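{- Let $A,B\subseteq N$ with $|A|=|B|=r$, and let $Z=D^TK^{ -1}D$. Then $$\det Z[A,B]=\frac{1}{\tau_c(G)}\sum_{F\in\mathcal F_{r+1}}\chi_F(A)\,\chi_F(B)\,w(F).$$
   Context: Network. $G=(V,E)$ is a finite connected simple undirected graph; each edge $e$ has a conductance $c_e\in\mathbb R_{>0}$. The weighted Laplacian $L_c$ is the $V\times V$ matrix with $(L_c)_{uu}=\sum_{e\ni u}c_e$, $(L_c)_{uv}=-c_{uv}$ if $uv\in E$, and $0$ otherwise. A spanning forest $F$ of $G$ is an acyclic subgraph with vertex set $V$ (isolated vertices allowed); $w(F)=\prod_{e\in F}c_e$; $\mathcal F_m$ is the set of spanning forests with exactly $m$ connected components. $\tau_c(G)=\sum_T\prod_{e\in T}c_e$, the sum over spanning trees $T$ of $G$. Matrix conventions. $A[S,T]$ is the submatrix with rows $S$ and columns $T$ in inherited order; $A[:,T]$ keeps all rows; empty determinants equal $1$. Superports. The boundary $M\subseteq V$ is nonempty and partitioned into nonempty superports $M=A_1\sqcup\cdots\sqcup A_p$. Choose a root $r_a\in A_a$ for each $a$; $R=\{r_1,\dots,r_p\}$, $N=M\setminus R$, $q=|N|$, $N=(x_1,\dots,x_q)$ in a fixed order; $r(x)$ is the root of the superport containing $x$. Fix a ground root $g\in R$. $K=L_c[V\setminus\{g\},V\setminus\{g\}]$. In $\mathbb R^{V\setminus\{g\}}$ with standard basis $(e_v)$ and the convention $e_g=0$, let $D$ be the matrix whose columns are $d_x=e_x-e_{r(x)}$, $x\in N$, in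 the fixed order. Quotient-incidence determinants. For a spanning forest $F$ with $s\ge1$ components, let $C_0(F)$ be the component containing $g$ and order the others as $C_1(F),\dots,C_{s-1}(F)$. Let $Q_F$ be the $(s-1)\times(|V|-1)$ matrix with columns indexed by $V\setminus\{g\}$ and $(Q_F)_{a,v}=1$ if $v\in C_a(F)$, $0$ otherwise ($1\le a\le s-1$), and $B_F=Q_FD$. For $S\subseteq N$ with $|S|=s-1$, $\chi_F(S)=\det B_F[:,S]$, with $\chi_F(\varnothing)=1$ when $s=1$. -}

module Defs where

open import Algebra.Bundles using (CommutativeRing)
import Algebra.Consequences.Setoid
import Algebra.Properties.CommutativeMonoid.Sum
import Algebra.Properties.Semiring.Exp
import Algebra.Properties.Semiring.Sum
open import Data.Bool.Base using (if_then_else_)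
open import Data.Fin.Base using (Fin; zero; suc; toℕ; fromℕ; fromℕ<; inject₁; punchIn; cast)
import Data.Fin.Base as Fin
import Data.Fin.Properties as Finₚ
open import Data.Fin.Permutation.Components using (transpose; transpose-inverse)
open import Data.Fin.Subset using (Subset; inside; outside; _∈_; Nonempty; ⊤) renaming (∣_∣ to card)
open import Data.Fin.Subset.Properties using (_∈?_)
open import Data.Nat.Base as ℕ using (ℕ; zero; suc; _⊔_)
import Data.Nat.Properties as ℕₚ
open import Data.Product using (Σ; ∃; _×_; _,_; proj₁; proj₂)
open import Data.Rational as ℚ using (ℚ; 0ℚ; 1ℚ; ½; 1/_; ∣_∣)
import Data.Rational.Properties as ℚₚ
open import Data.Rational.Solver using (module +-*-Solver)
open import Data.Sum.Base using (_⊎_; inj₁; inj₂)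
open import Data.Vec.Base using (Vec; []; _∷_; lookup; tabulate; here; there)
import Data.Vec.Properties as Vecₚ
open import Function.Base using (_∘_)
open import Function.Bundles using (_⇔_; mk⇔; Equivalence)
open import Level using (0ℓ)
open import Relation.Binary.Bundles using (Setoid)
open import Relation.Binary.Construct.Closure.ReflexiveTransitive as Star using (Star; _◅_; _◅◅_)
  renaming (ε to stop)
open import Relation.Binary.PropositionalEquality as ≡ using (_≡_; _≢_; refl; cong; cong₂; subst)
open import Relation.Nullary.Decidable as Dec
  using (Dec; yes; no; does; map′; ¬?; _×-dec_; _⊎-dec_; _→-dec_)
open import Relation.Nullary.Negation using (¬_)
open import Relation.Unary using (Decidable)

module Real where

  private
    open +-*-Solver using (solve; _:=_; _:+_; _:*_; _:-_; :-_; con)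

    dist : ℚ → ℚ → ℚ
    dist p q = ∣ p ℚ.- q ∣

    half-pos : ∀ {ε} → 0ℚ ℚ.< ε → 0ℚ ℚ.< ½ ℚ.* ε
    half-pos {ε} 0<ε = ℚₚ.positive⁻¹ _ {{ℚₚ.pos*pos⇒pos ½ ε {{ℚ.positive 0<ε}}}}

    ½ε+½ε : ∀ ε → ½ ℚ.* ε ℚ.+ ½ ℚ.* ε ≡ ε
    ½ε+½ε = solve 1 (λ e → con ½ :* e :+ con ½ :* e := e) refl

    0<* : ∀ {p q} → 0ℚ ℚ.< p → 0ℚ ℚ.< q → 0ℚ ℚ.< p ℚ.* q
    0<* {p} {q} 0<p 0<q =
      ℚₚ.positive⁻¹ _ {{ℚₚ.pos*pos⇒pos p {{ℚ.positive 0<p}} q {{ℚ.positive 0<q}}}}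

    dist-refl : ∀ p → dist p p ≡ 0ℚ
    dist-refl p = cong ∣_∣ (ℚₚ.+-inverseʳ p)

    dist-sym : ∀ p q → dist p q ≡ dist q p
    dist-sym p q = ≡.trans
      (cong ∣_∣ (solve 2 (λ p q → p :- q := :- (q :- p)) refl p q))
      (ℚₚ.∣-p∣≡∣p∣ (q ℚ.- p))

    ∣+∣< : ∀ {p q δ ε} → ∣ p ∣ ℚ.< δ → ∣ q ∣ ℚ.< ε → ∣ p ℚ.+ q ∣ ℚ.< δ ℚ.+ ε
    ∣+∣< {p} {q} p<δ q<ε = ℚₚ.≤-<-trans (ℚₚ.∣p+q∣≤∣p∣+∣q∣ p q) (ℚₚ.+-mono-< p<δ q<ε)

    ∣+∣<ε : ∀ {p q r ε} → r ≡ p ℚ.+ q → ∣ p ∣ ℚ.< ½ ℚ.* ε → ∣ q ∣ ℚ.< ½ ℚ.* ε → ∣ r ∣ ℚ.< ε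
    ∣+∣<ε {ε = ε} refl p<δ q<ε = subst (_ ℚ.<_) (½ε+½ε ε) (∣+∣< p<δ q<ε)

    dist-trans : ∀ p q r {ε} → dist p q ℚ.< ½ ℚ.* ε → dist q r ℚ.< ½ ℚ.* ε → dist p r ℚ.< ε
    dist-trans p q r = ∣+∣<ε {p ℚ.- q} {q ℚ.- r} (solve 3 (λ p q r → p :- r := (p :- q) :+ (q :- r)) refl p q r)

    dist-+ : ∀ p q p′ q′ {ε} → dist p p′ ℚ.< ½ ℚ.* ε → dist q q′ ℚ.< ½ ℚ.* ε →
             dist (p ℚ.+ q) (p′ ℚ.+ q′) ℚ.< ε
    dist-+ p q p′ q′ = ∣+∣<ε {p ℚ.- p′} {q ℚ.- q′}
      (solve 4 (λ p q p′ q′ → (p :+ q) :- (p′ :+ q′) := (p :- p′) :+ (q :- q′)) refl p q p′ q′)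

    dist-neg : ∀ p p′ {ε} → dist p p′ ℚ.< ε → dist (ℚ.- p) (ℚ.- p′) ℚ.< ε
    dist-neg p p′ = subst (ℚ._< _) (≡.trans (dist-sym p p′)
      (cong ∣_∣ (solve 2 (λ p q → q :- p := (:- p) :- (:- q)) refl p p′)))

    _/₊_ : ∀ (ε : ℚ) {b} → 0ℚ ℚ.< b → ℚ
    _/₊_ ε {b} 0<b = ε ℚ.* (1/ b) {{ℚₚ.pos⇒nonZero b {{ℚ.positive 0<b}}}}

    /₊-* : ∀ ε {b} (0<b : 0ℚ ℚ.< b) → b ℚ.* (ε /₊ 0<b) ≡ ε
    /₊-* ε {b} 0<b = ≡.trans
      (solve 3 (λ b e i → b :* (e :* i) := e :* (b :* i)) refl b ε _)
      (≡.trans (cong (ε ℚ.*_) (ℚₚ.*-inverseʳ b {{ℚₚ.pos⇒nonZero b {{ℚ.positive 0<b}}}}))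
        (ℚₚ.*-identityʳ ε))

    /₊-pos : ∀ {ε b} → 0ℚ ℚ.< ε → (0<b : 0ℚ ℚ.< b) → 0ℚ ℚ.< ε /₊ 0<b
    /₊-pos {ε} {b} 0<ε 0<b = 0<* 0<ε
      (ℚₚ.positive⁻¹ _ {{ℚₚ.1/pos⇒pos b {{ℚ.positive 0<b}}}})

    ∣*∣< : ∀ {p q B δ} → 0ℚ ℚ.< B → ∣ p ∣ ℚ.< B → ∣ q ∣ ℚ.< δ → ∣ p ℚ.* q ∣ ℚ.< B ℚ.* δ
    ∣*∣< {p} {q} {B} {δ} 0<B p<B q<δ = begin-strict
      ∣ p ℚ.* q ∣       ≡⟨ ℚₚ.∣p*q∣≡∣p∣*∣q∣ p q ⟩
      ∣ p ∣ ℚ.* ∣ q ∣   ≤⟨ ℚₚ.*-monoʳ-≤-nonNeg ∣ q ∣ {{ℚₚ.∣-∣-nonNeg q}} (ℚₚ.<⇒≤ p<B) ⟩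
      B ℚ.* ∣ q ∣       <⟨ ℚₚ.*-monoʳ-<-pos B {{ℚ.positive 0<B}} q<δ ⟩
      B ℚ.* δ           ∎
      where open ℚₚ.≤-Reasoning

    dist-* : ∀ p q p′ q′ {B ε} (0<B : 0ℚ ℚ.< B) → ∣ p ∣ ℚ.< B → ∣ q′ ∣ ℚ.< B →
             dist p p′ ℚ.< (½ ℚ.* ε) /₊ 0<B → dist q q′ ℚ.< (½ ℚ.* ε) /₊ 0<B →
             dist (p ℚ.* q) (p′ ℚ.* q′) ℚ.< ε
    dist-* p q p′ q′ {B} {ε} 0<B p<B q′<B dp dq = ∣+∣<ε {p ℚ.* (q ℚ.- q′)} {q′ ℚ.* (p ℚ.- p′)}
      (solve 4 (λ p q p′ q′ → (p :* q) :- (p′ :* q′) := p :* (q :- q′) :+ q′ :* (p :- p′))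
        refl p q p′ q′)
      (subst (_ ℚ.<_) (/₊-* _ 0<B) (∣*∣< {p} 0<B p<B dq))
      (subst (_ ℚ.<_) (/₊-* _ 0<B) (∣*∣< {q′} 0<B q′<B dp))

  Eventually : (ℕ → Set) → Set
  Eventually P = ∃ λ N → ∀ n → N ℕ.≤ n → P n

  Eventually₂ : (ℕ → ℕ → Set) → Set
  Eventually₂ P = ∃ λ N → ∀ m n → N ℕ.≤ m → N ℕ.≤ n → P m n

  -- Cauchy reals: rational Cauchy sequences carrying a modulus of convergence,
  -- identified by the setoid equality _≈_.
  record ℝ : Set where
    no-eta-equality
    field
      seq    : ℕ → ℚ
      cauchy : ∀ ε → 0ℚ ℚ.< ε → Eventually₂ λ m n → ∣ seq m ℚ.- seq n ∣ ℚ.< ε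
  open ℝ

  infix 4 _≈_
  record _≈_ (x y : ℝ) : Set where
    no-eta-equality
    field
      close : ∀ ε → 0ℚ ℚ.< ε → Eventually λ n → ∣ seq x n ℚ.- seq y n ∣ ℚ.< ε
  open _≈_

  -- Strict positivity must be witnessed by a rational lower bound: positivity of every
  -- term of the sequence would still allow the limit 0.
  Positive : ℝ → Set
  Positive x = ∃ λ δ → 0ℚ ℚ.< δ × Eventually λ n → δ ℚ.< seq x n

  private
    zip : ∀ {P Q R : ℕ → Set} → (∀ {n} → P n → Q n → R n) →
          Eventually P → Eventually Q → Eventually R
    zip f (M , p) (N , q) = M ⊔ N , λ n le →
      f (p n (ℕₚ.m⊔n≤o⇒m≤o M N le)) (q n (ℕₚ.m⊔n≤o⇒n≤o M N le))

    zip₂ : ∀ {P Q R : ℕ → ℕ → Set} → (∀ {m n} → P m n → Q m n → R m n) →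
           Eventually₂ P → Eventually₂ Q → Eventually₂ R
    zip₂ f (M , p) (N , q) = M ⊔ N , λ m n le le′ →
      f (p m n (ℕₚ.m⊔n≤o⇒m≤o M N le) (ℕₚ.m⊔n≤o⇒m≤o M N le′))
        (q m n (ℕₚ.m⊔n≤o⇒n≤o M N le) (ℕₚ.m⊔n≤o⇒n≤o M N le′))

    map-ev : ∀ {P Q : ℕ → Set} → (∀ {n} → P n → Q n) → Eventually P → Eventually Q
    map-ev f (N , p) = N , λ n le → f (p n le)

    const : ℚ → ℝ
    const p .seq _ = p
    const p .cauchy ε 0<ε = 0 , λ _ _ _ _ → subst (ℚ._< ε) (≡.sym (dist-refl p)) 0<ε

    ∣p∣<ε+∣q∣ : ∀ p q {ε} → dist p q ℚ.< ε → ∣ p ∣ ℚ.< ε ℚ.+ ∣ q ∣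
    ∣p∣<ε+∣q∣ p q {ε} d = subst (λ r → ∣ r ∣ ℚ.< ε ℚ.+ ∣ q ∣)
      (solve 2 (λ a b → (a :- b) :+ b := a) refl p q)
      (ℚₚ.≤-<-trans (ℚₚ.∣p+q∣≤∣p∣+∣q∣ (p ℚ.- q) q) (ℚₚ.+-monoˡ-< ∣ q ∣ d))

    bounded : ∀ x → ∃ λ B → 0ℚ ℚ.< B × Eventually λ n → ∣ seq x n ∣ ℚ.< B
    bounded x = let N , c = cauchy x 1ℚ (ℚₚ.positive⁻¹ 1ℚ)
                    b = λ n le → ∣p∣<ε+∣q∣ (seq x n) (seq x N) (c n N le ℕₚ.≤-refl)
      in 1ℚ ℚ.+ ∣ seq x N ∣ , ℚₚ.≤-<-trans (ℚₚ.0≤∣p∣ (seq x N)) (b N ℕₚ.≤-refl) , N , b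

    <-+ʳ : ∀ {p} q {r} → 0ℚ ℚ.< r → p ℚ.< q → p ℚ.< q ℚ.+ r
    <-+ʳ q {r} 0<r p<q = ℚₚ.<-trans p<q
      (subst (ℚ._< q ℚ.+ r) (ℚₚ.+-identityʳ q) (ℚₚ.+-monoʳ-< q 0<r))

    weaken : ∀ {p q B C} → 0ℚ ℚ.< B → 0ℚ ℚ.< C → p ℚ.< B → q ℚ.< C →
             p ℚ.< B ℚ.+ C × q ℚ.< B ℚ.+ C
    weaken {p} {q} {B} {C} 0<B 0<C p<B q<C =
      <-+ʳ B 0<C p<B , subst (q ℚ.<_) (ℚₚ.+-comm C B) (<-+ʳ C 0<B q<C)

    Bounded₂ : ℚ → ℝ → ℝ → Set
    Bounded₂ B x y = Eventually λ n → ∣ seq x n ∣ ℚ.< B × ∣ seq y n ∣ ℚ.< B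

    bounded₂ : ∀ x y → ∃ λ B → 0ℚ ℚ.< B × Bounded₂ B x y
    bounded₂ x y = go (bounded x) (bounded y)
      where
      go : (∃ λ B → 0ℚ ℚ.< B × Eventually λ n → ∣ seq x n ∣ ℚ.< B) →
           (∃ λ C → 0ℚ ℚ.< C × Eventually λ n → ∣ seq y n ∣ ℚ.< C) →
           ∃ λ B → 0ℚ ℚ.< B × Bounded₂ B x y
      go (B , 0<B , b) (C , 0<C , c) = B ℚ.+ C , <-+ʳ {0ℚ} B 0<C 0<B ,
        zip (λ {n} → weaken {∣ seq x n ∣} {∣ seq y n ∣} {B} {C} 0<B 0<C) b c

    pointwise : ∀ {x y} → (∀ n → seq x n ≡ seq y n) → x ≈ y
    pointwise {x} {y} eq .close ε 0<ε = 0 , λ n _ →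
      subst (λ q → dist (seq x n) q ℚ.< ε) (eq n) (subst (ℚ._< ε) (≡.sym (dist-refl (seq x n))) 0<ε)

  0ℝ 1ℝ : ℝ
  0ℝ = const 0ℚ
  1ℝ = const 1ℚ

  infixl 6 _+_
  infixl 7 _*_
  infix 8 -_

  _+_ _*_ : ℝ → ℝ → ℝ
  (x + y) .seq n = seq x n ℚ.+ seq y n
  (x + y) .cauchy ε 0<ε = zip₂
    (λ {m} {n} → dist-+ (seq x m) (seq y m) (seq x n) (seq y n))
    (cauchy x (½ ℚ.* ε) (half-pos 0<ε)) (cauchy y (½ ℚ.* ε) (half-pos 0<ε))
  (x * y) .seq n = seq x n ℚ.* seq y n
  (x * y) .cauchy ε 0<ε = go (bounded₂ x y)
    where
    go : (∃ λ B → 0ℚ ℚ.< B × Bounded₂ B x y) →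
         Eventually₂ λ m n → ∣ seq x m ℚ.* seq y m ℚ.- seq x n ℚ.* seq y n ∣ ℚ.< ε
    go (B , 0<B , N , b) = zip₂
        (λ {m} {n} (dx , dy) (bx , by) →
          dist-* (seq x m) (seq y m) (seq x n) (seq y n) 0<B bx by dx dy)
        (zip₂ _,_ (cauchy x δ 0<δ) (cauchy y δ 0<δ))
        (N , λ m n le le′ → proj₁ (b m le) , proj₂ (b n le′))
      where
      δ = (½ ℚ.* ε) /₊ 0<B
      0<δ = /₊-pos (half-pos 0<ε) 0<B

  -_ : ℝ → ℝ
  (- x) .seq n = ℚ.- seq x n
  (- x) .cauchy ε 0<ε = let N , c = cauchy x ε 0<ε in
    N , λ m n le le′ → dist-neg (seq x m) (seq x n) (c m n le le′)

  private
    ≈-refl : ∀ {x} → x ≈ x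
    ≈-refl = pointwise λ _ → refl

    ≈-sym : ∀ {x y} → x ≈ y → y ≈ x
    ≈-sym {x} {y} p .close ε 0<ε =
      map-ev (λ {n} → subst (ℚ._< ε) (dist-sym (seq x n) (seq y n))) (close p ε 0<ε)

    ≈-trans : ∀ {x y z} → x ≈ y → y ≈ z → x ≈ z
    ≈-trans {x} {y} {z} p q .close ε 0<ε =
      zip (λ {n} → dist-trans (seq x n) (seq y n) (seq z n))
        (close p (½ ℚ.* ε) (half-pos 0<ε)) (close q (½ ℚ.* ε) (half-pos 0<ε))

    +-cong : ∀ {x x′ y y′} → x ≈ x′ → y ≈ y′ → x + y ≈ x′ + y′
    +-cong {x} {x′} {y} {y′} p q .close ε 0<ε =
      zip (λ {n} → dist-+ (seq x n) (seq y n) (seq x′ n) (seq y′ n))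
        (close p (½ ℚ.* ε) (half-pos 0<ε)) (close q (½ ℚ.* ε) (half-pos 0<ε))

    *-cong : ∀ {x x′ y y′} → x ≈ x′ → y ≈ y′ → x * y ≈ x′ * y′
    *-cong {x} {x′} {y} {y′} p q .close ε 0<ε = go (bounded₂ x y′)
      where
      go : (∃ λ B → 0ℚ ℚ.< B × Bounded₂ B x y′) →
           Eventually λ n → ∣ seq x n ℚ.* seq y n ℚ.- seq x′ n ℚ.* seq y′ n ∣ ℚ.< ε
      go (B , 0<B , b) = zip
          (λ {n} (dx , dy) (bx , by) →
            dist-* (seq x n) (seq y n) (seq x′ n) (seq y′ n) 0<B bx by dx dy)
          (zip _,_ (close p δ 0<δ) (close q δ 0<δ)) b
        where
        δ = (½ ℚ.* ε) /₊ 0<B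
        0<δ = /₊-pos (half-pos 0<ε) 0<B

    -‿cong : ∀ {x y} → x ≈ y → - x ≈ - y
    -‿cong {x} {y} p .close ε 0<ε =
      map-ev (λ {n} → dist-neg (seq x n) (seq y n)) (close p ε 0<ε)

  private
    +-assoc : ∀ x y z → (x + y) + z ≈ x + (y + z)
    +-assoc x y z = pointwise {(x + y) + z} {x + (y + z)}
      λ n → ℚₚ.+-assoc (seq x n) (seq y n) (seq z n)

    +-comm : ∀ x y → x + y ≈ y + x
    +-comm x y = pointwise {x + y} {y + x} λ n → ℚₚ.+-comm (seq x n) (seq y n)

    +-identityˡ : ∀ x → 0ℝ + x ≈ x
    +-identityˡ x = pointwise {0ℝ + x} {x} λ n → ℚₚ.+-identityˡ (seq x n)

    -‿inverseˡ : ∀ x → (- x) + x ≈ 0ℝ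
    -‿inverseˡ x = pointwise {(- x) + x} {0ℝ} λ n → ℚₚ.+-inverseˡ (seq x n)

    *-assoc : ∀ x y z → (x * y) * z ≈ x * (y * z)
    *-assoc x y z = pointwise {(x * y) * z} {x * (y * z)}
      λ n → ℚₚ.*-assoc (seq x n) (seq y n) (seq z n)

    *-comm : ∀ x y → x * y ≈ y * x
    *-comm x y = pointwise {x * y} {y * x} λ n → ℚₚ.*-comm (seq x n) (seq y n)

    *-identityˡ : ∀ x → 1ℝ * x ≈ x
    *-identityˡ x = pointwise {1ℝ * x} {x} λ n → ℚₚ.*-identityˡ (seq x n)

    *-distribˡ-+ : ∀ x y z → x * (y + z) ≈ x * y + x * z
    *-distribˡ-+ x y z = pointwise {x * (y + z)} {x * y + x * z}
      λ n → ℚₚ.*-distribˡ-+ (seq x n) (seq y n) (seq z n)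

  ℝ-setoid : Setoid 0ℓ 0ℓ
  ℝ-setoid = record
    { Carrier = ℝ ; _≈_ = _≈_
    ; isEquivalence = record { refl = ≈-refl ; sym = ≈-sym ; trans = ≈-trans } }

  open Algebra.Consequences.Setoid ℝ-setoid
    using (comm∧idˡ⇒id; comm∧invˡ⇒inv; comm∧distrˡ⇒distr)

  ℝ-commutativeRing : CommutativeRing 0ℓ 0ℓ
  ℝ-commutativeRing = record
    { Carrier = ℝ ; _≈_ = _≈_ ; _+_ = _+_ ; _*_ = _*_ ; -_ = -_ ; 0# = 0ℝ ; 1# = 1ℝ
    ; isCommutativeRing = record
      { isRing = record
        { +-isAbelianGroup = record
          { isGroup = record
            { isMonoid = record
              { isSemigroup = record
                { isMagma = record { isEquivalence = Setoid.isEquivalence ℝ-setoid ; ∙-cong = +-cong }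
                ; assoc = +-assoc }
              ; identity = comm∧idˡ⇒id {_+_} +-comm {0ℝ} +-identityˡ }
            ; inverse = comm∧invˡ⇒inv {_+_} { -_ } {0ℝ} +-comm -‿inverseˡ
            ; ⁻¹-cong = -‿cong }
          ; comm = +-comm }
        ; *-cong = *-cong
        ; *-assoc = *-assoc
        ; *-identity = comm∧idˡ⇒id {_*_} *-comm {1ℝ} *-identityˡ
        ; distrib = comm∧distrˡ⇒distr {_*_} {_+_} +-cong *-comm *-distribˡ-+ }
      ; *-comm = *-comm } }

  private
    1/₊ : ∀ {p} → 0ℚ ℚ.< p → ℚ
    1/₊ {p} 0<p = (1/ p) {{ℚₚ.pos⇒nonZero p {{ℚ.positive 0<p}}}}

    *1/₊ : ∀ {p} (0<p : 0ℚ ℚ.< p) → p ℚ.* 1/₊ 0<p ≡ 1ℚ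
    *1/₊ {p} 0<p = ℚₚ.*-inverseʳ p {{ℚₚ.pos⇒nonZero p {{ℚ.positive 0<p}}}}

    dist-1/₊ : ∀ δ p q ε → 0ℚ ℚ.< δ → 0ℚ ℚ.< ε → δ ℚ.< p → δ ℚ.< q →
               (0<p : 0ℚ ℚ.< p) (0<q : 0ℚ ℚ.< q) →
               dist p q ℚ.< ε ℚ.* (δ ℚ.* δ) → dist (1/₊ 0<p) (1/₊ 0<q) ℚ.< ε
    dist-1/₊ δ p q ε 0<δ 0<ε δ<p δ<q 0<p 0<q d =
      ℚₚ.*-cancelʳ-<-nonNeg (p ℚ.* q) {{ℚ.nonNegative (ℚₚ.<⇒≤ 0<pq)}} (begin-strict
        dist i j ℚ.* (p ℚ.* q)
          ≡⟨ cong (dist i j ℚ.*_) {x = p ℚ.* q} (≡.sym (ℚₚ.0≤p⇒∣p∣≡p (ℚₚ.<⇒≤ 0<pq))) ⟩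
        dist i j ℚ.* ∣ p ℚ.* q ∣
          ≡⟨ ℚₚ.∣p*q∣≡∣p∣*∣q∣ (i ℚ.- j) (p ℚ.* q) ⟨
        ∣ (i ℚ.- j) ℚ.* (p ℚ.* q) ∣
          ≡⟨ cong ∣_∣ (clear i j) ⟩
        dist ((p ℚ.* i) ℚ.* q) ((q ℚ.* j) ℚ.* p)
          ≡⟨ cong₂ (λ a b → dist (a ℚ.* q) (b ℚ.* p)) (*1/₊ 0<p) (*1/₊ 0<q) ⟩
        dist (1ℚ ℚ.* q) (1ℚ ℚ.* p)
          ≡⟨ cong₂ dist (ℚₚ.*-identityˡ q) (ℚₚ.*-identityˡ p) ⟩
        dist q p
          ≡⟨ dist-sym q p ⟩
        dist p q
          <⟨ d ⟩
        ε ℚ.* (δ ℚ.* δ)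
          <⟨ ℚₚ.*-monoʳ-<-pos ε {{ℚ.positive 0<ε}} δδ<pq ⟩
        ε ℚ.* (p ℚ.* q) ∎)
      where
      open ℚₚ.≤-Reasoning
      i = 1/₊ 0<p
      j = 1/₊ 0<q
      clear : ∀ i j → (i ℚ.- j) ℚ.* (p ℚ.* q) ≡ (p ℚ.* i) ℚ.* q ℚ.- (q ℚ.* j) ℚ.* p
      clear i j = solve 4 (λ i j p q →
        (i :- j) :* (p :* q) := (p :* i) :* q :- (q :* j) :* p) refl i j p q
      0<pq : 0ℚ ℚ.< p ℚ.* q
      0<pq = 0<* 0<p 0<q
      δδ<pq : δ ℚ.* δ ℚ.< p ℚ.* q
      δδ<pq = ℚₚ.<-trans (ℚₚ.*-monoʳ-<-pos δ {{ℚ.positive 0<δ}} δ<q)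
                         (ℚₚ.*-monoˡ-<-pos q {{ℚ.positive (ℚₚ.<-trans 0<δ δ<q)}} δ<p)

    shift : ℕ → ℝ → ℝ
    shift N x .seq n = seq x (N ℕ.+ n)
    shift N x .cauchy ε 0<ε = let M , c = cauchy x ε 0<ε in M , λ m n le le′ →
      c (N ℕ.+ m) (N ℕ.+ n) (ℕₚ.≤-trans le (ℕₚ.m≤n+m m N)) (ℕₚ.≤-trans le′ (ℕₚ.m≤n+m n N))

    shift-≈ : ∀ N x → x ≈ shift N x
    shift-≈ N x .close ε 0<ε = let M , c = cauchy x ε 0<ε in
      M , λ n le → c n (N ℕ.+ n) le (ℕₚ.≤-trans le (ℕₚ.m≤n+m n N))

    recip-shift : ∀ x {δ} → 0ℚ ℚ.< δ → (∀ n → δ ℚ.< seq x n) → ℝ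
    recip-shift x 0<δ δ<x .seq n = 1/₊ (ℚₚ.<-trans 0<δ (δ<x n))
    recip-shift x {δ} 0<δ δ<x .cauchy ε 0<ε =
      let M , c = cauchy x (ε ℚ.* (δ ℚ.* δ)) (0<* 0<ε (0<* 0<δ 0<δ)) in M , λ m n le le′ →
      dist-1/₊ δ (seq x m) (seq x n) ε 0<δ 0<ε (δ<x m) (δ<x n)
        (ℚₚ.<-trans 0<δ (δ<x m)) (ℚₚ.<-trans 0<δ (δ<x n)) (c m n le le′)

  -- The reciprocal is taken from the index on where x exceeds its positive lower bound.
  recip : (x : ℝ) → Positive x → ℝ
  recip x (δ , 0<δ , N , δ<x) =
    recip-shift (shift N x) 0<δ (λ n → δ<x (N ℕ.+ n) (ℕₚ.m≤m+n N n))

  recip-inverseʳ : ∀ x (x>0 : Positive x) → x * recip x x>0 ≈ 1ℝ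
  recip-inverseʳ x x>0@(δ , 0<δ , N , δ<x) = ≈-trans
    (*-cong (shift-≈ N x) (≈-refl {recip x x>0}))
    (pointwise {shift N x * recip x x>0} {1ℝ}
      λ n → *1/₊ (ℚₚ.<-trans 0<δ (δ<x (N ℕ.+ n) (ℕₚ.m≤m+n N n))))

-- Edges are indexed by Fin size.  Edge e is the unordered pair {lo e , hi e}, stored
-- increasingly, so that loops are excluded by lo<hi and parallel edges by simple.
record SimpleGraph (n : ℕ) : Set where
  field
    size   : ℕ
    lo hi  : Fin size → Fin n
    lo<hi  : ∀ e → lo e Fin.< hi e
    simple : ∀ {e f} → lo e ≡ lo f → hi e ≡ hi f → e ≡ f

  Incident : Fin size → Fin n → Set
  Incident e v = lo e ≡ v ⊎ hi e ≡ v

  Joins : Fin size → Fin n → Fin n → Set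
  Joins e u v = (lo e ≡ u × hi e ≡ v) ⊎ (lo e ≡ v × hi e ≡ u)

  incident? : ∀ e v → Dec (Incident e v)
  incident? e v = lo e Finₚ.≟ v ⊎-dec hi e Finₚ.≟ v

  joins? : ∀ e u v → Dec (Joins e u v)
  joins? e u v = (lo e Finₚ.≟ u ×-dec hi e Finₚ.≟ v) ⊎-dec (lo e Finₚ.≟ v ×-dec hi e Finₚ.≟ u)

-- A spanning subgraph (one with all vertices of G) is given by its set of edges F.
module _ {n : ℕ} (G : SimpleGraph n) where
  open SimpleGraph G

  Adjacent : Subset size → Fin n → Fin n → Set
  Adjacent F u v = ∃ λ e → e ∈ F × Joins e u v

  Reachable : Subset size → Fin n → Fin n → Set
  Reachable F = Star (Adjacent F)

  Connected : Subset size → Set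
  Connected F = ∀ u v → Reachable F u v

  IsCycle : Subset size → ∀ {k} → Vec (Fin n) (3 ℕ.+ k) → Set
  IsCycle F {k} vs =
      (∀ i j → lookup vs i ≡ lookup vs j → i ≡ j)
    × (∀ (i : Fin (2 ℕ.+ k)) → Adjacent F (lookup vs (inject₁ i)) (lookup vs (suc i)))
    × Adjacent F (lookup vs (fromℕ (2 ℕ.+ k))) (lookup vs zero)

  Acyclic : Subset size → Set
  Acyclic F = ¬ (∃ λ k → ∃ λ (vs : Vec (Fin n) (3 ℕ.+ k)) → IsCycle F vs)

  -- F has exactly s connected components, numbered by Fin s.
  record Components (F : Subset size) (s : ℕ) : Set where
    field
      component  : Fin n → Fin s
      surjective : ∀ a → ∃ λ v → component v ≡ a
      classes    : ∀ u v → component u ≡ component v ⇔ Reachable F u v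

  IsSpanningForest : ℕ → Subset size → Set
  IsSpanningForest s F = Acyclic F × Components F s

  IsSpanningTree : Subset size → Set
  IsSpanningTree T = Acyclic T × Connected T

  -- C₀(F) is the component of g; the order of the remaining ones is arbitrary.
  record ComponentOrder (g : Fin n) (F : Subset size) (r : ℕ) : Set where
    field
      components : Components F (suc r)
    open Components components public
    field
      ground : component g ≡ zero

  componentOrder : ∀ g {F r} → Components F (suc r) → ComponentOrder g F r
  componentOrder g {F} {r} C = record
    { components = record
      { component  = swap ∘ component
      ; surjective = λ a → let v , eq = surjective (unswap a) in
          v , ≡.trans (cong swap eq) (transpose-inverse (component g) zero {a})
      ; classes    = λ u v → mk⇔
          (λ eq → Equivalence.to (classes u v) (swap-injective eq))
          (λ p → cong swap (Equivalence.from (classes u v) p)) }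
    ; ground = swap-g }
    where
    open Components C
    swap unswap : Fin (suc r) → Fin (suc r)
    swap   = transpose (component g) zero
    unswap = transpose zero (component g)
    swap-injective : ∀ {i j} → swap i ≡ swap j → i ≡ j
    swap-injective {i} {j} eq = ≡.trans (≡.sym (transpose-inverse zero (component g)))
      (≡.trans (cong unswap eq) (transpose-inverse zero (component g)))
    swap-g : swap (component g) ≡ zero
    swap-g with component g Finₚ.≟ component g
    ... | yes _ = refl
    ... | no ≢  with () ← ≢ refl

  private
    Link : ∀ {m} → (Fin m → Fin n) → (Fin m → Fin n) → Subset m → Fin n → Fin n → Set
    Link a b F u v = ∃ λ e → e ∈ F × ((a e ≡ u × b e ≡ v) ⊎ (a e ≡ v × b e ≡ u))

    link? : ∀ {m} (a b : Fin m → Fin n) (F : Subset m) u v → Dec (Star (Link a b F) u v)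
    link? {zero} a b [] u v = map′ (λ where refl → stop) (λ where stop → refl) (u Finₚ.≟ v)
    link? {suc m} a b (outside ∷ F) u v =
      map′ (Star.map λ (e , p , j) → suc e , there p , j) (Star.map down)
        (link? (a ∘ suc) (b ∘ suc) F u v)
      where
      down : ∀ {u v} → Link a b (outside ∷ F) u v → Link (a ∘ suc) (b ∘ suc) F u v
      down (suc e , there p , j) = e , p , j
    link? {suc m} a b (inside ∷ F) u v = map′ to from
      (R? u v ⊎-dec (R? u (a zero) ×-dec R? (b zero) v) ⊎-dec (R? u (b zero) ×-dec R? (a zero) v))
      where
      R = Star (Link (a ∘ suc) (b ∘ suc) F)
      R? = link? (a ∘ suc) (b ∘ suc) F
      Via : Fin n → Fin n → Set
      Via u v = R u v ⊎ (R u (a zero) × R (b zero) v) ⊎ (R u (b zero) × R (a zero) v)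
      up : ∀ {u v} → R u v → Star (Link a b (inside ∷ F)) u v
      up = Star.map λ (e , p , j) → suc e , there p , j
      to : ∀ {u v} → Via u v → Star (Link a b (inside ∷ F)) u v
      to (inj₁ p) = up p
      to (inj₂ (inj₁ (p , q))) = up p ◅◅ (zero , here , inj₁ (refl , refl)) ◅ up q
      to (inj₂ (inj₂ (p , q))) = up p ◅◅ (zero , here , inj₂ (refl , refl)) ◅ up q
      from : ∀ {u v} → Star (Link a b (inside ∷ F)) u v → Via u v
      from stop = inj₁ stop
      from ((suc e , there p , j) ◅ s) with from s
      ... | inj₁ q              = inj₁ ((e , p , j) ◅ q)
      ... | inj₂ (inj₁ (q , t)) = inj₂ (inj₁ ((e , p , j) ◅ q , t))
      ... | inj₂ (inj₂ (q , t)) = inj₂ (inj₂ ((e , p , j) ◅ q , t))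
      from ((zero , _ , inj₁ (refl , refl)) ◅ s) with from s
      ... | inj₁ q              = inj₂ (inj₁ (stop , q))
      ... | inj₂ (inj₁ (_ , t)) = inj₂ (inj₁ (stop , t))
      ... | inj₂ (inj₂ (_ , t)) = inj₁ t
      from ((zero , _ , inj₂ (refl , refl)) ◅ s) with from s
      ... | inj₁ q              = inj₂ (inj₂ (stop , q))
      ... | inj₂ (inj₁ (_ , t)) = inj₁ t
      ... | inj₂ (inj₂ (_ , t)) = inj₂ (inj₂ (stop , t))

    anyVec? : ∀ {m k} {P : Vec (Fin m) k → Set} → Decidable P → Dec (∃ P)
    anyVec? {k = zero}  P? = map′ ([] ,_) (λ where ([] , p) → p) (P? [])
    anyVec? {k = suc k} P? =
      map′ (λ (x , xs , p) → x ∷ xs , p) (λ where (x ∷ xs , p) → x , xs , p)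
        (Finₚ.any? λ x → anyVec? λ xs → P? (x ∷ xs))

    isCycle? : ∀ F {k} → Decidable (IsCycle F {k})
    isCycle? F vs =
      Finₚ.all? (λ i → Finₚ.all? λ j → (lookup vs i Finₚ.≟ lookup vs j) →-dec (i Finₚ.≟ j))
      ×-dec Finₚ.all? (λ i → adjacent? _ _) ×-dec adjacent? _ _
      where
      adjacent? : ∀ u v → Dec (Adjacent F u v)
      adjacent? u v = Finₚ.any? λ e → (e ∈? F) ×-dec joins? e u v

  reachable? : ∀ F u v → Dec (Reachable F u v)
  reachable? = link? lo hi

  connected? : Decidable Connected
  connected? F = Finₚ.all? λ u → Finₚ.all? λ v → reachable? F u v

  acyclic? : Decidable Acyclic
  acyclic? F = ¬? (map′ (λ (k , c) → toℕ k , c) bound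
    (Finₚ.any? {n} λ k → anyVec? λ vs → isCycle? F {toℕ k} vs))
    where
    bound : (∃ λ k → ∃ λ vs → IsCycle F {k} vs) → ∃ λ (k : Fin n) → ∃ λ vs → IsCycle F {toℕ k} vs
    bound (k , vs , c) = fromℕ< k<n ,
      subst (λ k → ∃ λ vs → IsCycle F {k} vs) (≡.sym (Finₚ.toℕ-fromℕ< k<n)) (vs , c)
      where
      k<n : k ℕ.< n
      k<n = ℕₚ.≤-trans (ℕ.s≤s (ℕₚ.m≤n+m k 2)) (Finₚ.injective⇒≤ (λ {i} {j} → proj₁ c i j))

  components? : ∀ s F → Dec (Components F s)
  components? s F = map′ fromVec toVec (anyVec? λ vs →
      Finₚ.all? (λ a → Finₚ.any? λ v → lookup vs v Finₚ.≟ a)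
      ×-dec Finₚ.all? λ u → Finₚ.all? λ v →
        ((lookup vs u Finₚ.≟ lookup vs v) →-dec reachable? F u v)
        ×-dec (reachable? F u v →-dec (lookup vs u Finₚ.≟ lookup vs v)))
    where
    IsLabelling : (Fin n → Fin s) → Set
    IsLabelling f = (∀ a → ∃ λ v → f v ≡ a)
                  × (∀ u v → (f u ≡ f v → Reachable F u v) × (Reachable F u v → f u ≡ f v))
    fromVec : (∃ λ vs → IsLabelling (lookup vs)) → Components F s
    fromVec (vs , sur , cls) = record
      { component = lookup vs ; surjective = sur
      ; classes = λ u v → mk⇔ (proj₁ (cls u v)) (proj₂ (cls u v)) }
    toVec : Components F s → ∃ λ vs → IsLabelling (lookup vs)
    toVec C = tabulate component
      , (λ a → let v , eq = surjective a in v , ≡.trans (look v) eq)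
      , λ u v → (λ eq → Equivalence.to (classes u v) (≡.trans (≡.sym (look u)) (≡.trans eq (look v))))
              , (λ p → ≡.trans (look u) (≡.trans (Equivalence.from (classes u v) p) (≡.sym (look v))))
      where
      open Components C
      look = Vecₚ.lookup∘tabulate component

  isSpanningForest? : ∀ s → Decidable (IsSpanningForest s)
  isSpanningForest? s F = acyclic? F ×-dec components? s F

  isSpanningTree? : Decidable IsSpanningTree
  isSpanningTree? T = acyclic? T ×-dec connected? T

record Superports (n : ℕ) : Set where
  field
    boundary  : Subset n
    nonempty  : Nonempty boundary
    p         : ℕ
    superport : Fin p → Subset n
    partition : ∀ v → v ∈ boundary ⇔ (∃ λ a → v ∈ superport a)
    disjoint  : ∀ {a b v} → v ∈ superport a → v ∈ superport b → a ≡ b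
    root      : Fin p → Fin n
    root∈     : ∀ a → root a ∈ superport a

  NonRoot : Fin n → Set
  NonRoot v = v ∈ boundary × (∀ a → v ≢ root a)

  rootOf : ∀ {v} → v ∈ boundary → Fin n
  rootOf {v} v∈ = root (proj₁ (Equivalence.to (partition v) v∈))

-- N = M ∖ R listed in a fixed order x₁, …, x_q.
record NonRoots {n : ℕ} (P : Superports n) : Set where
  open Superports P
  field
    q         : ℕ
    x         : Fin q → Fin n
    injective : ∀ {i j} → x i ≡ x j → i ≡ j
    nonRoot   : ∀ i → NonRoot (x i)
    complete  : ∀ v → NonRoot v → ∃ λ i → x i ≡ v

-- The elements of S in increasing order.
elements : ∀ {q} (S : Subset q) → Fin (card S) → Fin q
elements (inside  ∷ S) zero    = zero
elements (inside  ∷ S) (suc i) = suc (elements S i)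
elements (outside ∷ S) i       = suc (elements S i)

select : ∀ {q r} (S : Subset q) → card S ≡ r → Fin r → Fin q
select S eq i = elements S (cast (≡.sym eq) i)

module Network {a ℓ} (R : CommutativeRing a ℓ) where
  open CommutativeRing R using (_≈_; _+_; _*_; _-_; -_; 0#; 1#; semiring; *-commutativeMonoid)
    renaming (Carrier to A)
  open Algebra.Properties.Semiring.Sum semiring using (sum; sum-syntax)
  open Algebra.Properties.Semiring.Exp semiring using (_^_)
  open Algebra.Properties.CommutativeMonoid.Sum *-commutativeMonoid
    using () renaming (sum to product)

  Matrix : ℕ → ℕ → Set a
  Matrix m n = Fin m → Fin n → A

  infixl 7 _⊗_
  infix 9 _ᵀ

  _⊗_ : ∀ {m n k} → Matrix m n → Matrix n k → Matrix m k
  _⊗_ {n = n} X Y i k = ∑[ j < n ] (X i j * Y j k)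

  _ᵀ : ∀ {m n} → Matrix m n → Matrix n m
  (X ᵀ) i j = X j i

  [_]₀₁ : ∀ {P : Set} → Dec P → A
  [ P? ]₀₁ = if does P? then 1# else 0#

  identity : ∀ n → Matrix n n
  identity n i j = [ i Finₚ.≟ j ]₀₁

  IsInverse : ∀ {n} → Matrix n n → Matrix n n → Set ℓ
  IsInverse {n} X Y = (∀ i j → (X ⊗ Y) i j ≈ identity n i j) × (∀ i j → (Y ⊗ X) i j ≈ identity n i j)

  submatrix : ∀ {m n k l} → Matrix m n → (Fin k → Fin m) → (Fin l → Fin n) → Matrix k l
  submatrix X f g i j = X (f i) (g j)

  det : ∀ {n} → Matrix n n → A
  det {zero}  X = 1#
  det {suc n} X = ∑[ j < suc n ] ((- 1#) ^ toℕ j * X zero j * det (submatrix X suc (punchIn j)))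

  sumSubsets : ∀ {m} → (Subset m → A) → A
  sumSubsets {zero}  f = f []
  sumSubsets {suc m} f = sumSubsets (f ∘ (outside ∷_)) + sumSubsets (f ∘ (inside ∷_))

  whenever : ∀ {P : Set} → Dec P → (P → A) → A
  whenever (yes p) f = f p
  whenever (no _)  f = 0#

  sumOver : ∀ {m} {P : Subset m → Set} → Decidable P → (∀ F → P F → A) → A
  sumOver P? f = sumSubsets λ F → whenever (P? F) (f F)

  module _ {n : ℕ} (G : SimpleGraph n) (c : Fin (SimpleGraph.size G) → A) where
    open SimpleGraph G

    weight : Subset size → A
    weight F = product λ e → if lookup F e then c e else 1#

    τ : A
    τ = sumOver (isSpanningTree? G) λ T _ → weight T

    laplacian : Matrix n n
    laplacian u v with u Finₚ.≟ v
    ... | yes _ = ∑[ e < size ] (if does (incident? e u) then c e else 0#)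
    ... | no  _ with Finₚ.any? (λ e → joins? e u v)
    ...   | yes (e , _) = - c e
    ...   | no  _       = 0#

  -- V ∖ {g} is indexed by Fin n through the order-preserving punchIn g.
  module _ {n : ℕ} (g : Fin (suc n)) where

    reducedLaplacian : (G : SimpleGraph (suc n)) → (Fin (SimpleGraph.size G) → A) → Matrix n n
    reducedLaplacian G c = submatrix (laplacian G c) (punchIn g) (punchIn g)

    -- basis g = 0, since punchIn g never takes the value g.
    basis : Fin (suc n) → Fin n → A
    basis v i = [ punchIn g i Finₚ.≟ v ]₀₁

    rootDifferences : {P : Superports (suc n)} (N : NonRoots P) → Matrix n (NonRoots.q N)
    rootDifferences {P} N i j = basis (x j) i - basis (rootOf (proj₁ (nonRoot j))) i
      where
      open Superports P
      open NonRoots N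

    module _ {G : SimpleGraph (suc n)} {F : Subset (SimpleGraph.size G)} {r : ℕ}
             (C : ComponentOrder G g F r) {P : Superports (suc n)} (N : NonRoots P) where
      open ComponentOrder C
      open NonRoots N using (q)

      quotient : Matrix r n
      quotient a i = [ component (punchIn g i) Finₚ.≟ suc a ]₀₁

      quotientIncidence : Matrix r q
      quotientIncidence = quotient ⊗ rootDifferences N

      χ : (S : Subset q) → card S ≡ r → A
      χ S ∣S∣≡r = det (submatrix quotientIncidence (λ a → a) (select S ∣S∣≡r))

open Real public using (ℝ; Positive; recip)
open CommutativeRing Real.ℝ-commutativeRing public using (_≈_; _*_)
open Network Real.ℝ-commutativeRing public

-- For an n × n matrix K and lists X, Y of r vectors, let Φ(K) = det [ 0 , - X ; Yᵀ , K ], the rows of X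
-- being the border vectors.  A rank-one change of K by c b bᵀ adds c times the same determinant
-- bordered once more by b, so Φ(Σ c_e b_e b_eᵀ) is the sum over edge sets F of w(F) times Φ(0) bordered
-- by X, Y and the vectors of F.  If F is a forest, deleting its edges one by one and row-reducing
-- with pivot ± 1 identifies this coefficient with det(Q_F X) det(Q_F Y); the sign occurs twice and
-- cancels.  If F has a cycle or the wrong number of components, the coefficient vanishes.
-- For invertible K, elimination gives Φ(K) = det(X K⁻¹ Yᵀ) det K; the case r = 0 is the
-- matrix-tree theorem det K = τ.
module Submission where

open import Algebra.Bundles using (CommutativeRing)
import Algebra.Properties.CommutativeMonoid.Sum
import Algebra.Properties.Ring
import Algebra.Properties.Semiring.Exp
import Algebra.Properties.Semiring.Sum
import Algebra.Solver.Ring.NaturalCoefficients.Default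
open import Data.Bool.Base using (if_then_else_; true; false)
open import Data.Empty using (⊥-elim)
open import Data.Fin.Base as Fin using (Fin; zero; suc; toℕ; fromℕ; inject₁; lift; punchIn; punchOut; splitAt; _↑ˡ_; _↑ʳ_)
import Data.Fin.Properties as Finₚ
open import Data.Fin.Subset using (Subset; inside; outside; _∈_; ⊤) renaming (∣_∣ to card)
open import Data.Nat.Base as ℕ using (ℕ; zero; suc; _⊔_)
import Data.Nat.Properties as ℕₚ
open import Data.Product using (Σ; ∃; _×_; _,_; proj₁; proj₂)
open import Data.Rational as ℚ using (ℚ; 0ℚ; 1ℚ; ½)
import Data.Rational.Properties as ℚₚ
open import Data.Sum.Base using (_⊎_; inj₁; inj₂)
open import Data.Vec.Base as Vec using (Vec; lookup; here; there)
open import Data.Vec.Functional using (Vector; []; _∷_; _++_; tail; insertAt; updateAt)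
open import Data.Vec.Functional.Properties using (updateAt-updates; updateAt-minimal; updateAt-updateAt; insertAt-lookup; insertAt-punchIn; insertAt-removeAt; lookup-++ˡ; lookup-++ʳ)
open import Data.Vec.Membership.Propositional using () renaming (_∈_ to _∈ᵥ_)
open import Data.Vec.Relation.Unary.All as All using (All)
import Data.Vec.Relation.Unary.AllPairs as AllPairs
open import Data.Vec.Relation.Unary.Any using (here; there; any?)
open import Data.Vec.Relation.Unary.Unique.Propositional using (Unique)
open import Data.Vec.Relation.Unary.Unique.Propositional.Properties using (lookup-injective)
open import Function.Base using (_∘_; id; const)
open import Function.Bundles using (mk⇔; Equivalence)
import Level
open import Relation.Binary.Construct.Closure.ReflexiveTransitive as Star using (Star; _◅_; _◅◅_) renaming (ε to stop)
open import Relation.Binary.Definitions using (tri<; tri≈; tri>)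
open import Relation.Binary.PropositionalEquality as ≡ using (_≡_; _≢_; _≗_; subst)
import Relation.Binary.Reasoning.Setoid
open import Relation.Nullary.Decidable using (Dec; yes; no; does; from-yes)
open import Relation.Nullary.Negation using (¬_)
open import Relation.Unary using (Decidable)
open import Defs using (module Network; SimpleGraph; Adjacent; Reachable; Acyclic; Connected; Components; ComponentOrder; IsSpanningForest; IsSpanningTree; isSpanningForest?; isSpanningTree?; componentOrder; reachable?)

-- Everything except the positivity of `τ` holds over an arbitrary commutative ring. This is forced
-- by the reals: whether a real is zero is undecidable, so elimination may divide only by pivots
-- known to be 1 or -1, and `K` must be inverted by Cramer's rule from a given inverse of its
-- determinant. The matrix-tree theorem therefore comes before the existence of the inverse of `K`.
-- Determinants are handled without permutations and without Cauchy-Binet: the working principle is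
-- that an alternating functional of n vectors of length n is a multiple of `det`. The entry `- X`
-- rather than `X` in the border makes a rank-one change contribute with a plus sign and makes the
-- determinant of [ 0 , - I ; I , 0 ] equal to 1, so no sign depends on r or n. The order of the
-- components is arbitrary, so each χ is determined only up to sign. Deleting an edge produces an
-- order of its own, so the coefficient formula is proved for every order at once. Acyclicity,
-- defined by vertex cycles, does not pass easily to fewer edges; it is replaced by the equivalent
-- condition that every edge is a bridge.

-- Alternating functionals of row vectors, and determinants over a commutative ring.

module Determinant {a ℓ} (R : CommutativeRing a ℓ) where
  open CommutativeRing R hiding (zero) renaming (Carrier to A)
  open Network R using (Matrix; det; _⊗_; _ᵀ; identity; submatrix)
  open Algebra.Properties.Ring ring using (-‿involutive; -1*x≈-x; +-inverseˡ-unique)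
  open Algebra.Properties.Semiring.Exp semiring using (_^_)
  open Algebra.Properties.Semiring.Sum semiring
    using (sum; sum-syntax; sum-cong-≋; ∑-distrib-+; ∑-comm; sum-remove; sum-replicate-zero; *-distribˡ-sum)
  open Algebra.Solver.Ring.NaturalCoefficients.Default commutativeSemiring using (solve; _:=_; _:+_; _:*_)
  open Relation.Binary.Reasoning.Setoid setoid

  private
    variable
      k m n : ℕ

  infix 4 _≋_
  _≋_ : Vector A n → Vector A n → Set ℓ
  u ≋ v = ∀ i → u i ≈ v i

  sum-zero : {t : Vector A n} → (∀ i → t i ≈ 0#) → sum t ≈ 0#
  sum-zero {n} t≈0 = trans (sum-cong-≋ t≈0) (sum-replicate-zero n)

  sum-single : ∀ (t : Vector A n) i → (∀ j → j ≢ i → t j ≈ 0#) → sum t ≈ t i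
  sum-single {suc n} t i t≈0 = begin
    sum t                            ≈⟨ sum-remove {i = i} t ⟩
    t i + sum (λ j → t (punchIn i j)) ≈⟨ +-congˡ (sum-zero λ j → t≈0 _ (Finₚ.punchInᵢ≢i i j)) ⟩
    t i + 0#                         ≈⟨ +-identityʳ _ ⟩
    t i                              ∎

  sum-linear : ∀ s (t u : Vector A n) → ∑[ i < n ] (t i + s * u i) ≈ sum t + s * sum u
  sum-linear s t u = trans (∑-distrib-+ t _) (+-congˡ (sym (*-distribˡ-sum s u)))

  identity-diagonal : ∀ (i : Fin n) → identity n i i ≈ 1#
  identity-diagonal i with i Finₚ.≟ i
  ... | yes _  = refl
  ... | no i≢i = ⊥-elim (i≢i ≡.refl)

  identity-off : ∀ {i j : Fin n} → i ≢ j → identity n i j ≈ 0#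
  identity-off {i = i} {j} i≢j with i Finₚ.≟ j
  ... | yes i≡j = ⊥-elim (i≢j i≡j)
  ... | no _    = refl

  identity-punchIn : ∀ (i : Fin (suc n)) j k → identity (suc n) (punchIn i j) (punchIn i k) ≈ identity n j k
  identity-punchIn i j k with j Finₚ.≟ k
  ... | yes ≡.refl = identity-diagonal (punchIn i j)
  ... | no j≢k     = identity-off (j≢k ∘ Finₚ.punchIn-injective i j k)

  sum-identityʳ : ∀ (t : Vector A n) j → ∑[ i < n ] (t i * identity n i j) ≈ t j
  sum-identityʳ t j = begin
    sum (λ i → t i * identity _ i j) ≈⟨ sum-single _ j
        (λ i i≢j → trans (*-congˡ (identity-off i≢j)) (zeroʳ _)) ⟩
    t j * identity _ j j             ≈⟨ *-congˡ (identity-diagonal j) ⟩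
    t j * 1#                         ≈⟨ *-identityʳ _ ⟩
    t j                              ∎

  sum-identityˡ : ∀ (t : Vector A n) i → ∑[ j < n ] (identity n i j * t j) ≈ t i
  sum-identityˡ t i = begin
    sum (λ j → identity _ i j * t j) ≈⟨ sum-single _ i
        (λ j j≢i → trans (*-congʳ (identity-off (j≢i ∘ ≡.sym))) (zeroˡ _)) ⟩
    identity _ i i * t i             ≈⟨ *-congʳ (identity-diagonal i) ⟩
    1# * t i                         ≈⟨ *-identityˡ _ ⟩
    t i                              ∎

  -1*-1≈1 : - 1# * - 1# ≈ 1#
  -1*-1≈1 = trans (-1*x≈-x (- 1#)) (-‿involutive 1#)

  sign-square : ∀ k → (- 1#) ^ k * (- 1#) ^ k ≈ 1#
  sign-square zero    = *-identityˡ 1#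
  sign-square (suc k) = begin
    (- 1# * (- 1#) ^ k) * (- 1# * (- 1#) ^ k)
        ≈⟨ solve 2 (λ x y → (x :* y) :* (x :* y) := (x :* x) :* (y :* y)) refl (- 1#) ((- 1#) ^ k) ⟩
    (- 1# * - 1#) * ((- 1#) ^ k * (- 1#) ^ k)   ≈⟨ *-cong -1*-1≈1 (sign-square k) ⟩
    1# * 1#                                     ≈⟨ *-identityˡ 1# ⟩
    1#                                          ∎

  -- The number `m` of vectors and their length `n` are independent, so that functionals of too many
  -- vectors and of partial lists of rows are covered. Linearity compares three families agreeing
  -- off `i`; with the scalar `s` it joins additivity and homogeneity in one law.
  record Alternating (f : (Fin m → Vector A n) → A) : Set (a Level.⊔ ℓ) where
    field
      congr     : ∀ {X Y} → (∀ i → X i ≋ Y i) → f X ≈ f Y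
      linear    : ∀ i s {X Y Z} → (∀ k → Z i k ≈ X i k + s * Y i k) →
                  (∀ j → j ≢ i → Z j ≋ X j) → (∀ j → j ≢ i → Z j ≋ Y j) →
                  f Z ≈ f X + s * f Y
      alternate : ∀ {i j X} → i ≢ j → X i ≋ X j → f X ≈ 0#
  open Alternating

  module _ {p q} {f : (Fin q → Vector A p) → A} (f-alt : Alternating f)
           (put : (Fin m → Vector A n) → Fin q → Vector A p) (ι : Fin m → Fin q)
           (ι-injective : ∀ {i j} → ι i ≡ ι j → i ≡ j) (L : Vector A n → Vector A p)
           (L-linear : ∀ {u v w} s → (∀ k → w k ≈ u k + s * v k) → ∀ k → L w k ≈ L u k + s * L v k)
           (L-cong : ∀ {u v} → u ≋ v → L u ≋ L v)
           (put-ι : ∀ X i → put X (ι i) ≋ L (X i))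
           (put-rest : ∀ X Y k → (∀ i → k ≢ ι i) → put X k ≋ put Y k) where

    private
      put-agree : ∀ {X Y} k → (∀ i → k ≡ ι i → X i ≋ Y i) → put X k ≋ put Y k
      put-agree {X} {Y} k X≋Y with Finₚ.any? (λ i → k Finₚ.≟ ι i)
      ... | yes (i , ≡.refl) = λ l → trans (put-ι X i l) (trans (L-cong (X≋Y i ≡.refl) l) (sym (put-ι Y i l)))
      ... | no k∉ι           = put-rest X Y k λ i k≡ → k∉ι (i , k≡)

      put-off : ∀ {i X Y} → (∀ j → j ≢ i → X j ≋ Y j) → ∀ k → k ≢ ι i → put X k ≋ put Y k
      put-off X≋Y k k≢ = put-agree k λ j k≡ → X≋Y j λ where ≡.refl → k≢ k≡

    -- `put` places `L (X i)` at row `ι i` and keeps all other rows independent of `X`. Fixing a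
    -- row, padding with zeros, inserting a column and multiplying by a matrix are all instances.
    alternating-∘ : Alternating (f ∘ put)
    alternating-∘ .congr X≋Y = congr f-alt λ k → put-agree k λ i _ → X≋Y i
    alternating-∘ .linear i s {X} {Y} {Z} Z≈ Z≋X Z≋Y = linear f-alt (ι i) s
      (λ k → trans (put-ι Z i k) (trans (L-linear s Z≈ k) (sym (+-cong (put-ι X i k) (*-congˡ (put-ι Y i k))))))
      (put-off Z≋X) (put-off Z≋Y)
    alternating-∘ .alternate {i} {j} {X} i≢j Xi≋Xj = alternate f-alt (i≢j ∘ ι-injective)
      λ k → trans (put-ι X i k) (trans (L-cong Xi≋Xj k) (sym (put-ι X j k)))

  module _ {f : (Fin m → Vector A n) → A} (f-alt : Alternating f) where

    linear-sum : ∀ i (s : Vector A k) (V : Fin k → Vector A n) {Z} →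
                 (∀ l → Z i l ≈ ∑[ t < k ] (s t * V t l)) →
                 f Z ≈ ∑[ t < k ] (s t * f (updateAt Z i (const (V t))))
    -- An empty combination makes row `i` zero; linearity with all three families equal to `Z` then
    -- gives f Z = f Z + f Z.
    linear-sum {zero}  i s V {Z} Z≈ = zero-row (begin
        f Z             ≈⟨ linear f-alt i 1# {Z} {Z}
            (λ l → trans (Z≈ l) (sym (trans (+-cong (Z≈ l) (trans (*-congˡ (Z≈ l)) (zeroʳ 1#)))
                (+-identityˡ 0#)))) (λ _ _ _ → refl) (λ _ _ _ → refl) ⟩
        f Z + 1# * f Z  ≈⟨ +-congˡ (*-identityˡ _) ⟩
        f Z + f Z       ∎)
      where
      zero-row : ∀ {x} → x ≈ x + x → x ≈ 0#
      zero-row {x} x≈x+x = begin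
        x              ≈⟨ +-identityʳ x ⟨
        x + 0#         ≈⟨ +-congˡ (-‿inverseʳ x) ⟨
        x + (x - x)    ≈⟨ +-assoc x x (- x) ⟨
        (x + x) - x    ≈⟨ +-congʳ x≈x+x ⟨
        x - x          ≈⟨ -‿inverseʳ x ⟩
        0#             ∎
    linear-sum {suc k} i s V {Z} Z≈ = begin
      f Z
        ≈⟨ linear f-alt i (s zero) {X} {Y} (λ l → begin
             Z i l ≈⟨ Z≈ l ⟩
             s zero * V zero l + rest l ≈⟨ +-comm _ _ ⟩
             rest l + s zero * V zero l ≈⟨ +-cong (reflexive (≡.cong-app (updateAt-updates i Z) l))
                 (*-congˡ (reflexive (≡.cong-app (updateAt-updates i Z) l))) ⟨
             X i l + s zero * Y i l ∎)
             (off rest) (off (V zero)) ⟩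
      f X + s zero * f Y                                           ≈⟨ +-comm _ _ ⟩
      s zero * f Y + f X
        ≈⟨ +-congˡ (linear-sum i (s ∘ suc) (V ∘ suc) (λ l → reflexive (≡.cong-app (updateAt-updates i Z) l))) ⟩
      s zero * f Y + (∑[ t < k ] (s (suc t) * f (updateAt X i (const (V (suc t))))))
        ≈⟨ +-congˡ (sum-cong-≋ λ t → *-congˡ (congr f-alt λ j → again (V (suc t)) j)) ⟩
      s zero * f Y + (∑[ t < k ] (s (suc t) * f (updateAt Z i (const (V (suc t)))))) ∎
      where
      rest : Vector A n
      rest l = ∑[ t < k ] (s (suc t) * V (suc t) l)
      X Y : Fin m → Vector A n
      X = updateAt Z i (const rest)
      Y = updateAt Z i (const (V zero))
      off : ∀ v j → j ≢ i → Z j ≋ updateAt Z i (const v) j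
      off v j j≢i l = reflexive (≡.cong-app (≡.sym (updateAt-minimal j i Z j≢i)) l)
      again : ∀ v j → updateAt X i (const v) j ≋ updateAt Z i (const v) j
      again v j l with j Finₚ.≟ i
      ... | yes ≡.refl = reflexive (≡.cong-app
          (≡.trans (updateAt-updates i X) (≡.sym (updateAt-updates i Z))) l)
      ... | no j≢i     = reflexive (≡.cong-app (≡.trans (updateAt-minimal j i X j≢i)
                           (≡.trans (updateAt-minimal j i Z j≢i) (≡.sym (updateAt-minimal j i Z j≢i)))) l)

  ∷-cong : ∀ {x y : Vector A n} {X Y : Fin m → Vector A n} → x ≋ y → (∀ i → X i ≋ Y i) → ∀ i → (x ∷ X) i ≋
      (y ∷ Y) i
  ∷-cong x≋y X≋Y zero    = x≋y
  ∷-cong x≋y X≋Y (suc i) = X≋Y i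

  head∷tail : ∀ (X : Fin (suc m) → Vector A n) i → X i ≋ (X zero ∷ tail X) i
  head∷tail X zero    _ = refl
  head∷tail X (suc i) _ = refl

  ∷-alternating : {f : (Fin (suc m) → Vector A n) → A} → Alternating f → ∀ x → Alternating (f ∘ (x ∷_))
  ∷-alternating f-alt x = alternating-∘ f-alt (x ∷_) suc Finₚ.suc-injective id (λ _ → id) id
    (λ _ _ _ → refl) λ where
      X Y zero    _  _ → refl
      X Y (suc k) ≢ι _ → ⊥-elim (≢ι k ≡.refl)

  module _ {f : (Fin (suc m) → Vector A n) → A} (f-alt : Alternating f) where

    linear-head : ∀ {x y z W} s → (∀ k → z k ≈ x k + s * y k) → f (z ∷ W) ≈ f (x ∷ W) + s * f (y ∷ W)
    linear-head s z≈ = linear f-alt zero s z≈ off off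
      where
      off : ∀ {x y W} j → j ≢ zero → (x ∷ W) j ≋ (y ∷ W) j
      off zero    j≢ _ = ⊥-elim (j≢ ≡.refl)
      off (suc j) _  _ = refl

    linear-sum-head : ∀ (s : Vector A k) (V : Fin k → Vector A n) {z W} →
                      (∀ l → z l ≈ ∑[ t < k ] (s t * V t l)) →
                      f (z ∷ W) ≈ ∑[ t < k ] (s t * f (V t ∷ W))
    linear-sum-head {k} s V {z} {W} z≈ = trans (linear-sum f-alt zero s V z≈)
      (sum-cong-≋ {k} λ t → *-congˡ (congr f-alt (at-zero t)))
      where
      at-zero : ∀ t i → updateAt (z ∷ W) zero (const (V t)) i ≋ (V t ∷ W) i
      at-zero t zero    _ = refl
      at-zero t (suc i) _ = refl

    expand-head : ∀ X → f X ≈ ∑[ j < n ] (X zero j * f (identity n j ∷ tail X))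
    expand-head X = trans (congr f-alt (head∷tail X))
      (linear-sum-head (X zero) (identity n) λ l → sym (sum-identityʳ (X zero) l))

  module _ {f : (Fin (2 ℕ.+ m) → Vector A n) → A} (f-alt : Alternating f) where

    -- Polarisation: the value at a family with x + y in both leading places is zero, and of its
    -- four terms the two with a repeated vector vanish.
    swap : ∀ x y W → f (x ∷ (y ∷ W)) ≈ - 1# * f (y ∷ (x ∷ W))
    swap x y W = trans (+-inverseˡ-unique _ _ (begin
        f (x ∷ (y ∷ W)) + f (y ∷ (x ∷ W))
          ≈⟨ +-cong (trans (sym (+-identityˡ _)) (+-cong (sym (same x W)) (sym (*-identityˡ _))))
              (sym (trans (+-congˡ (trans (*-identityˡ _) (same y W))) (+-identityʳ _))) ⟩
        (f (x ∷ (x ∷ W)) + 1# * f (x ∷ (y ∷ W))) + (f (y ∷ (x ∷ W)) + 1# * f (y ∷ (y ∷ W)))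
          ≈⟨ +-cong (sym (linear-head (∷-alternating f-alt x) 1# (λ _ → refl)))
              (sym (linear-head (∷-alternating f-alt y) 1# (λ _ → refl))) ⟩
        f (x ∷ (z ∷ W)) + f (y ∷ (z ∷ W))
          ≈⟨ +-congˡ (*-identityˡ _) ⟨
        f (x ∷ (z ∷ W)) + 1# * f (y ∷ (z ∷ W))
          ≈⟨ linear-head f-alt 1# (λ _ → refl) ⟨
        f (z ∷ (z ∷ W))
          ≈⟨ same z W ⟩
        0# ∎)) (sym (-1*x≈-x _))
      where
      z : Vector A n
      z k = x k + 1# * y k
      same : ∀ x W → f (x ∷ (x ∷ W)) ≈ 0#
      same x W = alternate f-alt {zero} {suc zero} (λ ()) λ _ → refl

  -- Row `j` reaches the top by `j` exchanges with the row just above it.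
  insertAt-head : {f : (Fin (suc m) → Vector A n) → A} → Alternating f → ∀ W j x →
                  f (insertAt W j x) ≈ (- 1#) ^ toℕ j * f (x ∷ W)
  insertAt-head f-alt W zero x = trans (congr f-alt λ where
    zero    _ → refl
    (suc i) _ → refl) (sym (*-identityˡ _))
  insertAt-head {suc m} {f = f} f-alt W (suc j) x = begin
    f (insertAt W (suc j) x)                                  ≈⟨ congr f-alt (λ where zero _ → refl ; (suc i) _ → refl) ⟩
    f (W zero ∷ insertAt (tail W) j x)
        ≈⟨ insertAt-head (∷-alternating f-alt (W zero)) (tail W) j x ⟩
    (- 1#) ^ toℕ j * f (W zero ∷ (x ∷ tail W))                ≈⟨ *-congˡ (swap f-alt (W zero) x (tail W)) ⟩
    (- 1#) ^ toℕ j * (- 1# * f (x ∷ (W zero ∷ tail W)))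
        ≈⟨ solve 3 (λ a b c → a :* (b :* c) := (b :* a) :* c) refl _ _ _ ⟩
    (- 1# * (- 1#) ^ toℕ j) * f (x ∷ (W zero ∷ tail W))
        ≈⟨ *-congˡ (congr f-alt (∷-cong (λ _ → refl) λ i k → sym (head∷tail W i k))) ⟩
    (- 1# * (- 1#) ^ toℕ j) * f (x ∷ W)                       ∎

  -- Induction on the rows below `x`: linearity splits off the multiple of `x` from the next row,
  -- and that term has `x` twice.
  shear : {f : (Fin (suc m) → Vector A n) → A} → Alternating f → ∀ x {W W′} (s : Vector A m) →
          (∀ i k → W i k ≈ W′ i k + s i * x k) → f (x ∷ W) ≈ f (x ∷ W′)
  shear {zero}  f-alt x s W≈ = congr f-alt (∷-cong (λ _ → refl) λ ())
  shear {suc m} {f = f} f-alt x {W} {W′} s W≈ = begin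
    f (x ∷ W)
        ≈⟨ congr f-alt (∷-cong (λ _ → refl) (head∷tail W)) ⟩
    f (x ∷ (W zero ∷ tail W))
        ≈⟨ linear-head (∷-alternating f-alt x) (s zero) (W≈ zero) ⟩
    f (x ∷ (W′ zero ∷ tail W)) + s zero * f (x ∷ (x ∷ tail W))
        ≈⟨ +-congˡ (trans (*-congˡ (alternate f-alt {zero} {suc zero} (λ ()) λ _ → refl)) (zeroʳ _)) ⟩
    f (x ∷ (W′ zero ∷ tail W)) + 0#                                 ≈⟨ +-identityʳ _ ⟩
    f (x ∷ (W′ zero ∷ tail W))                                      ≈⟨ second (tail W) ⟩
    f₁ (x ∷ tail W)                                                 ≈⟨ shear f₁-alt x (s ∘ suc) (W≈ ∘ suc) ⟩
    f₁ (x ∷ tail W′)                                                ≈⟨ second (tail W′) ⟨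
    f (x ∷ (W′ zero ∷ tail W′))
        ≈⟨ congr f-alt (∷-cong (λ _ → refl) (head∷tail W′)) ⟨
    f (x ∷ W′)                                                      ∎
    where
    -- The row already reduced is frozen in second place, so that `x` stays at the head for the
    -- recursive call.
    f₁ : (Fin (suc m) → Vector A _) → A
    f₁ X = f (insertAt X (suc zero) (W′ zero))
    second : ∀ V → f (x ∷ (W′ zero ∷ V)) ≈ f₁ (x ∷ V)
    second V = congr f-alt λ where
      zero          _ → refl
      (suc zero)    _ → refl
      (suc (suc i)) _ → refl
    f₁-alt : Alternating f₁
    f₁-alt = alternating-∘ f-alt (λ X → insertAt X (suc zero) (W′ zero)) (punchIn (suc zero))
        (Finₚ.punchIn-injective (suc zero) _ _) id (λ _ → id) id
      (λ X i k → reflexive (≡.cong-app (insertAt-punchIn X (suc zero) (W′ zero) i) k)) λ where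
        X Y zero          ≢ι _ → ⊥-elim (≢ι zero ≡.refl)
        X Y (suc zero)    _  _ → refl
        X Y (suc (suc i)) ≢ι _ → ⊥-elim (≢ι (suc i) ≡.refl)

  -- The Laplace determinant: multilinearity, alternation, transpose.

  laplaceTerm : Matrix (suc n) (suc n) → Vector A (suc n)
  laplaceTerm X j = (- 1#) ^ toℕ j * X zero j * det (submatrix X suc (punchIn j))

  det-cong : {X Y : Matrix n n} → (∀ i → X i ≋ Y i) → det X ≈ det Y
  det-cong {zero}  X≋Y = refl
  det-cong {suc n} {X} {Y} X≋Y = sum-cong-≋ {suc n} {laplaceTerm X} {laplaceTerm Y} λ j →
    *-cong (*-congˡ {(- 1#) ^ toℕ j} (X≋Y zero j)) (det-cong λ i k → X≋Y (suc i) (punchIn j k))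

  det-linear : ∀ i s {X Y Z : Matrix n n} → (∀ k → Z i k ≈ X i k + s * Y i k) →
               (∀ j → j ≢ i → Z j ≋ X j) → (∀ j → j ≢ i → Z j ≋ Y j) →
               det Z ≈ det X + s * det Y
  det-linear {suc n} zero s {X} {Y} {Z} Z≈ Z≋X Z≋Y = trans (sum-cong-≋ {suc n} {laplaceTerm Z} term)
      (sum-linear s (laplaceTerm X) (laplaceTerm Y))
    where
    term : ∀ j → laplaceTerm Z j ≈ laplaceTerm X j + s * laplaceTerm Y j
    term j = begin
      (- 1#) ^ toℕ j * Z zero j * det (submatrix Z suc (punchIn j))
        ≈⟨ *-congʳ (*-congˡ (Z≈ j)) ⟩
      (- 1#) ^ toℕ j * (X zero j + s * Y zero j) * det (submatrix Z suc (punchIn j))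
        ≈⟨ solve 5 (λ σ x s y d → σ :* (x :+ s :* y) :* d := σ :* x :* d :+ s :* (σ :* y :* d)) refl _ _ _ _ _ ⟩
      (- 1#) ^ toℕ j * X zero j * det (submatrix Z suc (punchIn j)) +
      s * ((- 1#) ^ toℕ j * Y zero j * det (submatrix Z suc (punchIn j)))
        ≈⟨ +-cong (*-congˡ (det-cong λ i k → Z≋X (suc i) (λ ()) (punchIn j k)))
                  (*-congˡ (*-congˡ (det-cong λ i k → Z≋Y (suc i) (λ ()) (punchIn j k)))) ⟩
      _ ∎
  det-linear {suc n} (suc i) s {X} {Y} {Z} Z≈ Z≋X Z≋Y = trans (sum-cong-≋ {suc n} {laplaceTerm Z} term)
      (sum-linear s (laplaceTerm X) (laplaceTerm Y))
    where
    term : ∀ j → laplaceTerm Z j ≈ laplaceTerm X j + s * laplaceTerm Y j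
    term j = begin
      (- 1#) ^ toℕ j * Z zero j * det (submatrix Z suc (punchIn j))
        ≈⟨ *-congˡ (det-linear i s (λ k → Z≈ (punchIn j k))
             (λ l l≢i k → Z≋X (suc l) (l≢i ∘ Finₚ.suc-injective) (punchIn j k))
             (λ l l≢i k → Z≋Y (suc l) (l≢i ∘ Finₚ.suc-injective) (punchIn j k))) ⟩
      (- 1#) ^ toℕ j * Z zero j * (det (submatrix X suc (punchIn j)) + s * det (submatrix Y suc (punchIn j)))
        ≈⟨ solve 5 (λ σ z x s y → σ :* z :* (x :+ s :* y) := σ :* z :* x :+ s :* (σ :* z :* y)) refl _ _ _ _ _ ⟩
      (- 1#) ^ toℕ j * Z zero j * det (submatrix X suc (punchIn j)) +
      s * ((- 1#) ^ toℕ j * Z zero j * det (submatrix Y suc (punchIn j)))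
        ≈⟨ +-cong (*-congʳ (*-congˡ (Z≋X zero (λ ()) j))) (*-congˡ (*-congʳ (*-congˡ (Z≋Y zero (λ ()) j)))) ⟩
      _ ∎

  cancel : ∀ {x y} → y ≈ - 1# * x → x + y ≈ 0#
  cancel {x} {y} y≈-x = trans (+-congˡ (trans y≈-x (-1*x≈-x x))) (-‿inverseʳ x)

  -- The terms (j , punchIn j k) and (punchIn j k , j) of a twofold Laplace expansion cancel;
  -- H stands for the minor on the remaining columns.
  cancelling-sum : ∀ m (x : Vector A (2 ℕ.+ m)) (H : (Fin m → Fin (2 ℕ.+ m)) → A) →
    (∀ {φ ψ} → φ ≗ ψ → H φ ≈ H ψ) →
    ∑[ j < 2 ℕ.+ m ] ∑[ k < 1 ℕ.+ m ]
      ((- 1#) ^ toℕ j * x j * ((- 1#) ^ toℕ k * x (punchIn j k) * H (punchIn j ∘ punchIn k))) ≈ 0#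
  cancelling-sum m x H H-cong = begin
    sum above + sum (λ j → below j + sum (rest j))
      ≈⟨ +-congˡ (∑-distrib-+ below (λ j → sum (rest j))) ⟩
    sum above + (sum below + sum (λ j → sum (rest j)))
      ≈⟨ +-assoc _ _ _ ⟨
    (sum above + sum below) + sum (λ j → sum (rest j))
      ≈⟨ +-cong (sym (∑-distrib-+ above below)) (smaller m x H H-cong) ⟩
    sum (λ k → above k + below k) + 0#
      ≈⟨ +-identityʳ _ ⟩
    sum (λ k → above k + below k)
      ≈⟨ sum-zero (λ k → cancel (solve 6
          (λ o m σ y z h → (m :* σ) :* y :* (o :* z :* h) := m :* (o :* z :* (σ :* y :* h)))
           refl 1# (- 1#) ((- 1#) ^ toℕ k) (x (suc k)) (x zero) (H (suc ∘ punchIn k)))) ⟩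
    0# ∎
    where
    t : Fin (2 ℕ.+ m) → Fin (1 ℕ.+ m) → A
    t j k = (- 1#) ^ toℕ j * x j * ((- 1#) ^ toℕ k * x (punchIn j k) * H (punchIn j ∘ punchIn k))
    above below : Fin (1 ℕ.+ m) → A
    above k = t zero k
    below j = t (suc j) zero
    rest : Fin (1 ℕ.+ m) → Fin m → A
    rest j k = t (suc j) (suc k)
    smaller : ∀ m (x : Vector A (2 ℕ.+ m)) (H : (Fin m → Fin (2 ℕ.+ m)) → A) → (∀ {φ ψ} → φ ≗ ψ → H φ ≈ H ψ) →
      ∑[ j < suc m ] ∑[ k < m ] ((- 1#) ^ suc (toℕ j) * x (suc j) *
        ((- 1#) ^ suc (toℕ k) * x (punchIn (suc j) (suc k)) * H (punchIn (suc j) ∘ punchIn (suc k)))) ≈ 0#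
    smaller zero    x H H-cong = sum-zero {1} λ _ → refl
    smaller (suc m) x H H-cong = trans
      (sum-cong-≋ λ j → sum-cong-≋ λ k → begin
        (- 1# * (- 1#) ^ toℕ j) * x (suc j) *
            ((- 1# * (- 1#) ^ toℕ k) * x (suc (punchIn j k)) * H (punchIn (suc j) ∘ punchIn (suc k)))
          ≈⟨ solve 6 (λ m σ y ρ z h → (m :* σ) :* y :* ((m :* ρ) :* z :* h) := (m :* m) :*
              (σ :* y :* (ρ :* z :* h))) refl _ _ _ _ _ _ ⟩
        (- 1# * - 1#) * ((- 1#) ^ toℕ j * x (suc j) *
            ((- 1#) ^ toℕ k * x (suc (punchIn j k)) * H (punchIn (suc j) ∘ punchIn (suc k))))
          ≈⟨ trans (*-congʳ -1*-1≈1) (*-identityˡ _) ⟩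
        (- 1#) ^ toℕ j * x (suc j) * ((- 1#) ^ toℕ k * x (suc (punchIn j k)) * H
            (punchIn (suc j) ∘ punchIn (suc k)))
          ≈⟨ *-congˡ (*-congˡ (H-cong λ where zero → ≡.refl ; (suc i) → ≡.refl)) ⟩
        (- 1#) ^ toℕ j * x (suc j) * ((- 1#) ^ toℕ k * x (suc (punchIn j k)) * H
            (lift 1 (punchIn j ∘ punchIn k))) ∎)
      (cancelling-sum m (x ∘ suc) (H ∘ lift 1) λ φ≗ψ → H-cong λ where
        zero    → ≡.refl
        (suc i) → ≡.cong suc (φ≗ψ i))

  -- Expanding along the first row and then along the second gives exactly the double sum of
  -- `cancelling-sum`, since both rows supply entries of the same `x`.
  det-twice : ∀ (x : Vector A (2 ℕ.+ m)) W → det (x ∷ (x ∷ W)) ≈ 0#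
  det-twice {m} x W = trans
    (sum-cong-≋ {x = laplaceTerm (x ∷ (x ∷ W))} λ j →
      *-distribˡ-sum ((- 1#) ^ toℕ j * x j) (laplaceTerm (submatrix (x ∷ (x ∷ W)) suc (punchIn j))))
    (cancelling-sum m x (λ φ → det (λ i k → W i (φ k))) λ φ≗ψ → det-cong λ i k → reflexive
        (≡.cong (W i) (φ≗ψ k)))

  -- Two equal rows below the first remain equal in every minor, which is one size smaller. A row
  -- equal to the first is moved to second place by `insertAt-head`, applied with the first row held
  -- fixed, and `det-twice` finishes.
  det-alternating : Alternating (det {n})
  det-alternating .congr          = det-cong
  det-alternating .linear         = det-linear
  det-alternating .alternate {i} {j} {X} = go i j X
    where
    below : ∀ {n} (X : Matrix (suc n) (suc n)) i j → i ≢ j → X (suc i) ≋ X (suc j) → det X ≈ 0#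
    below {n} X i j i≢j Xi≋Xj = sum-zero {t = laplaceTerm X} λ k →
      trans (*-congˡ {(- 1#) ^ toℕ k * X zero k} (alternate det-alternating i≢j (Xi≋Xj ∘ punchIn k))) (zeroʳ _)
    -- Alternation in the lower rows alone follows from `below`, so its use in `top` is not
    -- circular.
    minors : ∀ {n} (x : Vector A (suc n)) → Alternating (λ W → det (x ∷ W))
    minors x .congr X≋Y = det-cong (∷-cong {x = x} (λ _ → refl) X≋Y)
    minors x .linear i s Z≈ Z≋X Z≋Y = det-linear (suc i) s Z≈ (off Z≋X) (off Z≋Y)
      where
      off : ∀ {X Y} → (∀ j → j ≢ i → X j ≋ Y j) → ∀ j → j ≢ suc i → (x ∷ X) j ≋ (x ∷ Y) j
      off X≋Y zero    _    _ = refl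
      off X≋Y (suc j) j≢i    = X≋Y j (j≢i ∘ ≡.cong suc)
    minors x .alternate {i} {j} {X} i≢j = below (x ∷ X) i j i≢j
    top : ∀ {n} (X : Matrix (suc n) (suc n)) j → X zero ≋ X (suc j) → det X ≈ 0#
    top {suc n} X j X₀≋Xj = begin
      det X                                     ≈⟨ det-cong (head∷tail X) ⟩
      det (X zero ∷ tail X)
          ≈⟨ congr (minors (X zero)) {tail X} {insertAt W j (X zero)} moved ⟩
      det (X zero ∷ insertAt W j (X zero))      ≈⟨ insertAt-head (minors (X zero)) W j (X zero) ⟩
      (- 1#) ^ toℕ j * det (X zero ∷ (X zero ∷ W)) ≈⟨ *-congˡ (det-twice (X zero) W) ⟩
      (- 1#) ^ toℕ j * 0#                       ≈⟨ zeroʳ _ ⟩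
      0#                                        ∎
      where
      W : Fin n → Vector A (2 ℕ.+ n)
      W i = X (suc (punchIn j i))
      moved : ∀ i → X (suc i) ≋ insertAt W j (X zero) i
      moved i with i Finₚ.≟ j
      ... | yes ≡.refl = λ k → trans (sym (X₀≋Xj k))
          (reflexive (≡.cong-app (≡.sym (insertAt-lookup W j (X zero))) k))
      ... | no i≢j     = λ k → reflexive
          (≡.cong-app (≡.trans (≡.cong (X ∘ suc) (≡.sym (Finₚ.punchIn-punchOut (i≢j ∘ ≡.sym))))
                           (≡.trans (≡.sym (insertAt-punchIn W j (X zero) _))
                               (≡.cong (insertAt W j (X zero)) (Finₚ.punchIn-punchOut (i≢j ∘ ≡.sym))))) k)
    go : ∀ {n} (i j : Fin n) (X : Matrix n n) → i ≢ j → X i ≋ X j → det X ≈ 0#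
    go zero    zero    X i≢j _     = ⊥-elim (i≢j ≡.refl)
    go zero    (suc j) X _   X₀≋Xj = top X j X₀≋Xj
    go (suc i) zero    X _   Xi≋X₀ = top X i λ k → sym (Xi≋X₀ k)
    go (suc i) (suc j) X i≢j Xi≋Xj = below X i j (i≢j ∘ ≡.cong suc) Xi≋Xj

  -- Apart from the corner term, expanding along the first column and then along the first row, or
  -- in the other order, gives the same double sum of an entry of each times a minor two sizes
  -- smaller. Hence the two induction hypotheses of different sizes.
  det-transpose-step : (∀ (X : Matrix n n) → det (X ᵀ) ≈ det X) →
                       (∀ (X : Matrix (suc n) (suc n)) → det (X ᵀ) ≈ det X) →
                       ∀ (X : Matrix (2 ℕ.+ n) (2 ℕ.+ n)) → det (X ᵀ) ≈ det X
  det-transpose-step {n} IH₀ IH₁ X = +-cong (*-congˡ {1# * X zero zero} (IH₁ (submatrix X suc suc))) (begin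
      sum (λ i → - 1# * (- 1#) ^ toℕ i * X (suc i) zero * det (submatrix X (punchIn (suc i)) suc ᵀ))
        ≈⟨ sum-cong-≋ column ⟩
      sum (λ i → sum (λ j → doubleTerm i j))
        ≈⟨ ∑-comm doubleTerm ⟩
      sum (λ j → sum (λ i → doubleTerm i j))
        ≈⟨ sum-cong-≋ row ⟨
      sum (λ j → - 1# * (- 1#) ^ toℕ j * X zero (suc j) * det (submatrix X suc (punchIn (suc j)))) ∎)
    where
    minor : Fin (suc n) → Fin (suc n) → A
    minor i j = det (submatrix X (λ k → suc (punchIn i k)) (λ k → suc (punchIn j k)))
    doubleTerm : Fin (suc n) → Fin (suc n) → A
    doubleTerm i j = - 1# * ((- 1#) ^ toℕ i * X (suc i) zero) * ((- 1#) ^ toℕ j * X zero (suc j)) * minor i j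
    column : ∀ i → - 1# * (- 1#) ^ toℕ i * X (suc i) zero * det (submatrix X (punchIn (suc i)) suc ᵀ) ≈ sum
        (doubleTerm i)
    column i = begin
      - 1# * (- 1#) ^ toℕ i * X (suc i) zero * det (submatrix X (punchIn (suc i)) suc ᵀ)
        ≈⟨ *-cong (*-assoc _ _ _) (IH₁ (submatrix X (punchIn (suc i)) suc)) ⟩
      - 1# * ((- 1#) ^ toℕ i * X (suc i) zero) * sum (λ j → (- 1#) ^ toℕ j * X zero (suc j) * minor i j)
        ≈⟨ *-distribˡ-sum (- 1# * ((- 1#) ^ toℕ i * X (suc i) zero))
            (λ j → (- 1#) ^ toℕ j * X zero (suc j) * minor i j) ⟩
      sum (λ j → - 1# * ((- 1#) ^ toℕ i * X (suc i) zero) * ((- 1#) ^ toℕ j * X zero (suc j) * minor i j))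
        ≈⟨ sum-cong-≋ {x = doubleTerm i} (λ j → *-assoc _ _ _) ⟨
      sum (doubleTerm i) ∎
    row : ∀ j → - 1# * (- 1#) ^ toℕ j * X zero (suc j) * det (submatrix X suc (punchIn (suc j))) ≈ sum
        (λ i → doubleTerm i j)
    row j = begin
      - 1# * (- 1#) ^ toℕ j * X zero (suc j) * det (submatrix X suc (punchIn (suc j)))
        ≈⟨ *-congˡ (IH₁ (submatrix X suc (punchIn (suc j)))) ⟨
      - 1# * (- 1#) ^ toℕ j * X zero (suc j) * sum (λ i → (- 1#) ^ toℕ i * X (suc i) zero *
        det (submatrix X (λ k → suc (punchIn i k)) (λ k → suc (punchIn j k)) ᵀ))
        ≈⟨ *-congˡ (sum-cong-≋ λ i → *-congˡ {(- 1#) ^ toℕ i * X (suc i) zero}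
            (IH₀ (submatrix X (λ k → suc (punchIn i k)) (λ k → suc (punchIn j k))))) ⟩
      - 1# * (- 1#) ^ toℕ j * X zero (suc j) * sum (λ i → (- 1#) ^ toℕ i * X (suc i) zero * minor i j)
        ≈⟨ *-distribˡ-sum (- 1# * (- 1#) ^ toℕ j * X zero (suc j))
            (λ i → (- 1#) ^ toℕ i * X (suc i) zero * minor i j) ⟩
      sum (λ i → - 1# * (- 1#) ^ toℕ j * X zero (suc j) * ((- 1#) ^ toℕ i * X (suc i) zero * minor i j))
        ≈⟨ sum-cong-≋ (λ i → solve 6 (λ m σ x ρ y d → m :* σ :* x :* (ρ :* y :* d) := m :* (ρ :* y) :*
            (σ :* x) :* d)
             refl (- 1#) ((- 1#) ^ toℕ j) (X zero (suc j)) ((- 1#) ^ toℕ i) (X (suc i) zero) (minor i j)) ⟩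
      sum (λ i → doubleTerm i j) ∎

  det-transpose : ∀ (X : Matrix n n) → det (X ᵀ) ≈ det X
  det-transpose {zero}        X = refl
  det-transpose {suc zero}    X = refl
  det-transpose {suc (suc n)} = det-transpose-step det-transpose det-transpose

  -- Uniqueness of the determinant among alternating functionals, and its consequences.

  insertZero : Fin (suc n) → Vector A n → Vector A (suc n)
  insertZero j v = insertAt v j 0#

  insertZero-linear : ∀ j {u v w : Vector A n} s → (∀ k → w k ≈ u k + s * v k) →
                      ∀ k → insertZero j w k ≈ insertZero j u k + s * insertZero j v k
  insertZero-linear zero    s w≈ zero    = sym (trans (+-identityˡ _) (zeroʳ s))
  insertZero-linear zero    s w≈ (suc k) = w≈ k
  insertZero-linear {suc n} (suc j) s w≈ zero    = w≈ zero
  insertZero-linear {suc n} (suc j) s w≈ (suc k) = insertZero-linear j s (w≈ ∘ suc) k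

  insertZero-cong : ∀ j {u v : Vector A n} → u ≋ v → insertZero j u ≋ insertZero j v
  insertZero-cong zero    u≋v zero    = refl
  insertZero-cong zero    u≋v (suc k) = u≋v k
  insertZero-cong {suc n} (suc j) u≋v zero    = u≋v zero
  insertZero-cong {suc n} (suc j) u≋v (suc k) = insertZero-cong j (u≋v ∘ suc) k

  -- Splits `v` into its part away from coordinate `j` and a multiple of the unit vector at `j`: the
  -- form in which `shear` clears column `j` under a unit row.
  insertZero-punchOut : ∀ j (v : Vector A (suc n)) k → v k ≈ insertZero j (v ∘ punchIn j) k + v j * identity
      (suc n) j k
  insertZero-punchOut j v k with j Finₚ.≟ k
  ... | yes ≡.refl = sym (trans (+-cong (reflexive (insertAt-lookup _ j 0#)) (*-identityʳ _)) (+-identityˡ _))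
  ... | no j≢k     = sym (trans (+-cong (reflexive
      (≡.trans (≡.cong (insertZero j (v ∘ punchIn j)) (≡.sym (Finₚ.punchIn-punchOut j≢k)))
                       (≡.trans (insertAt-punchIn _ j 0# (punchOut j≢k))
                           (≡.cong v (Finₚ.punchIn-punchOut j≢k))))) (zeroʳ _)) (+-identityʳ _))

  module _ {f : (Fin (suc m) → Vector A (suc n)) → A} (f-alt : Alternating f) where

    -- The cofactor functional of an alternating `f`: a unit row on top and zeros below it. It takes
    -- one vector fewer, each one entry shorter, which drives the inductions below.
    deleteColumn : Fin (suc n) → (Fin m → Vector A n) → A
    deleteColumn j W = f (identity (suc n) j ∷ (insertZero j ∘ W))

    deleteColumn-alternating : ∀ j → Alternating (deleteColumn j)
    deleteColumn-alternating j = alternating-∘ f-alt (λ W → identity _ j ∷ (insertZero j ∘ W)) suc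
        Finₚ.suc-injective
      (insertZero j) (insertZero-linear j) (insertZero-cong j) (λ _ _ _ → refl) λ where
        X Y zero    _  _ → refl
        X Y (suc k) ≢ι _ → ⊥-elim (≢ι k ≡.refl)

    -- Laplace expansion along the first row for an arbitrary `f`: expand that row in unit vectors,
    -- then clear column `j` of the remaining rows by multiples of the unit row.
    expand-column : ∀ X → f X ≈ ∑[ j < suc n ] (X zero j * deleteColumn j (λ i → X (suc i) ∘ punchIn j))
    expand-column X = trans (expand-head f-alt X) (sum-cong-≋ λ j → *-congˡ {X zero j}
      (shear f-alt (identity _ j) {W = tail X} (λ i → X (suc i) j) λ i → insertZero-punchOut j (X (suc i))))

  -- Each cofactor again has more vectors than coordinates; when no coordinate is left, a row is an
  -- empty linear combination.
  alternating-excess : {f : (Fin m → Vector A n) → A} → Alternating f → n ℕ.< m → ∀ X → f X ≈ 0#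
  alternating-excess {suc m} {zero}  f-alt _         X = linear-sum f-alt zero [] [] λ ()
  alternating-excess {suc m} {suc n} f-alt (ℕ.s≤s n<m) X = trans (expand-column f-alt X)
    (sum-zero λ j → trans (*-congˡ {X zero j}
        (alternating-excess (deleteColumn-alternating f-alt j) n<m (λ i → X (suc i) ∘ punchIn j))) (zeroʳ _))

  -- Cofactors of `f` are alternating of one size less, hence multiples of minors by induction; it
  -- remains to evaluate the cofactors at the identity. Products, block determinants and bordered
  -- determinants with zero block are all computed by this principle.
  alternating-det : {f : (Fin n → Vector A n) → A} → Alternating f → ∀ X → f X ≈ f (identity n) * det X
  alternating-det {zero}          f-alt X = trans (congr f-alt λ ()) (sym (*-identityʳ _))
  alternating-det {suc n} {f = f} f-alt X = begin
    f X                                                     ≈⟨ expand-column f-alt X ⟩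
    sum (λ j → X zero j * deleteColumn f-alt j (λ i → X (suc i) ∘ punchIn j)) ≈⟨ sum-cong-≋ term ⟩
    sum (λ j → f (identity (suc n)) * laplaceTerm X j)
        ≈⟨ *-distribˡ-sum (f (identity (suc n))) (laplaceTerm X) ⟨
    f (identity (suc n)) * det X                            ∎
    where
    I = identity (suc n)
    -- Unit row `j` on top of the other unit rows is the identity with row `j` moved up `j` places;
    -- the sign changes sides because it squares to 1.
    at-identity : ∀ j → deleteColumn f-alt j (identity n) ≈ (- 1#) ^ toℕ j * f I
    at-identity j = begin
      f (I j ∷ (insertZero j ∘ identity n))
        ≈⟨ congr f-alt (∷-cong (λ _ → refl) rows) ⟩
      f (I j ∷ (I ∘ punchIn j))
        ≈⟨ trans (*-congʳ (sign-square (toℕ j))) (*-identityˡ _) ⟨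
      (- 1#) ^ toℕ j * (- 1#) ^ toℕ j * f (I j ∷ (I ∘ punchIn j))
        ≈⟨ *-assoc _ _ _ ⟩
      (- 1#) ^ toℕ j * ((- 1#) ^ toℕ j * f (I j ∷ (I ∘ punchIn j)))
        ≈⟨ *-congˡ (insertAt-head f-alt (I ∘ punchIn j) j (I j)) ⟨
      (- 1#) ^ toℕ j * f (insertAt (I ∘ punchIn j) j (I j))
        ≈⟨ *-congˡ (congr f-alt λ i k → reflexive (≡.cong-app (insertAt-removeAt I j i) k)) ⟩
      (- 1#) ^ toℕ j * f I ∎
      where
      rows : ∀ i → insertZero j (identity n i) ≋ I (punchIn j i)
      rows i k = begin
        insertZero j (identity n i) k
          ≈⟨ insertZero-cong j (λ l → sym (identity-punchIn j i l)) k ⟩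
        insertZero j (I (punchIn j i) ∘ punchIn j) k
          ≈⟨ trans (+-congˡ (trans (*-congʳ (identity-off (Finₚ.punchInᵢ≢i j i))) (zeroˡ _))) (+-identityʳ _) ⟨
        insertZero j (I (punchIn j i) ∘ punchIn j) k + I (punchIn j i) j * I j k
          ≈⟨ insertZero-punchOut j (I (punchIn j i)) k ⟨
        I (punchIn j i) k ∎
    term : ∀ j → X zero j * deleteColumn f-alt j (λ i → X (suc i) ∘ punchIn j) ≈ f I * laplaceTerm X j
    term j = begin
      X zero j * deleteColumn f-alt j (λ i → X (suc i) ∘ punchIn j)
        ≈⟨ *-congˡ (alternating-det (deleteColumn-alternating f-alt j) (λ i → X (suc i) ∘ punchIn j)) ⟩
      X zero j * (deleteColumn f-alt j (identity n) * det (submatrix X suc (punchIn j)))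
        ≈⟨ *-congˡ (*-congʳ (at-identity j)) ⟩
      X zero j * ((- 1#) ^ toℕ j * f I * det (submatrix X suc (punchIn j)))
        ≈⟨ solve 4 (λ x σ f d → x :* (σ :* f :* d) := f :* (σ :* x :* d)) refl _ _ _ _ ⟩
      f I * laplaceTerm X j ∎

  det-⊗ : ∀ (X Y : Matrix n n) → det (X ⊗ Y) ≈ det X * det Y
  det-⊗ {n} X Y = begin
    det (X ⊗ Y)               ≈⟨ alternating-det f-alt X ⟩
    det (identity n ⊗ Y) * det X ≈⟨ *-congʳ (det-cong λ i k → sum-identityˡ (λ j → Y j k) i) ⟩
    det Y * det X             ≈⟨ *-comm _ _ ⟩
    det X * det Y             ∎
    where
    f-alt : Alternating (λ X → det (X ⊗ Y))
    f-alt = alternating-∘ det-alternating (_⊗ Y) id id (λ x k → ∑[ j < n ] (x j * Y j k))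
      (λ {u} {v} {w} s w≈ k → begin
        sum (λ j → w j * Y j k)
          ≈⟨ sum-cong-≋ (λ j → trans (*-congʳ (w≈ j))
              (solve 4 (λ u s v y → (u :+ s :* v) :* y := u :* y :+ s :* (v :* y)) refl (u j) s (v j)
                  (Y j k))) ⟩
        sum (λ j → u j * Y j k + s * (v j * Y j k))
          ≈⟨ sum-linear s (λ j → u j * Y j k) (λ j → v j * Y j k) ⟩
        sum (λ j → u j * Y j k) + s * sum (λ j → v j * Y j k) ∎)
      (λ u≋v k → sum-cong-≋ λ j → *-congʳ (u≋v j)) (λ _ _ _ → refl) (λ _ _ k ≢ι → ⊥-elim (≢ι k ≡.refl))

  det-identity : ∀ n → det (identity n) ≈ 1#
  det-identity zero    = refl
  det-identity (suc n) = begin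
    sum (laplaceTerm (identity (suc n)))
      ≈⟨ sum-single (laplaceTerm (identity (suc n))) zero
          (λ j j≢0 → trans (*-congʳ (trans (*-congˡ (identity-off (j≢0 ∘ ≡.sym))) (zeroʳ _))) (zeroˡ _)) ⟩
    1# * 1# * det (submatrix (identity (suc n)) suc suc)
      ≈⟨ trans (*-congʳ (*-identityˡ _)) (*-identityˡ _) ⟩
    det (submatrix (identity (suc n)) suc suc)
      ≈⟨ det-cong (λ i j → identity-punchIn {n} zero i j) ⟩
    det (identity n)
      ≈⟨ det-identity n ⟩
    1# ∎

  det-zero-column : ∀ (X : Matrix (suc n) (suc n)) → (∀ i → X i zero ≈ 0#) → det X ≈ 0#
  det-zero-column {n} X X₀≈0 = sum-zero {t = laplaceTerm X} term
    where
    minor : ∀ {n} (X : Matrix (suc n) (suc n)) → (∀ i → X i zero ≈ 0#) → ∀ j → det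
        (submatrix X suc (punchIn (suc j))) ≈ 0#
    minor {suc n} X X₀≈0 j = det-zero-column (submatrix X suc (punchIn (suc j))) (X₀≈0 ∘ suc)
    term : ∀ j → laplaceTerm X j ≈ 0#
    term zero    = trans (*-congʳ (trans (*-congˡ (X₀≈0 zero)) (zeroʳ _))) (zeroˡ _)
    term (suc j) = trans (*-congˡ (minor X X₀≈0 j)) (zeroʳ _)

  -- The multipliers `u` that clear the first column are given as data, so nothing is divided by the
  -- pivot entry.
  pivot : ∀ (X : Matrix (suc n) (suc n)) (u : Vector A n) → (∀ i → X (suc i) zero + u i * X zero zero ≈ 0#) →
          det X ≈ X zero zero * det (λ i j → X (suc i) (suc j) + u i * X zero (suc j))
  pivot {n} X u X₀≈0 = begin
    det X
      ≈⟨ det-cong (head∷tail X) ⟩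
    det (X zero ∷ tail X)
      ≈⟨ shear det-alternating (X zero) (λ i → - u i) (λ i k → sym (begin
           (X (suc i) k + u i * X zero k) + - u i * X zero k   ≈⟨ +-assoc _ _ _ ⟩
           X (suc i) k + (u i * X zero k + - u i * X zero k)   ≈⟨ +-congˡ (sym (distribʳ _ _ _)) ⟩
           X (suc i) k + (u i + - u i) * X zero k
               ≈⟨ +-congˡ (trans (*-congʳ (-‿inverseʳ (u i))) (zeroˡ _)) ⟩
           X (suc i) k + 0#                                    ≈⟨ +-identityʳ _ ⟩
           X (suc i) k                                         ∎)) ⟩
    det Y
      ≈⟨ sum-single (laplaceTerm Y) zero term ⟩
    1# * X zero zero * det (λ i j → X (suc i) (suc j) + u i * X zero (suc j))
      ≈⟨ *-congʳ (*-identityˡ _) ⟩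
    X zero zero * det (λ i j → X (suc i) (suc j) + u i * X zero (suc j)) ∎
    where
    cleared : ∀ {n} (X : Matrix (suc n) (suc n)) (u : Vector A n) → Matrix (suc n) (suc n)
    cleared X u = X zero ∷ λ i k → X (suc i) k + u i * X zero k
    Y = cleared X u
    minor : ∀ {n} (j : Fin n) X u → (∀ i → X (suc i) zero + u i * X zero zero ≈ 0#) → det
        (submatrix (cleared X u) suc (punchIn (suc j))) ≈ 0#
    minor {suc n} j X u X₀≈0 = det-zero-column (submatrix (cleared X u) suc (punchIn (suc j))) X₀≈0
    term : ∀ j → j ≢ zero → laplaceTerm Y j ≈ 0#
    term zero    0≢0 = ⊥-elim (0≢0 ≡.refl)
    term (suc j) _   = trans (*-congˡ {(- 1#) ^ toℕ (suc j) * X zero (suc j)} (minor j X u X₀≈0)) (zeroʳ _)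

-- Block and bordered determinants, and Cramer's rule.

module Bordered {a ℓ} (R : CommutativeRing a ℓ) where
  open CommutativeRing R hiding (zero) renaming (Carrier to A)
  open Network R using (Matrix; det; _⊗_; _ᵀ; identity; IsInverse)
  open Determinant R
  open Alternating
  open Algebra.Properties.Ring ring using (-‿distribˡ-*; -‿distribʳ-*; -‿involutive; -‿+-comm; -0#≈0#)
  open Algebra.Properties.Semiring.Sum semiring
    using (sum; sum-syntax; sum-cong-≋; ∑-comm; *-distribˡ-sum; *-distribʳ-sum)
  open Algebra.Solver.Ring.NaturalCoefficients.Default commutativeSemiring using (solve; _:=_; _:*_)
  open Relation.Binary.Reasoning.Setoid setoid

  private
    variable
      n r : ℕ

  x+0 : ∀ {x y} → y ≈ 0# → x + y ≈ x
  x+0 y≈0 = trans (+-congˡ y≈0) (+-identityʳ _)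

  x*0 : ∀ {x y} → y ≈ 0# → x * y ≈ 0#
  x*0 y≈0 = trans (*-congˡ y≈0) (zeroʳ _)

  0*x : ∀ {x y} → y ≈ 0# → y * x ≈ 0#
  0*x y≈0 = trans (*-congʳ y≈0) (zeroˡ _)

  -x*-y : ∀ x y → - x * - y ≈ x * y
  -x*-y x y = begin
    - x * - y     ≈⟨ -‿distribˡ-* x (- y) ⟨
    - (x * - y)   ≈⟨ -‿cong (-‿distribʳ-* x y) ⟨
    - - (x * y)   ≈⟨ -‿involutive _ ⟩
    x * y         ∎

  sum-neg : ∀ (t : Vector A n) → sum (λ i → - t i) ≈ - sum t
  sum-neg {zero}  t = sym -0#≈0#
  sum-neg {suc n} t = trans (+-congˡ (sum-neg (t ∘ suc))) (-‿+-comm _ _)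

  0ᵥ : Vector A n
  0ᵥ _ = 0#

  block : Matrix r r → Matrix r n → Matrix n r → Matrix n n → Matrix (r ℕ.+ n) (r ℕ.+ n)
  block T U V K = (λ i → T i ++ U i) ++ (λ i → V i ++ K i)

  block-cong : ∀ {T T′ : Matrix r r} {U U′ : Matrix r n} {V V′ : Matrix n r} {K K′ : Matrix n n} →
               (∀ i → T i ≋ T′ i) → (∀ i → U i ≋ U′ i) → (∀ i → V i ≋ V′ i) → (∀ i → K i ≋ K′ i) →
               ∀ i → block T U V K i ≋ block T′ U′ V′ K′ i
  block-cong {r} T≋ U≋ V≋ K≋ i j with splitAt r i
  ... | inj₁ i with splitAt r j
  ...   | inj₁ j = T≋ i j
  ...   | inj₂ j = U≋ i j
  block-cong {r} T≋ U≋ V≋ K≋ _ j′ | inj₂ i with splitAt r j′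
  ...   | inj₁ j = V≋ i j
  ...   | inj₂ j = K≋ i j

  ++-∷ : ∀ {b} {B : Set b} (T : Fin (suc r) → B) (V : Fin n → B) i → (T ++ V) i ≡ (T zero ∷ (tail T ++ V)) i
  ++-∷ T V zero = ≡.refl
  ++-∷ {r} T V (suc i) with splitAt r i
  ... | inj₁ _ = ≡.refl
  ... | inj₂ _ = ≡.refl

  module _ {p} {f : (Fin (r ℕ.+ n) → Vector A p) → A} (f-alt : Alternating f)
           {m} (L : Vector A m → Vector A p)
           (L-linear : ∀ {u v w} s → (∀ k → w k ≈ u k + s * v k) → ∀ k → L w k ≈ L u k + s * L v k)
           (L-cong : ∀ {u v} → u ≋ v → L u ≋ L v) where

    ++ˡ-alternating : ∀ V → Alternating (λ T → f ((L ∘ T) ++ V))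
    ++ˡ-alternating V = alternating-∘ f-alt (λ T → (L ∘ T) ++ V) (_↑ˡ n) (Finₚ.↑ˡ-injective n _ _) L
        L-linear L-cong
      (λ T i k → reflexive (≡.cong-app (lookup-++ˡ (L ∘ T) V i) k)) rest
      where
      rest : ∀ (X Y : Fin r → Vector A m) (k : Fin (r ℕ.+ n)) → (∀ i → k ≢ i ↑ˡ n) → ((L ∘ X) ++ V) k ≋
          ((L ∘ Y) ++ V) k
      rest X Y k k≢ l with splitAt r k | Finₚ.join-splitAt r n k
      ... | inj₁ i | eq = ⊥-elim (k≢ i (≡.sym eq))
      ... | inj₂ _ | _  = refl

    ++ʳ-alternating : ∀ T → Alternating (λ V → f (T ++ (L ∘ V)))
    ++ʳ-alternating T = alternating-∘ f-alt (λ V → T ++ (L ∘ V)) (r ↑ʳ_) (Finₚ.↑ʳ-injective r _ _) L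
        L-linear L-cong
      (λ V i k → reflexive (≡.cong-app (lookup-++ʳ T (L ∘ V) i) k)) rest
      where
      rest : ∀ (X Y : Fin n → Vector A m) (k : Fin (r ℕ.+ n)) → (∀ i → k ≢ r ↑ʳ i) → (T ++ (L ∘ X)) k ≋
          (T ++ (L ∘ Y)) k
      rest X Y k k≢ l with splitAt r k | Finₚ.join-splitAt r n k
      ... | inj₁ _ | _  = refl
      ... | inj₂ i | eq = ⊥-elim (k≢ i (≡.sym eq))

  -- Induction on the upper rows: what is added to one of them is a combination of the lower rows
  -- `V`, and each of its terms repeats a row that is present further down.
  rows-add : ∀ {p} {f : (Fin (r ℕ.+ n) → Vector A p) → A} → Alternating f →
             ∀ (T T′ : Fin r → Vector A p) (V : Fin n → Vector A p) (C : Matrix r n) →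
             (∀ i k → T i k ≈ T′ i k + ∑[ v < n ] (C i v * V v k)) → f (T ++ V) ≈ f (T′ ++ V)
  rows-add {zero}          f-alt T T′ V C T≈ = congr f-alt λ _ _ → refl
  rows-add {suc r} {n} {f = f} f-alt T T′ V C T≈ = begin
    f (T ++ V)
      ≈⟨ congr f-alt (λ i k → reflexive (≡.cong-app (++-∷ T V i) k)) ⟩
    f (T zero ∷ (tail T ++ V))
      ≈⟨ linear-head f-alt 1# (λ k → trans (T≈ zero k) (+-congˡ (sym (*-identityˡ _)))) ⟩
    f (T′ zero ∷ (tail T ++ V)) + 1# * f (added ∷ (tail T ++ V))
      ≈⟨ x+0 (x*0 (trans (linear-sum-head f-alt (C zero) V (λ _ → refl))
          (sum-zero λ v → x*0 {C zero v} (alternate f-alt {zero} {suc (r ↑ʳ v)} (λ ()) λ k →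
           reflexive (≡.cong-app (≡.sym (lookup-++ʳ (tail T) V v)) k))))) ⟩
    f (T′ zero ∷ (tail T ++ V))
      ≈⟨ rows-add (∷-alternating f-alt (T′ zero)) (tail T) (tail T′) V (C ∘ suc) (T≈ ∘ suc) ⟩
    f (T′ zero ∷ (tail T′ ++ V))
      ≈⟨ congr f-alt (λ i k → reflexive (≡.cong-app (++-∷ T′ V i) k)) ⟨
    f (T′ ++ V) ∎
    where
    added : Vector A _
    added k = ∑[ v < n ] (C zero v * V v k)

  -- The identity block is eliminated one row at a time with pivot 1; each step subtracts one
  -- summand of the product of `V` and `U` from `K`.
  schur : ∀ (U : Matrix r n) (V : Matrix n r) (K : Matrix n n) →
          det (block (identity r) U V K) ≈ det (λ i j → K i j - ∑[ t < r ] (V i t * U t j))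
  schur {zero} {n}      U V K = det-cong {n} λ i j → sym (x+0 -0#≈0#)
  schur {suc r} {n} U V K = begin
    det M
      ≈⟨ pivot M (λ i → - M (suc i) zero)
          (λ i → trans (+-congˡ (*-identityʳ _)) (-‿inverseʳ (M (suc i) zero))) ⟩
    1# * det (λ i j → M (suc i) (suc j) + - M (suc i) zero * M zero (suc j))
      ≈⟨ *-identityˡ _ ⟩
    det (λ i j → M (suc i) (suc j) + - M (suc i) zero * M zero (suc j))
      ≈⟨ det-cong entry ⟩
    det (block (identity r) (tail U) (λ i → tail (V i)) K′)
      ≈⟨ schur (tail U) (λ i → tail (V i)) K′ ⟩
    det (λ i j → (K i j + - V i zero * U zero j) - ∑[ t < r ] (V i (suc t) * U (suc t) j))
      ≈⟨ det-cong (λ i j → begin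
           (K i j + - V i zero * U zero j) - ∑[ t < r ] (V i (suc t) * U (suc t) j)
             ≈⟨ +-assoc _ _ _ ⟩
           K i j + (- V i zero * U zero j - ∑[ t < r ] (V i (suc t) * U (suc t) j))
             ≈⟨ +-congˡ (+-congʳ (sym (-‿distribˡ-* _ _))) ⟩
           K i j + (- (V i zero * U zero j) - ∑[ t < r ] (V i (suc t) * U (suc t) j))
             ≈⟨ +-congˡ (-‿+-comm _ _) ⟩
           K i j - (V i zero * U zero j + ∑[ t < r ] (V i (suc t) * U (suc t) j)) ∎) ⟩
    det (λ i j → K i j - ∑[ t < suc r ] (V i t * U t j)) ∎
    where
    M = block (identity (suc r)) U V K
    K′ : Matrix n n
    K′ i j = K i j + - V i zero * U zero j
    entry : ∀ i j → M (suc i) (suc j) + - M (suc i) zero * M zero (suc j) ≈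
                    block (identity r) (tail U) (λ i → tail (V i)) K′ i j
    entry i j with splitAt r i
    ... | inj₁ i with splitAt r j
    ...   | inj₁ j = trans (x+0 (0*x -0#≈0#)) (identity-punchIn zero i j)
    ...   | inj₂ j = x+0 (0*x -0#≈0#)
    entry _ j′ | inj₂ i with splitAt r j′
    ...   | inj₁ j = x+0 (zeroʳ _)
    ...   | inj₂ j = refl

  private
    ++0-linear : ∀ {u v w : Vector A r} s → (∀ k → w k ≈ u k + s * v k) →
                 ∀ k → (w ++ 0ᵥ {n}) k ≈ (u ++ 0ᵥ) k + s * (v ++ 0ᵥ) k
    ++0-linear {r} s w≈ k with splitAt r k
    ... | inj₁ k = w≈ k
    ... | inj₂ _ = sym (x+0 (zeroʳ s))
    ++0-cong : ∀ {u v : Vector A r} → u ≋ v → (u ++ 0ᵥ {n}) ≋ (v ++ 0ᵥ)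
    ++0-cong {r} u≋v k with splitAt r k
    ... | inj₁ k = u≋v k
    ... | inj₂ _ = refl

  -- With zeros to its right, `P` enters as an alternating functional of its rows, so by uniqueness
  -- only the case of the identity matters; there the Schur complement is `K` itself.
  det-block-lower : ∀ (P : Matrix r r) (V : Matrix n r) (K : Matrix n n) →
                    det (block P (λ _ → 0ᵥ) V K) ≈ det P * det K
  det-block-lower {r} {n} P V K = begin
    det (block P (λ _ → 0ᵥ) V K)
      ≈⟨ alternating-det alt P ⟩
    det (block (identity r) (λ _ → 0ᵥ) V K) * det P
      ≈⟨ *-congʳ (trans (schur (λ _ → 0ᵥ) V K)
          (det-cong {n} λ i j → x+0 (trans (-‿cong (sum-zero {r} λ t → zeroʳ _)) -0#≈0#))) ⟩
    det K * det P
      ≈⟨ *-comm _ _ ⟩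
    det P * det K ∎
    where
    alt : Alternating (λ (P : Matrix r r) → det (block P (λ _ → 0ᵥ) V K))
    alt = ++ˡ-alternating det-alternating (_++ 0ᵥ) ++0-linear ++0-cong (λ i → V i ++ K i)

  border : Matrix n n → Vector A n → Vector A n → Matrix (suc n) (suc n)
  border M u v = (0# ∷ (λ j → - v j)) ∷ λ i → u i ∷ M i

  -- Both sides come from the matrix with first row (1, - c v) and further rows (u, M): eliminating
  -- with its corner 1 gives the left side, and splitting its first row as (1, 0) + c (0, - v) gives
  -- the right side.
  det-rank-one : ∀ (M : Matrix n n) c (u v : Vector A n) →
                 det (λ i j → M i j + c * (u i * v j)) ≈ det M + c * det (border M u v)
  det-rank-one {n} M c u v = begin
    det (λ i j → M i j + c * (u i * v j))
      ≈⟨ det-cong (λ i j → +-congˡ (sym (trans (-x*-y (u i) (c * v j))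
          (solve 3 (λ u c v → u :* (c :* v) := c :* (u :* v)) refl _ _ _)))) ⟩
    det (λ i j → M i j + - u i * - (c * v j))
      ≈⟨ cornered (λ j → - (c * v j)) ⟨
    det ((1# ∷ λ j → - (c * v j)) ∷ rows)
      ≈⟨ linear-head det-alternating {W = rows} c combine ⟩
    det ((1# ∷ 0ᵥ) ∷ rows) + c * det (border M u v)
      ≈⟨ +-congʳ (trans (cornered 0ᵥ) (det-cong {n} λ i j → x+0 (zeroʳ _))) ⟩
    det M + c * det (border M u v) ∎
    where
    rows : Fin n → Vector A (suc n)
    rows i = u i ∷ M i
    cornered : ∀ w → det ((1# ∷ w) ∷ rows) ≈ det (λ i j → M i j + - u i * w j)
    cornered w = trans (pivot ((1# ∷ w) ∷ rows) (λ i → - u i)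
        (λ i → trans (+-congˡ (*-identityʳ _)) (-‿inverseʳ (u i)))) (*-identityˡ _)
    combine : ∀ k → (1# ∷ λ j → - (c * v j)) k ≈ (1# ∷ 0ᵥ) k + c * (0# ∷ (λ j → - v j)) k
    combine zero    = sym (x+0 (zeroʳ c))
    combine (suc k) = trans (-‿distribʳ-* c (v k)) (sym (+-identityˡ _))

  bordered : (X Y : Fin r → Vector A n) → Matrix n n → A
  bordered X Y K = det (block (λ _ → 0ᵥ) (λ i k → - X i k) (λ k i → Y i k) K)

  bordered-cong : ∀ {X X′ Y Y′ : Fin r → Vector A n} {K K′ : Matrix n n} →
                  (∀ i → X i ≋ X′ i) → (∀ i → Y i ≋ Y′ i) → (∀ i → K i ≋ K′ i) →
                  bordered X Y K ≈ bordered X′ Y′ K′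
  bordered-cong X≋ Y≋ K≋ = det-cong (block-cong (λ _ _ → refl) (λ i k → -‿cong (X≋ i k)) (λ k i → Y≋ i k) K≋)

  -- Padding `x` and `y` with zeros confines the rank-one change to the block `K`; the border
  -- created by `det-rank-one` is then one more vector at the head of each list.
  bordered-rank-one : ∀ (X Y : Fin r → Vector A n) (K : Matrix n n) c (x y : Vector A n) →
    bordered X Y (λ i j → K i j + c * (y i * x j)) ≈ bordered X Y K + c * bordered (x ∷ X) (y ∷ Y) K
  bordered-rank-one {r} {n} X Y K c x y = begin
    bordered X Y (λ i j → K i j + c * (y i * x j))
      ≈⟨ det-cong padded ⟩
    det (λ i j → M i j + c * ((0ᵥ {r} ++ y) i * (0ᵥ {r} ++ x) j))
      ≈⟨ det-rank-one M c (0ᵥ {r} ++ y) (0ᵥ {r} ++ x) ⟩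
    bordered X Y K + c * det (border M (0ᵥ {r} ++ y) (0ᵥ {r} ++ x))
      ≈⟨ +-congˡ (*-congˡ (det-cong extended)) ⟩
    bordered X Y K + c * bordered (x ∷ X) (y ∷ Y) K ∎
    where
    M = block (λ _ → 0ᵥ) (λ i k → - X i k) (λ k i → Y i k) K
    padded : ∀ i j → block (λ _ → 0ᵥ) (λ i k → - X i k) (λ k i → Y i k) (λ i j → K i j + c * (y i * x j)) i j ≈
                     M i j + c * ((0ᵥ {r} ++ y) i * (0ᵥ {r} ++ x) j)
    padded i j with splitAt r i
    ... | inj₁ i with splitAt r j
    ...   | inj₁ j = sym (x+0 (x*0 (zeroʳ _)))
    ...   | inj₂ j = sym (x+0 (x*0 (zeroˡ _)))
    padded _ j′ | inj₂ i with splitAt r j′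
    ...   | inj₁ j = sym (x+0 (x*0 (zeroʳ _)))
    ...   | inj₂ j = refl
    extended : ∀ i j → border M (0ᵥ {r} ++ y) (0ᵥ {r} ++ x) i j ≈
                       block (λ _ → 0ᵥ) (λ i k → - (x ∷ X) i k) (λ k i → (y ∷ Y) i k) K i j
    extended zero    zero    = refl
    extended zero    (suc j) with splitAt r j
    ... | inj₁ j = -0#≈0#
    ... | inj₂ j = refl
    extended (suc i) zero    with splitAt r i
    ... | inj₁ i = refl
    ... | inj₂ i = refl
    extended (suc i) (suc j) with splitAt r i
    ... | inj₁ i with splitAt r j
    ...   | inj₁ j = refl
    ...   | inj₂ j = refl
    extended (suc _) (suc j′) | inj₂ i with splitAt r j′
    ...   | inj₁ j = refl
    ...   | inj₂ j = refl

  -- `C` stands for X times the inverse of `K`, given only through its equation. Adding `C` times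
  -- the lower rows to the upper ones clears - X and leaves a block lower triangular matrix.
  bordered-jacobi : ∀ (X Y : Fin r → Vector A n) (K : Matrix n n) (C : Matrix r n) →
                    (∀ i k → ∑[ v < n ] (C i v * K v k) ≈ X i k) →
                    bordered X Y K ≈ det (λ i j → ∑[ v < n ] (C i v * Y j v)) * det K
  bordered-jacobi {r} {n} X Y K C CK≈X = begin
    bordered X Y K
      ≈⟨ rows-add det-alternating (λ i → 0ᵥ ++ λ k → - X i k) (λ i → Z i ++ 0ᵥ) (λ v → (λ j → Y j v) ++ K v)
          (λ i v → - C i v) eliminated ⟩
    det (block Z (λ _ → 0ᵥ) (λ k i → Y i k) K)
      ≈⟨ det-block-lower Z (λ k i → Y i k) K ⟩
    det Z * det K ∎
    where
    Z : Matrix r r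
    Z i j = ∑[ v < n ] (C i v * Y j v)
    negate : ∀ i (t : Vector A n) → ∑[ v < n ] (- C i v * t v) ≈ - (∑[ v < n ] (C i v * t v))
    negate i t = trans (sum-cong-≋ λ v → sym (-‿distribˡ-* (C i v) (t v))) (sum-neg λ v → C i v * t v)
    eliminated : ∀ i k → (0ᵥ {r} ++ λ k → - X i k) k ≈
                 (Z i ++ 0ᵥ {n}) k + ∑[ v < n ] (- C i v * ((λ j → Y j v) ++ K v) k)
    eliminated i k with splitAt r k
    ... | inj₁ j = sym (trans (+-congˡ (negate i (Y j))) (-‿inverseʳ (Z i j)))
    ... | inj₂ k = sym (trans (+-identityˡ _) (trans (negate i (λ v → K v k)) (-‿cong (CK≈X i k))))

  private
    0++-linear : ∀ {u v w : Vector A n} s → (∀ k → w k ≈ u k + s * v k) →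
                 ∀ k → (0ᵥ {r} ++ λ k → - w k) k ≈ (0ᵥ {r} ++ λ k → - u k) k + s * (0ᵥ {r} ++ λ k → - v k) k
    0++-linear {r = r} {u} {v} {w} s w≈ k with splitAt r k
    ... | inj₁ _ = sym (x+0 (zeroʳ s))
    ... | inj₂ k = begin
      - w k                   ≈⟨ -‿cong (w≈ k) ⟩
      - (u k + s * v k)       ≈⟨ -‿+-comm _ _ ⟨
      - u k + - (s * v k)     ≈⟨ +-congˡ (-‿distribʳ-* s (v k)) ⟩
      - u k + s * - v k       ∎
    0++-cong : ∀ {u v : Vector A n} → u ≋ v → (0ᵥ {r} ++ λ k → - u k) ≋ (0ᵥ {r} ++ λ k → - v k)
    0++-cong {r = r} u≋v k with splitAt r k
    ... | inj₁ _ = refl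
    ... | inj₂ k = -‿cong (u≋v k)

    zero-top : ∀ (Y : Fin r → Vector A n) → Alternating (λ X → bordered X Y λ _ → 0ᵥ)
    zero-top Y = ++ˡ-alternating det-alternating (λ x → 0ᵥ ++ λ k → - x k) 0++-linear 0++-cong
        (λ k → (λ i → Y i k) ++ 0ᵥ)

    zero-bottom : ∀ (X : Fin r → Vector A n) → Alternating (λ W → bordered X (λ i k → W k i) λ _ → 0ᵥ)
    zero-bottom X = ++ʳ-alternating det-alternating (λ w → w ++ 0ᵥ) ++0-linear ++0-cong
        (λ i → 0ᵥ ++ λ k → - X i k)

  -- Over a zero block the determinant is alternating in the r vectors of `X`, of length n, and also
  -- in the n lower rows, of length r; whichever family is too large forces zero.
  bordered-zero : ∀ (X Y : Fin r → Vector A n) → r ≢ n → bordered X Y (λ _ → 0ᵥ) ≈ 0#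
  bordered-zero {r} {n} X Y r≢n with ℕₚ.<-cmp r n
  ... | tri< r<n _ _ = alternating-excess (zero-bottom X) r<n (λ k i → Y i k)
  ... | tri≈ _ r≡n _ = ⊥-elim (r≢n r≡n)
  ... | tri> _ _ n<r = alternating-excess (zero-top Y) n<r X

  -- Uniqueness in the upper rows and then in the lower rows reduces to the matrix
  -- [ 0 , - I ; I , 0 ].
  bordered-square : ∀ (X Y : Matrix n n) → bordered X Y (λ _ → 0ᵥ) ≈ det X * det Y
  bordered-square {n} X Y = begin
    bordered X Y (λ _ → 0ᵥ)
      ≈⟨ alternating-det (zero-top Y) X ⟩
    bordered I Y (λ _ → 0ᵥ) * det X
      ≈⟨ *-congʳ (alternating-det (zero-bottom I) (Y ᵀ)) ⟩
    bordered I (I ᵀ) (λ _ → 0ᵥ) * det (Y ᵀ) * det X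
      ≈⟨ *-congʳ (*-cong unit (det-transpose Y)) ⟩
    1# * det Y * det X
      ≈⟨ trans (*-congʳ (*-identityˡ _)) (*-comm _ _) ⟩
    det X * det Y ∎
    where
    I = identity n
    -- Adding the lower rows to the upper ones creates an identity corner; its Schur complement is 0
    -- - I (- I) = I.
    unit : bordered I (I ᵀ) (λ _ → 0ᵥ) ≈ 1#
    unit = begin
      bordered I (I ᵀ) (λ _ → 0ᵥ)
        ≈⟨ rows-add det-alternating (λ i → 0ᵥ ++ λ k → - I i k) (λ i → I i ++ λ k → - I i k)
            (λ v → I v ++ 0ᵥ) (λ i v → - I i v) added ⟩
      det (block I (λ i k → - I i k) I (λ _ → 0ᵥ))
        ≈⟨ schur (λ i k → - I i k) I (λ _ → 0ᵥ) ⟩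
      det (λ i j → 0# - ∑[ t < n ] (I i t * - I t j))
        ≈⟨ det-cong (λ i j → begin
             0# - ∑[ t < n ] (I i t * - I t j)   ≈⟨ +-identityˡ _ ⟩
             - ∑[ t < n ] (I i t * - I t j)      ≈⟨ -‿cong (sum-identityˡ (λ t → - I t j) i) ⟩
             - - I i j                           ≈⟨ -‿involutive _ ⟩
             I i j                               ∎) ⟩
      det I
        ≈⟨ det-identity n ⟩
      1# ∎
      where
      added : ∀ i k → (0ᵥ {n} ++ λ k → - I i k) k ≈
              (I i ++ λ k → - I i k) k + ∑[ v < n ] (- I i v * (I v ++ 0ᵥ {n}) k)
      added i k with splitAt n k
      ... | inj₁ k = sym (trans (+-congˡ (sum-identityʳ (λ v → - I i v) k)) (-‿inverseʳ (I i k)))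
      ... | inj₂ k = sym (x+0 (sum-zero {n} λ v → zeroʳ _))

  -- The adjugate scaled by `d`, which plays the role of 1 / det K: replacing row `j` by the unit
  -- vector `i` yields the cofactor at (j, i).
  cramer : ∀ (K : Matrix n n) d → det K * d ≈ 1# → Matrix n n
  cramer K d _ i j = d * det (updateAt K j (const (identity _ i)))

  -- Linearity in row `j` read backwards: the sum is `d` times the determinant of `K` with row `j`
  -- replaced by row `i`. This has two equal rows unless i = j, when it is det K.
  cramer-inverseʳ : ∀ (K : Matrix n n) d (inv : det K * d ≈ 1#) i j → (K ⊗ cramer K d inv) i j ≈ identity n i j
  cramer-inverseʳ {n} K d inv i j = begin
    ∑[ k < n ] (K i k * (d * det (updateAt K j (const (I k)))))
      ≈⟨ sum-cong-≋ (λ k → solve 3 (λ x d y → x :* (d :* y) := d :* (x :* y)) refl (K i k) d _) ⟩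
    ∑[ k < n ] (d * (K i k * det (updateAt K j (const (I k)))))
      ≈⟨ *-distribˡ-sum d (λ k → K i k * det (updateAt K j (const (I k)))) ⟨
    d * (∑[ k < n ] (K i k * det (updateAt K j (const (I k)))))
      ≈⟨ *-congˡ (sum-cong-≋ λ k → *-congˡ {K i k}
          (det-cong λ l t → reflexive (≡.cong-app (updateAt-updateAt j K l) t))) ⟨
    d * (∑[ k < n ] (K i k * det (updateAt Kᵢ j (const (I k)))))
      ≈⟨ *-congˡ (linear-sum det-alternating j (K i) I
          (λ l → trans (reflexive (≡.cong-app (updateAt-updates j K) l)) (sym (sum-identityʳ (K i) l)))) ⟨
    d * det Kᵢ
      ≈⟨ replaced ⟩
    I i j ∎
    where
    I = identity n
    Kᵢ : Matrix n n
    Kᵢ = updateAt K j (const (K i))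
    replaced : d * det Kᵢ ≈ I i j
    replaced with i Finₚ.≟ j
    ... | yes ≡.refl = trans (*-comm _ _) (trans (*-congʳ (det-cong unchanged)) inv)
      where
      unchanged : ∀ l → updateAt K i (const (K i)) l ≋ K l
      unchanged l t with l Finₚ.≟ i
      ... | yes ≡.refl = reflexive (≡.cong-app (updateAt-updates i K) t)
      ... | no l≢i     = reflexive (≡.cong-app (updateAt-minimal l i K l≢i) t)
    ... | no i≢j     = x*0 (alternate det-alternating i≢j λ t → trans
        (reflexive (≡.cong-app (updateAt-minimal i j K i≢j) t))
                         (sym (reflexive (≡.cong-app (updateAt-updates j K) t))))

  -- Since `K` is symmetric, the transpose of a right inverse is a left inverse. The two then
  -- coincide by associativity, so `L` is symmetric and inverts `K` on both sides.
  cramer-inverse : ∀ (K : Matrix n n) d (inv : det K * d ≈ 1#) → (∀ i j → K i j ≈ K j i) → IsInverse K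
      (cramer K d inv)
  cramer-inverse {n} K d inv K-sym = cramer-inverseʳ K d inv , λ i j → begin
      sum (λ k → L i k * K k j)     ≈⟨ sum-cong-≋ (λ k → *-congʳ (L-sym i k)) ⟩
      sum (λ k → L k i * K k j)     ≈⟨ left i j ⟩
      I i j                         ∎
    where
    I = identity n
    L = cramer K d inv
    I-sym : ∀ i j → I i j ≈ I j i
    I-sym i j with i Finₚ.≟ j
    ... | yes ≡.refl = sym (identity-diagonal i)
    ... | no i≢j     = sym (identity-off (i≢j ∘ ≡.sym))
    left : ∀ i j → ∑[ k < n ] (L k i * K k j) ≈ I i j
    left i j = begin
      sum (λ k → L k i * K k j)     ≈⟨ sum-cong-≋ (λ k → trans (*-comm _ _) (*-congʳ (K-sym k j))) ⟩
      sum (λ k → K j k * L k i)     ≈⟨ cramer-inverseʳ K d inv j i ⟩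
      I j i                         ≈⟨ I-sym j i ⟩
      I i j                         ∎
    L-sym : ∀ i j → L i j ≈ L j i
    L-sym i j = begin
      L i j                                                  ≈⟨ sum-identityˡ (λ k → L k j) i ⟨
      ∑[ k < n ] (I i k * L k j)                             ≈⟨ sum-cong-≋ (λ k → *-congʳ (left i k)) ⟨
      ∑[ k < n ] ((∑[ l < n ] (L l i * K l k)) * L k j)
          ≈⟨ sum-cong-≋ (λ k → *-distribʳ-sum (L k j) (λ l → L l i * K l k)) ⟩
      ∑[ k < n ] ∑[ l < n ] (L l i * K l k * L k j)          ≈⟨ ∑-comm (λ k l → L l i * K l k * L k j) ⟩
      ∑[ l < n ] ∑[ k < n ] (L l i * K l k * L k j)
          ≈⟨ sum-cong-≋ (λ l → sum-cong-≋ λ k → *-assoc (L l i) (K l k) (L k j)) ⟩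
      ∑[ l < n ] ∑[ k < n ] (L l i * (K l k * L k j))
          ≈⟨ sum-cong-≋ (λ l → *-distribˡ-sum (L l i) (λ k → K l k * L k j)) ⟨
      ∑[ l < n ] (L l i * (∑[ k < n ] (K l k * L k j)))
          ≈⟨ sum-cong-≋ (λ l → *-congˡ {L l i} (cramer-inverseʳ K d inv l j)) ⟩
      ∑[ l < n ] (L l i * I l j)                             ≈⟨ sum-identityʳ (λ l → L l i) j ⟩
      L j i                                                  ∎

-- Walks, bridges, deletion and insertion of an edge, spanning trees.

module Forests where
  open ≡ using (refl; sym; trans; cong)

  private
    variable
      k m n s : ℕ

  EdgePair : Fin n → Fin n → Fin n → Fin n → Set
  EdgePair a b u v = (a ≡ u × b ≡ v) ⊎ (a ≡ v × b ≡ u)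

  edgePair-sym : ∀ {a b u v : Fin n} → EdgePair a b u v → EdgePair a b v u
  edgePair-sym (inj₁ p) = inj₂ p
  edgePair-sym (inj₂ p) = inj₁ p

  module _ {R : Fin n → Fin n → Set} {a b : Fin n} where

    Via : Fin n → Fin n → Set
    Via u v = Star R u v ⊎ (Star R u a × Star R b v) ⊎ (Star R u b × Star R a v)

    -- The edge ab need be crossed at most once: after a crossing, a later one either returns to the
    -- present vertex or is the crossing to start from, and in both cases the part between is
    -- dropped.
    via : ∀ {u v} → Star (λ u v → R u v ⊎ EdgePair a b u v) u v → Via u v
    via stop = inj₁ stop
    via (inj₁ r ◅ s) with via s
    ... | inj₁ p              = inj₁ (r ◅ p)
    ... | inj₂ (inj₁ (p , q)) = inj₂ (inj₁ (r ◅ p , q))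
    ... | inj₂ (inj₂ (p , q)) = inj₂ (inj₂ (r ◅ p , q))
    via (inj₂ (inj₁ (refl , refl)) ◅ s) with via s
    ... | inj₁ p              = inj₂ (inj₁ (stop , p))
    ... | inj₂ (inj₁ (_ , q)) = inj₂ (inj₁ (stop , q))
    ... | inj₂ (inj₂ (_ , q)) = inj₁ q
    via (inj₂ (inj₂ (refl , refl)) ◅ s) with via s
    ... | inj₁ p              = inj₂ (inj₂ (stop , p))
    ... | inj₂ (inj₁ (_ , q)) = inj₁ q
    ... | inj₂ (inj₂ (_ , q)) = inj₂ (inj₂ (stop , q))

  module _ (R : Fin n → Fin n → Set) where

    infixr 5 _then_

    -- A walk with its vertices after the start listed in a vector, the shape from which the vertex
    -- vector of a cycle is built.
    data Chain : Fin n → Vec (Fin n) k → Fin n → Set where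
      end : ∀ {u} → Chain u Vec.[] u
      _then_ : ∀ {u w v} {ws : Vec (Fin n) k} → R u w → Chain w ws v → Chain u (w Vec.∷ ws) v

    SimplePath : Fin n → Fin n → Set
    SimplePath u v = ∃ λ k → ∃ λ (ws : Vec (Fin n) k) → Chain u ws v × Unique (u Vec.∷ ws)

    suffix : ∀ {u w v} {ws : Vec (Fin n) k} → Chain w ws v → Unique (w Vec.∷ ws) → u ∈ᵥ (w Vec.∷ ws) →
        SimplePath u v
    suffix c       uniq                   (here refl) = _ , _ , c , uniq
    suffix (_ then c) (_ AllPairs.∷ uniq)    (there u∈)  = suffix c uniq u∈

    -- Loop erasure: when the new start already occurs on the simple path found so far, only the
    -- part from that occurrence on is kept.
    simplePath : ∀ {u v} → Star R u v → SimplePath u v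
    simplePath stop = _ , _ , end , All.[] AllPairs.∷ AllPairs.[]
    simplePath {u} (_◅_ {j = w} r s) with simplePath s
    ... | k , ws , c , uniq with any? (u Finₚ.≟_) (w Vec.∷ ws)
    ...   | yes u∈ = suffix c uniq u∈
    ...   | no u∉  = _ , _ , r then c , fresh (w Vec.∷ ws) u∉ AllPairs.∷ uniq
      where
      fresh : ∀ {k} (vs : Vec (Fin n) k) → ¬ (u ∈ᵥ vs) → All (u ≢_) vs
      fresh Vec.[]       _  = All.[]
      fresh (v Vec.∷ vs) u∉ = (u∉ ∘ here) All.∷ fresh vs (u∉ ∘ there)

    chain-step : ∀ {u v} {ws : Vec (Fin n) k} → Chain u ws v → ∀ i → R (lookup (u Vec.∷ ws) (inject₁ i))
        (lookup ws i)
    chain-step (r then _) zero    = r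
    chain-step (_ then c) (suc i) = chain-step c i

    chain-last : ∀ {u v} {ws : Vec (Fin n) k} → Chain u ws v → lookup (u Vec.∷ ws) (fromℕ k) ≡ v
    chain-last end     = refl
    chain-last (_ then c) = chain-last c

    walk : ∀ (f : Fin (suc k) → Fin n) → (∀ i → R (f (inject₁ i)) (f (suc i))) → Star R (f zero) (f (fromℕ k))
    walk {zero}  f step = stop
    walk {suc k} f step = step zero ◅ walk (f ∘ suc) (step ∘ suc)

  module Bridges {n} (G : SimpleGraph n) where
    open SimpleGraph G

    edge-unique : ∀ {d e u v} → Joins d u v → Joins e u v → d ≡ e
    edge-unique (inj₁ (refl , refl)) (inj₁ (p , q)) = simple (sym p) (sym q)
    edge-unique (inj₂ (refl , refl)) (inj₂ (p , q)) = simple (sym p) (sym q)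
    edge-unique {d} {e} (inj₁ (refl , refl)) (inj₂ (p , q)) =
      ⊥-elim (Finₚ.<-asym (lo<hi d) (≡.subst₂ Fin._<_ p q (lo<hi e)))
    edge-unique {d} {e} (inj₂ (refl , refl)) (inj₁ (p , q)) =
      ⊥-elim (Finₚ.<-asym (lo<hi d) (≡.subst₂ Fin._<_ p q (lo<hi e)))

    lo≢hi : ∀ e → lo e ≢ hi e
    lo≢hi e lo≡hi = Finₚ.<-irrefl lo≡hi (lo<hi e)

    AdjacentAvoiding : Subset size → Fin size → Fin n → Fin n → Set
    AdjacentAvoiding F d u v = ∃ λ e → e ∈ F × e ≢ d × Joins e u v

    AllBridges : Subset size → Set
    AllBridges F = ∀ d → d ∈ F → ¬ Star (AdjacentAvoiding F d) (lo d) (hi d)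

    -- A simple path between the ends of `d` that avoids `d` would be a loop at length 0, a parallel
    -- edge at length 1, and from length 2 on it closes up with `d` to a cycle.
    acyclic⇒bridges : ∀ {F} → Acyclic G F → AllBridges F
    acyclic⇒bridges {F} acyclic d d∈F s with simplePath (AdjacentAvoiding F d) s
    ... | zero              , _ , c , _                      = lo≢hi d (chain-last _ c)
    ... | suc zero          , w Vec.∷ Vec.[] , (e , _ , e≢d , j) then end , _ = e≢d
        (edge-unique j (inj₁ (refl , refl)))
    ... | suc (suc k)       , ws , c , uniq = acyclic (k , lo d Vec.∷ ws
        , (λ i j → lookup-injective uniq i j)
        , (λ i → let e , e∈F , _ , j = chain-step _ c i in e , e∈F , j)
        , d , d∈F , inj₂ (refl , sym (chain-last _ c)))

    -- The closing edge of a cycle is no bridge: the remaining steps join its ends, and none of them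
    -- uses it because the vertices are distinct.
    bridges⇒acyclic : ∀ {F} → AllBridges F → Acyclic G F
    bridges⇒acyclic {F} bridges (k , vs , injective , step , d , d∈F , joined) = bridges d d∈F (oriented joined)
      where
      -- Here the length of at least 3 enters: no single step leads from the first vertex to the
      -- last.
      last-step : ∀ (i : Fin (2 ℕ.+ k)) → inject₁ i ≡ zero → suc i ≢ fromℕ (2 ℕ.+ k)
      last-step zero _ ()
      not-closing : Joins d (lookup vs (fromℕ (2 ℕ.+ k))) (lookup vs zero) →
                    ∀ i → ¬ Joins d (lookup vs (inject₁ i)) (lookup vs (suc i))
      not-closing (inj₁ (p , q)) i (inj₁ (p′ , q′)) with () ← injective _ _ (trans (sym q) q′)
      not-closing (inj₁ (p , q)) i (inj₂ (p′ , q′)) = last-step i (injective _ _ (trans (sym q′) q))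
          (injective _ _ (trans (sym p′) p))
      not-closing (inj₂ (p , q)) i (inj₁ (p′ , q′)) = last-step i (injective _ _ (trans (sym p′) p))
          (injective _ _ (trans (sym q′) q))
      not-closing (inj₂ (p , q)) i (inj₂ (p′ , q′)) with () ← injective _ _ (trans (sym p) p′)
      avoiding : ∀ i → AdjacentAvoiding F d (lookup vs (inject₁ i)) (lookup vs (suc i))
      avoiding i = let e , e∈F , j = step i in e , e∈F , (λ where refl → not-closing joined i j) , j
      around : Star (AdjacentAvoiding F d) (lookup vs zero) (lookup vs (fromℕ (2 ℕ.+ k)))
      around = walk (AdjacentAvoiding F d) (lookup vs) avoiding
      oriented : Joins d (lookup vs (fromℕ (2 ℕ.+ k))) (lookup vs zero) → Star (AdjacentAvoiding F d) (lo d)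
          (hi d)
      oriented (inj₁ (p , q)) = ≡.subst₂ (Star _) (sym p) (sym q)
        (Star.reverse (λ (e , e∈F , e≢d , j) → e , e∈F , e≢d , edgePair-sym j) around)
      oriented (inj₂ (p , q)) = ≡.subst₂ (Star _) (sym p) (sym q) around

    reachable-sym : ∀ {F u v} → Reachable G F u v → Reachable G F v u
    reachable-sym = Star.reverse λ (e , e∈F , j) → e , e∈F , edgePair-sym j

  open Bridges

  -- A graph with its edge count exposed, so that edges can be removed one at a time.
  record Edges (n m : ℕ) : Set where
    field
      lo hi  : Fin m → Fin n
      lo<hi  : ∀ e → lo e Fin.< hi e
      simple : ∀ {e f} → lo e ≡ lo f → hi e ≡ hi f → e ≡ f

    graph : SimpleGraph n
    graph = record { size = m ; lo = lo ; hi = hi ; lo<hi = lo<hi ; simple = simple }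
  open Edges using (graph)

  edges : (G : SimpleGraph n) → Edges n (SimpleGraph.size G)
  edges G = record { lo = lo ; hi = hi ; lo<hi = lo<hi ; simple = simple }
    where open SimpleGraph G

  rest : Edges n (suc m) → Edges n m
  rest E = record
    { lo = lo ∘ suc ; hi = hi ∘ suc ; lo<hi = lo<hi ∘ suc
    ; simple = λ p q → Finₚ.suc-injective (simple p q) }
    where open Edges E

  module FirstEdge {n m} (E : Edges n (suc m)) where
    open Edges E using (lo; hi)

    private
      G T : SimpleGraph n
      G = graph E
      T = graph (rest E)

    a b : Fin n
    a = lo zero
    b = hi zero

    reachable-∷ : ∀ {s F u v} → Reachable T F u v → Reachable G (s Vec.∷ F) u v
    reachable-∷ = Star.map λ (e , e∈F , j) → suc e , there e∈F , j

    reachable-outside : ∀ {F u v} → Reachable G (outside Vec.∷ F) u v → Reachable T F u v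
    reachable-outside = Star.map λ where (suc e , there e∈F , j) → e , e∈F , j

    reachable-first : ∀ {F} → Reachable G (inside Vec.∷ F) a b
    reachable-first = (zero , here , inj₁ (refl , refl)) ◅ stop

    reachable-inside : ∀ {F u v} → Reachable G (inside Vec.∷ F) u v → Via {R = Adjacent T F} {a} {b} u v
    reachable-inside = via ∘ Star.map λ where
      (zero  , _         , j) → inj₂ j
      (suc e , there e∈F , j) → inj₁ (e , e∈F , j)

    acyclic-rest : ∀ {s F} → Acyclic G (s Vec.∷ F) → Acyclic T F
    acyclic-rest acyclic = bridges⇒acyclic T λ d d∈F path → acyclic⇒bridges G acyclic (suc d) (there d∈F)
      (Star.map (λ (e , e∈F , e≢d , j) → suc e , there e∈F , e≢d ∘ Finₚ.suc-injective , j) path)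

    acyclic-outside : ∀ {F} → Acyclic T F → Acyclic G (outside Vec.∷ F)
    acyclic-outside acyclic = bridges⇒acyclic G λ where
      (suc d) (there d∈F) path → acyclic⇒bridges T acyclic d d∈F
        (Star.map (λ where (suc e , there e∈F , e≢d , j) → e , e∈F , e≢d ∘ cong suc , j) path)

    acyclic-first : ∀ {F} → Acyclic G (inside Vec.∷ F) → ¬ Reachable T F a b
    acyclic-first acyclic path = acyclic⇒bridges G acyclic zero here
      (Star.map (λ (e , e∈F , j) → suc e , there e∈F , (λ ()) , j) path)

    -- If a walk around `d` had to use the new edge, its two remaining pieces together with `d`
    -- would already join a to b in `F`.
    acyclic-inside : ∀ {F} → Acyclic T F → ¬ Reachable T F a b → Acyclic G (inside Vec.∷ F)
    acyclic-inside {F} acyclic ¬path = bridges⇒acyclic G bridge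
      where
      forget : ∀ {d u v} → Star (AdjacentAvoiding T F d) u v → Reachable T F u v
      forget = Star.map λ (e , e∈F , _ , j) → e , e∈F , j
      bridge : AllBridges G (inside Vec.∷ F)
      bridge zero    _           path = ¬path (Star.map (λ where
        (zero  , _         , e≢d , _) → ⊥-elim (e≢d refl)
        (suc e , there e∈F , _   , j) → e , e∈F , j) path)
      bridge (suc d) (there d∈F) path with via {R = AdjacentAvoiding T F d} {a} {b} (Star.map (λ where
        (zero  , _         , _   , j) → inj₂ j
        (suc e , there e∈F , e≢d , j) → inj₁ (e , e∈F , e≢d ∘ cong suc , j)) path)
      ... | inj₁ p              = acyclic⇒bridges T acyclic d d∈F p
      ... | inj₂ (inj₁ (p , q)) = ¬path (reachable-sym T (forget p) ◅◅ (d , d∈F , inj₁ (refl , refl)) ◅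
          reachable-sym T (forget q))
      ... | inj₂ (inj₂ (p , q)) = ¬path (forget q ◅◅ (d , d∈F , inj₂ (refl , refl)) ◅ forget p)

    components-outside : ∀ {F} → Components T F s → Components G (outside Vec.∷ F) s
    components-outside C = record
      { component = component ; surjective = surjective
      ; classes   = λ u v → mk⇔ (reachable-∷ ∘ Equivalence.to (classes u v))
          (Equivalence.from (classes u v) ∘ reachable-outside) }
      where open Components C

    components-rest : ∀ {F} → Components G (outside Vec.∷ F) s → Components T F s
    components-rest C = record
      { component = component ; surjective = surjective
      ; classes   = λ u v → mk⇔ (reachable-outside ∘ Equivalence.to (classes u v))
          (Equivalence.from (classes u v) ∘ reachable-∷) }
      where open Components C

    -- The label of a is removed from the numbering and its vertices receive the label of b.
    merge : ∀ {F} (C : Components T F (suc s)) → Components.component C a ≢ Components.component C b →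
            Components G (inside Vec.∷ F) s
    merge {s} {F} C α≢β = record
      { component  = label ∘ component
      ; surjective = λ c → let v , v≡ = surjective (punchIn α c) in v ,
          trans (cong label v≡) (label-punchIn c)
      ; classes    = λ u v → mk⇔ (together u v) (same-label u v) }
      where
      open Components C
      α β : Fin (suc s)
      α = component a
      β = component b
      label : Fin (suc s) → Fin s
      label l with α Finₚ.≟ l
      ... | yes _  = punchOut α≢β
      ... | no α≢l = punchOut α≢l
      label-punchIn : ∀ c → label (punchIn α c) ≡ c
      label-punchIn c with α Finₚ.≟ punchIn α c
      ... | yes α≡ = ⊥-elim (Finₚ.punchInᵢ≢i α c (sym α≡))
      ... | no α≢  = Finₚ.punchOut-punchIn α
      label-αβ : label α ≡ label β
      label-αβ with α Finₚ.≟ α | α Finₚ.≟ β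
      ... | _     | yes α≡β = ⊥-elim (α≢β α≡β)
      ... | no α≢ | _       = ⊥-elim (α≢ refl)
      ... | yes _ | no _    = Finₚ.punchOut-cong α refl
      connected : ∀ {u v} → component u ≡ component v → Reachable G (inside Vec.∷ F) u v
      connected eq = reachable-∷ (Equivalence.to (classes _ _) eq)
      together : ∀ u v → label (component u) ≡ label (component v) → Reachable G (inside Vec.∷ F) u v
      together u v eq with α Finₚ.≟ component u | α Finₚ.≟ component v
      ... | yes α≡u | yes α≡v = connected (trans (sym α≡u) α≡v)
      ... | yes α≡u | no α≢v  = connected (sym α≡u) ◅◅ reachable-first ◅◅ connected
          (Finₚ.punchOut-injective α≢β α≢v eq)
      ... | no α≢u  | yes α≡v = connected (Finₚ.punchOut-injective α≢u α≢β eq) ◅◅ reachable-sym G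
          reachable-first ◅◅ connected α≡v
      ... | no α≢u  | no α≢v  = connected (Finₚ.punchOut-injective α≢u α≢v eq)
      constant : ∀ {u v} → Reachable T F u v → label (component u) ≡ label (component v)
      constant p = cong label (Equivalence.from (classes _ _) p)
      same-label : ∀ u v → Reachable G (inside Vec.∷ F) u v → label (component u) ≡ label (component v)
      same-label u v p with reachable-inside p
      ... | inj₁ q              = constant q
      ... | inj₂ (inj₁ (q , t)) = trans (constant q) (trans label-αβ (constant t))
      ... | inj₂ (inj₂ (q , t)) = trans (constant q) (trans (sym label-αβ) (constant t))

    -- Deleting the first edge cuts off the component of the endpoint not connected to g;
    -- it receives the label 1, the other labels being shifted past 1.
    record Split {g F r} (C : ComponentOrder G g (inside Vec.∷ F) r) : Set where
      private module C = ComponentOrder C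
      field
        order : ComponentOrder T g F (suc r)
      open ComponentOrder order using (component)
      field
        ends  : (component a ≡ suc zero × component b ≢ suc zero) ⊎
            (component b ≡ suc zero × component a ≢ suc zero)
        label : ∀ v → (component v ≡ suc zero × C.component v ≡ C.component a) ⊎ component v ≡ punchIn
            (suc zero) (C.component v)

    -- `α` is the endpoint to be cut off, so without the edge it is reachable neither from `g` nor
    -- from the other endpoint `β`. Abstracting over the two endpoints treats both orientations of
    -- the edge at once.
    module _ {g F r} (C : ComponentOrder G g (inside Vec.∷ F) r) (α β : Fin n)
             (C-αa : ComponentOrder.component C α ≡ ComponentOrder.component C a)
             (C-αβ : ComponentOrder.component C α ≡ ComponentOrder.component C β)
             (¬gα : ¬ Reachable T F g α) (¬βα : ¬ Reachable T F β α)
             (via-αβ : ∀ {u v} → Reachable G (inside Vec.∷ F) u v → Via {R = Adjacent T F} {α} {β} u v) where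
      private
        module C = ComponentOrder C

        cutLabel : Fin n → Fin (2 ℕ.+ r)
        cutLabel v with reachable? T F v α
        ... | yes _ = suc zero
        ... | no _  = punchIn (suc zero) (C.component v)

        cutLabel-α : cutLabel α ≡ suc zero
        cutLabel-α with reachable? T F α α
        ... | yes _ = refl
        ... | no ¬p = ⊥-elim (¬p stop)

        cutLabel-away : ∀ {v} → ¬ Reachable T F v α → cutLabel v ≡ punchIn (suc zero) (C.component v)
        cutLabel-away {v} ¬vα with reachable? T F v α
        ... | yes p = ⊥-elim (¬vα p)
        ... | no _  = refl

        cutLabel-β : cutLabel β ≢ suc zero
        cutLabel-β eq = Finₚ.punchInᵢ≢i (suc zero) (C.component β) (trans (sym (cutLabel-away ¬βα)) eq)

        cutLabel-cases : ∀ v → (cutLabel v ≡ suc zero × C.component v ≡ C.component a) ⊎ cutLabel v ≡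
            punchIn (suc zero) (C.component v)
        cutLabel-cases v with reachable? T F v α
        ... | yes p = inj₁ (refl , trans (Equivalence.from (C.classes v α) (reachable-∷ p)) C-αa)
        ... | no _  = inj₂ refl

        to : ∀ u v → cutLabel u ≡ cutLabel v → Reachable T F u v
        to u v eq with reachable? T F u α | reachable? T F v α
        ... | yes p | yes q = p ◅◅ reachable-sym T q
        ... | yes _ | no _  = ⊥-elim (Finₚ.punchInᵢ≢i (suc zero) (C.component v) (sym eq))
        ... | no _  | yes _ = ⊥-elim (Finₚ.punchInᵢ≢i (suc zero) (C.component u) eq)
        ... | no ¬p | no ¬q with via-αβ (Equivalence.to (C.classes u v) (Finₚ.punchIn-injective (suc zero) _ _ eq))
        ...   | inj₁ t              = t
        ...   | inj₂ (inj₁ (t , _)) = ⊥-elim (¬p t)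
        ...   | inj₂ (inj₂ (_ , t)) = ⊥-elim (¬q (reachable-sym T t))

        from : ∀ u v → Reachable T F u v → cutLabel u ≡ cutLabel v
        from u v uv with reachable? T F u α | reachable? T F v α
        ... | yes _ | yes _ = refl
        ... | yes p | no ¬q = ⊥-elim (¬q (reachable-sym T uv ◅◅ p))
        ... | no ¬p | yes q = ⊥-elim (¬p (uv ◅◅ q))
        ... | no _  | no _  = cong (punchIn (suc zero)) (Equivalence.from (C.classes u v) (reachable-∷ uv))

        cutLabel-surjective : ∀ l → ∃ λ v → cutLabel v ≡ l
        cutLabel-surjective l with suc zero Finₚ.≟ l
        ... | yes refl = α , cutLabel-α
        ... | no 1≢l with C.surjective (punchOut 1≢l)
        ...   | v , v≡ with reachable? T F v α
        ...     | no ¬p = v , trans (cutLabel-away ¬p)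
            (trans (cong (punchIn (suc zero)) v≡) (Finₚ.punchIn-punchOut 1≢l))
        -- The chosen representative lies on the side cut off; `β` belonged to the same old
        -- component and stays behind.
        ...     | yes p = β , trans (cutLabel-away ¬βα) (trans (cong (punchIn (suc zero))
            (trans (sym C-αβ) (trans (sym (Equivalence.from (C.classes v α) (reachable-∷ p))) v≡)))
                (Finₚ.punchIn-punchOut 1≢l))

        cut : ComponentOrder T g F (suc r)
        cut = record
          { components = record { component = cutLabel ; surjective = cutLabel-surjective ; classes = λ u v
              → mk⇔ (to u v) (from u v) }
          ; ground     = trans (cutLabel-away ¬gα) (cong (punchIn (suc zero)) C.ground) }

      cut-split : (∀ (f : Fin n → Fin (2 ℕ.+ r)) → f α ≡ suc zero → f β ≢ suc zero →
                     (f a ≡ suc zero × f b ≢ suc zero) ⊎ (f b ≡ suc zero × f a ≢ suc zero)) → Split C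
      cut-split ends = record { order = cut ; ends = ends cutLabel cutLabel-α cutLabel-β ; label =
          cutLabel-cases }

    -- If `g` still reaches a, then b is the end to cut off. Otherwise a is; this includes the case
    -- where the edge lies outside the component of `g` and either end would do.
    split : ∀ {g F r} (C : ComponentOrder G g (inside Vec.∷ F) r) → ¬ Reachable T F a b → Split C
    split {g} {F} {r} C ¬ab = choose (reachable? T F g a)
      where
      C-ab : ComponentOrder.component C a ≡ ComponentOrder.component C b
      C-ab = Equivalence.from (ComponentOrder.classes C a b) reachable-first
      swap : ∀ {u v} → Via {R = Adjacent T F} {a} {b} u v → Via {R = Adjacent T F} {b} {a} u v
      swap (inj₁ p)        = inj₁ p
      swap (inj₂ (inj₁ p)) = inj₂ (inj₂ p)
      swap (inj₂ (inj₂ p)) = inj₂ (inj₁ p)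
      choose : Dec (Reachable T F g a) → Split C
      choose (yes ga) = cut-split C b a (sym C-ab) (sym C-ab) (λ gb → ¬ab (reachable-sym T ga ◅◅ gb)) ¬ab
        (swap ∘ reachable-inside) λ _ p q → inj₂ (p , q)
      choose (no ¬ga) = cut-split C a b refl C-ab ¬ga (¬ab ∘ reachable-sym T)
        reachable-inside λ _ p q → inj₁ (p , q)

  -- Greedy choice: an edge is taken exactly when the tree edges chosen among the later ones do not
  -- yet join its ends. Connectedness is lost when edges are removed, so the induction preserves
  -- reachability instead.
  spanningTree : ∀ (E : Edges n m) → ∃ λ T → Acyclic (graph E) T ×
      (∀ {u v} → Reachable (graph E) ⊤ u v → Reachable (graph E) T u v)
  spanningTree {m = zero}  E = Vec.[] , (λ where (_ , _ , _ , _ , _ , () , _)) , Star.map λ where (_ , () , _)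
  spanningTree {m = suc m} E with spanningTree (rest E)
  ... | T , acyclic , spans with reachable? (graph (rest E)) T (FirstEdge.a E) (FirstEdge.b E)
  ...   | yes p = outside Vec.∷ T , acyclic-outside acyclic , λ q → reachable-∷ (redirect (reachable-inside q))
    where
    open FirstEdge E
    redirect : ∀ {u v} → Via {R = Adjacent (graph (rest E)) ⊤} {a} {b} u v → Reachable (graph (rest E)) T u v
    redirect (inj₁ q)              = spans q
    redirect (inj₂ (inj₁ (q , t))) = spans q ◅◅ p ◅◅ spans t
    redirect (inj₂ (inj₂ (q , t))) = spans q ◅◅ reachable-sym (graph (rest E)) p ◅◅ spans t
  ...   | no ¬p = inside Vec.∷ T , acyclic-inside acyclic ¬p , λ q → redirect (reachable-inside q)
    where
    open FirstEdge E
    redirect : ∀ {u v} → Via {R = Adjacent (graph (rest E)) ⊤} {a} {b} u v → Reachable (graph E)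
        (inside Vec.∷ T) u v
    redirect (inj₁ q)              = reachable-∷ (spans q)
    redirect (inj₂ (inj₁ (q , t))) = reachable-∷ (spans q) ◅◅ reachable-first ◅◅ reachable-∷ (spans t)
    redirect (inj₂ (inj₂ (q , t))) = reachable-∷ (spans q) ◅◅ reachable-sym (graph E) reachable-first ◅◅
        reachable-∷ (spans t)

open Forests
open Forests.Edges using (graph)

-- Expansion over edge sets, the Laplacian as a Gram matrix, component sums.

module Expansion {a ℓ} (R : CommutativeRing a ℓ) where
  open CommutativeRing R hiding (zero) renaming (Carrier to A)
  open Network R using (Matrix; det; identity; [_]₀₁; sumSubsets; laplacian; basis)
  open Determinant R
  open Bordered R
  open Algebra.Properties.Ring ring using (-‿distribʳ-*; -0#≈0#; -1*x≈-x)
  open Algebra.Properties.Semiring.Sum semiring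
    using (sum-syntax; sum-cong-≋)
  open Algebra.Properties.CommutativeMonoid.Sum *-commutativeMonoid using () renaming (sum to product)
  open Algebra.Solver.Ring.NaturalCoefficients.Default commutativeSemiring using (solve; _:=_; _:+_; _:*_)
  open Relation.Binary.Reasoning.Setoid setoid

  private
    variable
      k m n r : ℕ

  sumSubsets-cong : ∀ {m} {f h : Subset m → A} → (∀ F → f F ≈ h F) → sumSubsets f ≈ sumSubsets h
  sumSubsets-cong {zero}  f≈h = f≈h Vec.[]
  sumSubsets-cong {suc m} f≈h = +-cong (sumSubsets-cong (f≈h ∘ (outside Vec.∷_)))
      (sumSubsets-cong (f≈h ∘ (inside Vec.∷_)))

  *-distribˡ-sumSubsets : ∀ {m} x (f : Subset m → A) → x * sumSubsets f ≈ sumSubsets λ F → x * f F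
  *-distribˡ-sumSubsets {zero}  x f = refl
  *-distribˡ-sumSubsets {suc m} x f = trans (distribˡ x _ _)
      (+-cong (*-distribˡ-sumSubsets {m} x _) (*-distribˡ-sumSubsets {m} x _))

  subsetProduct : (Fin m → A) → Subset m → A
  subsetProduct c F = product λ e → if Vec.lookup F e then c e else 1#

  weightedGram : (Fin m → Vector A n) → (Fin m → A) → Matrix n n
  weightedGram {m} b c i j = ∑[ e < m ] (c e * (b e i * b e j))

  -- The coefficient of the monomial of F in bordered X Y (weightedGram b c).
  coefficient : (Fin m → Vector A n) → Subset m → (X Y : Fin r → Vector A n) → A
  coefficient b Vec.[]             X Y = bordered X Y λ _ → 0ᵥ
  coefficient b (outside Vec.∷ F)  X Y = coefficient (tail b) F X Y
  coefficient b (inside  Vec.∷ F)  X Y = coefficient (tail b) F (b zero ∷ X) (b zero ∷ Y)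

  expansion : ∀ (b : Fin m → Vector A n) (c : Fin m → A) (X Y : Fin r → Vector A n) →
              bordered X Y (weightedGram b c) ≈ sumSubsets λ F → coefficient b F X Y * subsetProduct c F
  expansion {zero}  b c X Y = sym (*-identityʳ _)
  expansion {suc m} b c X Y = begin
    bordered X Y (weightedGram b c)
      ≈⟨ bordered-cong {X = X} {Y = Y} (λ _ _ → refl) (λ _ _ → refl) (λ i j → +-comm _ _) ⟩
    bordered X Y (λ i j → weightedGram (tail b) (tail c) i j + c zero * (b zero i * b zero j))
      ≈⟨ bordered-rank-one X Y (weightedGram (tail b) (tail c)) (c zero) (b zero) (b zero) ⟩
    bordered X Y (weightedGram (tail b) (tail c)) + c zero * bordered (b zero ∷ X) (b zero ∷ Y)
        (weightedGram (tail b) (tail c))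
      ≈⟨ +-cong (expansion (tail b) (tail c) X Y)
          (*-congˡ (expansion (tail b) (tail c) (b zero ∷ X) (b zero ∷ Y))) ⟩
    sumSubsets (λ F → without F * w F) + c zero * sumSubsets (λ F → with₀ F * w F)
      ≈⟨ +-cong (sumSubsets-cong λ F → *-congˡ {without F} (sym (*-identityˡ (w F))))
                (trans (*-distribˡ-sumSubsets (c zero) (λ F → with₀ F * w F))
                    (sumSubsets-cong λ F → solve 3 (λ x y z → x :* (y :* z) := y :* (x :* z)) refl (c zero)
                        (with₀ F) (w F))) ⟩
    sumSubsets (λ F → coefficient b F X Y * subsetProduct c F) ∎
    where
    w without with₀ : Subset m → A
    w = subsetProduct (tail c)
    without F = coefficient (tail b) F X Y
    with₀ F = coefficient (tail b) F (b zero ∷ X) (b zero ∷ Y)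

  module _ (G : SimpleGraph n) (c : Fin (SimpleGraph.size G) → A) where
    open SimpleGraph G
    open Bridges G

    -- Orienting each edge from `lo` to `hi` is an arbitrary choice; only products of two entries of
    -- the same edge occur in the Laplacian.
    incidence : Fin size → Vector A n
    incidence e v = identity n v (lo e) - identity n v (hi e)

    private
      at-lo : ∀ {e v} → lo e ≡ v → incidence e v ≈ 1#
      at-lo {e} ≡.refl = trans (+-cong (identity-diagonal (lo e))
          (trans (-‿cong (identity-off (lo≢hi e))) -0#≈0#)) (+-identityʳ 1#)

      at-hi : ∀ {e v} → hi e ≡ v → incidence e v ≈ - 1#
      at-hi {e} ≡.refl = trans (+-cong (identity-off (lo≢hi e ∘ ≡.sym)) (-‿cong (identity-diagonal (hi e))))
          (+-identityˡ _)

      elsewhere : ∀ {e v} → lo e ≢ v → hi e ≢ v → incidence e v ≈ 0#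
      elsewhere ≢lo ≢hi = trans (+-cong (identity-off (≢lo ∘ ≡.sym))
          (trans (-‿cong (identity-off (≢hi ∘ ≡.sym))) -0#≈0#)) (+-identityˡ _)

      diagonal : ∀ e v → (if does (incident? e v) then c e else 0#) ≈ c e * (incidence e v * incidence e v)
      diagonal e v with lo e Finₚ.≟ v | hi e Finₚ.≟ v
      ... | yes p | _     = sym (trans (*-congˡ (trans (*-cong (at-lo p) (at-lo p)) (*-identityˡ 1#)))
          (*-identityʳ _))
      ... | no _  | yes q = sym (trans (*-congˡ (trans (*-cong (at-hi q) (at-hi q)) -1*-1≈1)) (*-identityʳ _))
      ... | no ¬p | no ¬q = sym (x*0 (x*0 (elsewhere ¬p ¬q)))

      joined : ∀ {e u v} → Joins e u v → c e * (incidence e u * incidence e v) ≈ - c e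
      joined {e} (inj₁ (p , q)) = trans (*-congˡ (trans (*-cong (at-lo p) (at-hi q)) (*-identityˡ _)))
          (trans (*-comm _ _) (-1*x≈-x (c e)))
      joined {e} (inj₂ (p , q)) = trans (*-congˡ (trans (*-cong (at-hi q) (at-lo p)) (*-identityʳ _)))
          (trans (*-comm _ _) (-1*x≈-x (c e)))

      not-joined : ∀ {e u v} → u ≢ v → ¬ Joins e u v → c e * (incidence e u * incidence e v) ≈ 0#
      not-joined {e} {u} {v} u≢v ¬j with lo e Finₚ.≟ u | hi e Finₚ.≟ u | lo e Finₚ.≟ v | hi e Finₚ.≟ v
      ... | no ≢lo | no ≢hi | _      | _      = x*0 (0*x (elsewhere ≢lo ≢hi))
      ... | _      | _      | no ≢lo | no ≢hi = x*0 (x*0 (elsewhere ≢lo ≢hi))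
      ... | yes p  | _      | yes q  | _      = ⊥-elim (u≢v (≡.trans (≡.sym p) q))
      ... | yes p  | _      | _      | yes q  = ⊥-elim (¬j (inj₁ (p , q)))
      ... | _      | yes p  | yes q  | _      = ⊥-elim (¬j (inj₂ (q , p)))
      ... | _      | yes p  | _      | yes q  = ⊥-elim (u≢v (≡.trans (≡.sym p) q))

    -- On the diagonal each incident edge contributes the square of 1 or -1. Off the diagonal,
    -- simplicity of the graph leaves at most one edge, with entries of opposite sign.
    laplacian-gram : ∀ u v → laplacian G c u v ≈ weightedGram incidence c u v
    laplacian-gram u v with u Finₚ.≟ v
    ... | yes ≡.refl = sum-cong-≋ λ e → diagonal e u
    ... | no u≢v with Finₚ.any? (λ e → joins? e u v)
    ...   | yes (e , j) = sym (trans (sum-single (λ d → c d * (incidence d u * incidence d v)) e λ d d≢e →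
        not-joined u≢v λ i → d≢e (edge-unique i j)) (joined j))
    ...   | no ¬j       = sym (sum-zero λ e → not-joined u≢v λ i → ¬j (e , i))

  weightedGram-sym : ∀ (b : Fin m → Vector A n) c i j → weightedGram b c i j ≈ weightedGram b c j i
  weightedGram-sym b c i j = sum-cong-≋ λ e → *-congˡ {c e} (*-comm (b e i) (b e j))

  module Reduced {n} (g : Fin (suc n)) where

    -- Definitionally `incidence` with the coordinate `g` dropped, so that the Gram formula for the
    -- Laplacian restricts to the reduced one.
    edgeVector : (E : Edges (suc n) m) → Fin m → Vector A n
    edgeVector E e i = basis g (Edges.lo E e) i - basis g (Edges.hi E e) i

    module _ {G : SimpleGraph (suc n)} {F : Subset (SimpleGraph.size G)} {r} (C : ComponentOrder G g F r) where
      open ComponentOrder C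

      indicator : Matrix r n
      indicator α i = [ component (punchIn g i) Finₚ.≟ suc α ]₀₁

      -- The product of the quotient matrix with the vectors of `X` as columns; for columns of `D`
      -- its determinant is χ by definition.
      componentSums : (Fin k → Vector A n) → Matrix r k
      componentSums X α j = ∑[ i < n ] (indicator α i * X j i)

      labelled : Fin r → Fin (suc n) → A
      labelled α v = identity (suc r) (component v) (suc α)

      -- The case v = g is where the conventions meet: the unit vector of `g` is zero, and `g` lies
      -- in component zero, which has no row.
      indicator-basis : ∀ α v → ∑[ i < n ] (indicator α i * basis g v i) ≈ labelled α v
      indicator-basis α v with g Finₚ.≟ v
      ... | yes ≡.refl = trans (sum-zero λ i → x*0 {indicator α i} (identity-off (Finₚ.punchInᵢ≢i g i)))
                           (sym (identity-off λ eq → Finₚ.0≢1+n (≡.trans (≡.sym ground) eq)))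
      ... | no g≢v     = begin
        ∑[ i < n ] (indicator α i * basis g v i)
          ≈⟨ sum-cong-≋ (λ i → *-congˡ {indicator α i}
              (trans (reflexive (≡.cong (identity (suc n) (punchIn g i))
                  (≡.sym (Finₚ.punchIn-punchOut g≢v)))) (identity-punchIn g i (punchOut g≢v)))) ⟩
        ∑[ i < n ] (indicator α i * identity n i (punchOut g≢v))
          ≈⟨ sum-identityʳ (indicator α) (punchOut g≢v) ⟩
        indicator α (punchOut g≢v)
          ≈⟨ reflexive (≡.cong (λ v → labelled α v) (Finₚ.punchIn-punchOut g≢v)) ⟩
        labelled α v ∎

      indicator-edge : ∀ {m} (E : Edges (suc n) m) e α → ∑[ i < n ] (indicator α i * edgeVector E e i) ≈
                       labelled α (Edges.lo E e) - labelled α (Edges.hi E e)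
      indicator-edge E e α = begin
        ∑[ i < n ] (indicator α i * (basis g (lo e) i - basis g (hi e) i))
          ≈⟨ sum-cong-≋ (λ i → trans (distribˡ (indicator α i) _ _)
              (+-congˡ (trans (sym (-‿distribʳ-* _ _)) (sym (-1*x≈-x _))))) ⟩
        ∑[ i < n ] (indicator α i * basis g (lo e) i + - 1# * (indicator α i * basis g (hi e) i))
          ≈⟨ sum-linear (- 1#) (λ i → indicator α i * basis g (lo e) i)
              (λ i → indicator α i * basis g (hi e) i) ⟩
        (∑[ i < n ] (indicator α i * basis g (lo e) i)) + - 1# * (∑[ i < n ] (indicator α i * basis g (hi e) i))
          ≈⟨ +-cong (indicator-basis α (lo e)) (trans (-1*x≈-x _) (-‿cong (indicator-basis α (hi e)))) ⟩
        labelled α (lo e) - labelled α (hi e) ∎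
        where open Edges E using (lo; hi)

    -- Row reduction with pivot the new component's entry ±1 in the column of the deleted edge.
    split-det : ∀ (E : Edges (suc n) (suc m)) {F r} (C : ComponentOrder (graph E) g (inside Vec.∷ F) r) →
                (S : FirstEdge.Split E C) → ∃ λ ε → ε * ε ≈ 1# × ∀ (X : Fin r → Vector A n) →
                det (componentSums (FirstEdge.Split.order S) (edgeVector E zero ∷ X)) ≈ ε * det
                    (componentSums C X)
    split-det E {F} {r} C S = ε , ε² , λ X → begin
        det (componentSums order (b ∷ X))
          ≈⟨ pivot (componentSums order (b ∷ X)) u (column X) ⟩
        componentSums order (b ∷ X) zero zero * det
            (λ α j → componentSums order X (suc α) j + u α * componentSums order X zero j)
          ≈⟨ *-cong (indicator-edge order E zero zero) (det-cong λ α j → reduced (X j) α) ⟩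
        ε * det (componentSums C X) ∎
      where
      open FirstEdge.Split S
      module C = ComponentOrder C
      module O = ComponentOrder order
      x y : Fin (suc n)
      x = FirstEdge.a E
      y = FirstEdge.b E
      b : Vector A n
      b = edgeVector E zero
      ε : A
      ε = labelled order zero x - labelled order zero y
      ε² : ε * ε ≈ 1#
      ε² with ends
      ... | inj₁ (p , q) = trans (*-cong at at) (*-identityˡ 1#)
        where
        at : ε ≈ 1#
        at = trans (+-cong (trans (reflexive (≡.cong (λ l → identity _ l (suc zero)) p))
            (identity-diagonal {2 ℕ.+ r} (suc zero)))
               (trans (-‿cong (identity-off q)) -0#≈0#)) (+-identityʳ 1#)
      ... | inj₂ (p , q) = trans (*-cong at at) -1*-1≈1
        where
        at : ε ≈ - 1#
        at = trans (+-cong (identity-off q)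
               (-‿cong (trans (reflexive (≡.cong (λ l → identity _ l (suc zero)) p))
                   (identity-diagonal {2 ℕ.+ r} (suc zero))))) (+-identityˡ _)
      -- The row of the part cut off is added back to the row of the component of `C` it came from;
      -- nothing is added if that was the ground component, which has no row.
      u : Vector A r
      u α = labelled C α x
      shifted : ∀ α v → labelled order (suc α) v + u α * labelled order zero v ≈ labelled C α v
      shifted α v with label v
      ... | inj₁ (p , q) = begin
        identity _ (O.component v) (suc (suc α)) + u α * identity _ (O.component v) (suc zero)
          ≈⟨ reflexive (≡.cong (λ l → identity (2 ℕ.+ r) l (suc (suc α)) + u α * identity _ l (suc zero)) p) ⟩
        identity (2 ℕ.+ r) (suc zero) (suc (suc α)) + u α * identity (2 ℕ.+ r) (suc zero) (suc zero)
          ≈⟨ +-cong (identity-off {i = suc zero} {suc (suc α)} λ ())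
              (trans (*-congˡ (identity-diagonal {2 ℕ.+ r} (suc zero))) (*-identityʳ _)) ⟩
        0# + u α
          ≈⟨ +-identityˡ _ ⟩
        u α
          ≈⟨ reflexive (≡.cong (λ l → identity _ l (suc α)) (≡.sym q)) ⟩
        labelled C α v ∎
      ... | inj₂ p = begin
        identity _ (O.component v) (suc (suc α)) + u α * identity _ (O.component v) (suc zero)
          ≈⟨ reflexive (≡.cong (λ l → identity (2 ℕ.+ r) l (suc (suc α)) + u α * identity _ l (suc zero)) p) ⟩
        identity (2 ℕ.+ r) (punchIn (suc zero) (C.component v)) (suc (suc α)) + u α * identity (2 ℕ.+ r)
            (punchIn (suc zero) (C.component v)) (suc zero)
          ≈⟨ x+0 (x*0 (identity-off (Finₚ.punchInᵢ≢i (suc zero) (C.component v)))) ⟩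
        identity (2 ℕ.+ r) (punchIn (suc zero) (C.component v)) (suc (suc α))
          ≈⟨ identity-punchIn (suc zero) (C.component v) (suc α) ⟩
        labelled C α v ∎
      reduced : ∀ (z : Vector A n) α → (∑[ i < n ] (indicator order (suc α) i * z i)) + u α *
          (∑[ i < n ] (indicator order zero i * z i)) ≈
                ∑[ i < n ] (indicator C α i * z i)
      reduced z α = begin
        (∑[ i < n ] (indicator order (suc α) i * z i)) + u α * (∑[ i < n ] (indicator order zero i * z i))
          ≈⟨ sum-linear (u α) (λ i → indicator order (suc α) i * z i) (λ i → indicator order zero i * z i) ⟨
        ∑[ i < n ] (indicator order (suc α) i * z i + u α * (indicator order zero i * z i))
          ≈⟨ sum-cong-≋ (λ i → trans (solve 4 (λ p q u z → p :* z :+ u :* (q :* z) := (p :+ u :* q) :* z)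
              refl _ _ _ _) (*-congʳ {z i} (shifted α (punchIn g i)))) ⟩
        ∑[ i < n ] (indicator C α i * z i) ∎
      column : ∀ X α → componentSums order (b ∷ X) (suc α) zero + u α * componentSums order (b ∷ X) zero
          zero ≈ 0#
      column X α = begin
        componentSums order (b ∷ X) (suc α) zero + u α * componentSums order (b ∷ X) zero zero
          ≈⟨ reduced b α ⟩
        ∑[ i < n ] (indicator C α i * b i)
          ≈⟨ indicator-edge C E zero α ⟩
        labelled C α x - labelled C α y
          ≈⟨ +-congʳ (reflexive (≡.cong (λ l → identity _ l (suc α))
              (Equivalence.from (C.classes x y) (FirstEdge.reachable-first E)))) ⟩
        labelled C α y - labelled C α y
          ≈⟨ -‿inverseʳ _ ⟩
        0# ∎

-- Coefficients of forests and of other edge sets, and the resulting forest sums.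

emptyGraph-reachable : ∀ {n} (E : Edges n 0) {u v} → Reachable (graph E) Vec.[] u v → u ≡ v
emptyGraph-reachable E stop              = ≡.refl
emptyGraph-reachable E ((() , _ , _) ◅ _)

-- Without edges the label map is a bijection: it is injective, and so is the choice of a vertex for
-- each label.
emptyGraph-size : ∀ {n r} (E : Edges n 0) → Components (graph E) Vec.[] r → r ≡ n
emptyGraph-size E C = ℕₚ.≤-antisym
  (Finₚ.injective⇒≤ {f = λ l → proj₁ (surjective l)} λ {l} {l′} eq →
    ≡.trans (≡.sym (proj₂ (surjective l))) (≡.trans (≡.cong component eq) (proj₂ (surjective l′))))
  (Finₚ.injective⇒≤ {f = component} λ eq → emptyGraph-reachable E (Equivalence.to (classes _ _) eq))
  where open Components C

emptyGraph-forest : ∀ {n} (E : Edges n 0) → IsSpanningForest (graph E) n Vec.[]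
emptyGraph-forest E = (λ where (_ , _ , _ , _ , _ , () , _)) , record
  { component = id ; surjective = λ v → v , ≡.refl
  ; classes = λ u v → mk⇔ (λ where ≡.refl → stop) (emptyGraph-reachable E) }

connected⇒components : ∀ {n} {G : SimpleGraph (suc n)} {F} → Connected G F → Components G F 1
connected⇒components connected = record
  { component = λ _ → zero ; surjective = λ where zero → zero , ≡.refl
  ; classes = λ u v → mk⇔ (λ _ → connected u v) (λ _ → ≡.refl) }

components⇒connected : ∀ {n} {G : SimpleGraph n} {F} → Components G F 1 → Connected G F
components⇒connected C u v = Equivalence.to (classes u v) (single (component u) (component v))
  where
  open Components C
  single : ∀ (x y : Fin 1) → x ≡ y
  single zero zero = ≡.refl

module ForestSum {a ℓ} (R : CommutativeRing a ℓ) {n} (g : Fin (suc n)) where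
  open CommutativeRing R hiding (zero) renaming (Carrier to A)
  open Network R using (Matrix; det; _⊗_; _ᵀ; identity; IsInverse; sumSubsets; whenever; sumOver; weight; τ; reducedLaplacian)
  open Determinant R
  open Bordered R
  open Expansion R
  open Reduced g
  open Algebra.Properties.Semiring.Sum semiring
    using (sum-syntax; sum-cong-≋; ∑-comm; *-distribˡ-sum; *-distribʳ-sum)
  open Algebra.Solver.Ring.NaturalCoefficients.Default commutativeSemiring using (solve; _:=_; _:*_)
  open Relation.Binary.Reasoning.Setoid setoid

  private
    variable
      m r : ℕ

  sumOver-intro : ∀ {m} {P : Subset m → Set} (P? : Decidable P) (t : Subset m → A) (f : ∀ F → P F → A) →
                  (∀ F p → t F ≈ f F p) → (∀ F → ¬ P F → t F ≈ 0#) → sumSubsets t ≈ sumOver P? f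
  sumOver-intro {P = P} P? t f t≈f t≈0 = sumSubsets-cong λ F → term (P? F)
    where
    term : ∀ {F} (d : Dec (P F)) → t F ≈ whenever d (f F)
    term {F} (yes p) = t≈f F p
    term {F} (no ¬p) = t≈0 F ¬p

  sumOver-⇔ : ∀ {m} {P Q : Subset m → Set} (P? : Decidable P) (Q? : Decidable Q) (f : ∀ F → P F → A)
      (h : ∀ F → Q F → A) →
              (∀ F → P F → Q F) → (∀ F → Q F → P F) → (∀ F p q → f F p ≈ h F q) → sumOver P? f ≈ sumOver Q? h
  sumOver-⇔ {P = P} {Q} P? Q? f h P⇒Q Q⇒P f≈h = sumSubsets-cong λ F → term (P? F) (Q? F)
    where
    term : ∀ {F} (d : Dec (P F)) (e : Dec (Q F)) → whenever d (f F) ≈ whenever e (h F)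
    term {F} (yes p) (yes q) = f≈h F p q
    term {F} (no _)  (no _)  = refl
    term {F} (yes p) (no ¬q) = ⊥-elim (¬q (P⇒Q F p))
    term {F} (no ¬p) (yes q) = ⊥-elim (¬p (Q⇒P F q))

  module _ (E : Edges (suc n) 0) (C : ComponentOrder (graph E) g Vec.[] n) where
    open ComponentOrder C

    -- Every component is a single vertex, but in arbitrary order, so the indicator matrix is a
    -- permutation matrix. Its determinant is known only up to sign, and only its square is used.
    indicator-orthogonal : ∀ α β → (indicator C ⊗ indicator C ᵀ) α β ≈ identity n α β
    indicator-orthogonal α β with surjective (suc α)
    ... | v , v≡ with g Finₚ.≟ v
    ...   | yes ≡.refl = ⊥-elim (Finₚ.0≢1+n (≡.trans (≡.sym ground) v≡))
    ...   | no g≢v     = begin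
      ∑[ i < n ] (indicator C α i * indicator C β i)
        ≈⟨ sum-single (λ i → indicator C α i * indicator C β i) i₀ (λ i i≢i₀ → 0*x (identity-off λ eq →
             i≢i₀ (Finₚ.punchIn-injective g _ _
                 (emptyGraph-reachable E (Equivalence.to (classes _ _) (≡.trans eq (≡.sym at-i₀))))))) ⟩
      indicator C α i₀ * indicator C β i₀
        ≈⟨ *-cong (reflexive (≡.cong (λ l → identity (suc n) l (suc α)) at-i₀))
            (reflexive (≡.cong (λ l → identity (suc n) l (suc β)) at-i₀)) ⟩
      identity (suc n) (suc α) (suc α) * identity (suc n) (suc α) (suc β)
        ≈⟨ trans (*-congʳ (identity-diagonal {suc n} (suc α))) (*-identityˡ _) ⟩
      identity (suc n) (suc α) (suc β)
        ≈⟨ identity-punchIn {n} zero α β ⟩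
      identity n α β ∎
      where
      i₀ = punchOut g≢v
      at-i₀ : component (punchIn g i₀) ≡ suc α
      at-i₀ = ≡.trans (≡.cong component (Finₚ.punchIn-punchOut g≢v)) v≡

    det-indicator² : det (indicator C) * det (indicator C) ≈ 1#
    det-indicator² = begin
      det (indicator C) * det (indicator C)       ≈⟨ *-congˡ (det-transpose (indicator C)) ⟨
      det (indicator C) * det (indicator C ᵀ)     ≈⟨ det-⊗ (indicator C) (indicator C ᵀ) ⟨
      det (indicator C ⊗ indicator C ᵀ)           ≈⟨ det-cong indicator-orthogonal ⟩
      det (identity n)                            ≈⟨ det-identity n ⟩
      1#                                          ∎

    empty-coefficient : ∀ X Y → bordered X Y (λ _ → 0ᵥ) ≈ det (componentSums C X) * det (componentSums C Y)
    empty-coefficient X Y = begin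
      bordered X Y (λ _ → 0ᵥ)
        ≈⟨ bordered-square X Y ⟩
      det X * det Y
        ≈⟨ trans (*-congʳ det-indicator²) (*-identityˡ _) ⟨
      (det Q * det Q) * (det X * det Y)
        ≈⟨ solve 3 (λ q x y → (q :* q) :* (x :* y) := (q :* x) :* (q :* y)) refl _ _ _ ⟩
      (det Q * det X) * (det Q * det Y)
        ≈⟨ *-cong (factor X) (factor Y) ⟨
      det (componentSums C X) * det (componentSums C Y) ∎
      where
      Q = indicator C
      factor : ∀ X → det (componentSums C X) ≈ det Q * det X
      factor X = trans (det-⊗ Q (X ᵀ)) (*-congˡ (det-transpose X))

  -- Induction on the edges: deleting an edge of `F` adds a component and a border vector together,
  -- so r keeps counting the components other than that of `g`. With no edges left this forces r =
  -- n.
  forest-coefficient : ∀ (E : Edges (suc n) m) F (C : ComponentOrder (graph E) g F r) → Acyclic (graph E) F →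
                       ∀ X Y → coefficient (edgeVector E) F X Y ≈ det (componentSums C X) * det
                           (componentSums C Y)
  forest-coefficient {r = r} E Vec.[] C _ X Y =
    square (ℕₚ.suc-injective (emptyGraph-size E (ComponentOrder.components C))) C X Y
    where
    square : r ≡ n → ∀ (C : ComponentOrder (graph E) g Vec.[] r) X Y →
             bordered X Y (λ _ → 0ᵥ) ≈ det (componentSums C X) * det (componentSums C Y)
    square ≡.refl = empty-coefficient E
  forest-coefficient E (outside Vec.∷ F) C acyclic X Y =
    forest-coefficient (rest E) F
      (record { components = components-rest (ComponentOrder.components C) ; ground = ComponentOrder.ground C })
      (acyclic-rest acyclic) X Y
    where open FirstEdge E
  forest-coefficient {r = r} E (inside Vec.∷ F) C acyclic X Y = contracted (split-det E C S)
    where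
    open FirstEdge E using (Split; split; acyclic-first; acyclic-rest)
    S : Split C
    S = split C (acyclic-first acyclic)
    open Split S using (order)
    b = edgeVector E zero
    contracted : (∃ λ ε → ε * ε ≈ 1# × ∀ (X : Fin r → Vector A n) → det (componentSums order (b ∷ X)) ≈ ε *
        det (componentSums C X)) →
                 coefficient (edgeVector (rest E)) F (b ∷ X) (b ∷ Y) ≈ det (componentSums C X) * det
                     (componentSums C Y)
    contracted (ε , ε² , det-split) = begin
      coefficient (edgeVector (rest E)) F (b ∷ X) (b ∷ Y)
        ≈⟨ forest-coefficient (rest E) F order (acyclic-rest acyclic) (b ∷ X) (b ∷ Y) ⟩
      det (componentSums order (b ∷ X)) * det (componentSums order (b ∷ Y))
        ≈⟨ *-cong (det-split X) (det-split Y) ⟩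
      (ε * det (componentSums C X)) * (ε * det (componentSums C Y))
        ≈⟨ solve 3 (λ e x y → (e :* x) :* (e :* y) := (e :* e) :* (x :* y)) refl ε (det (componentSums C X))
            (det (componentSums C Y)) ⟩
      (ε * ε) * (det (componentSums C X) * det (componentSums C Y))
        ≈⟨ trans (*-congʳ ε²) (*-identityˡ _) ⟩
      det (componentSums C X) * det (componentSums C Y) ∎

  -- For a first edge in `F`: if the rest is a forest with r + 2 components, the edge must have both
  -- ends in one of them, and its column of component sums vanishes. Otherwise the induction
  -- continues with one more border vector.
  nonforest-coefficient : ∀ (E : Edges (suc n) m) F → ¬ IsSpanningForest (graph E) (suc r) F →
                          ∀ (X Y : Fin r → Vector A n) → coefficient (edgeVector E) F X Y ≈ 0#
  nonforest-coefficient E Vec.[] ¬forest X Y =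
    bordered-zero X Y λ where ≡.refl → ¬forest (emptyGraph-forest E)
  nonforest-coefficient E (outside Vec.∷ F) ¬forest X Y =
    nonforest-coefficient (rest E) F (λ (acyclic , C) → ¬forest
        (acyclic-outside acyclic , components-outside C)) X Y
    where open FirstEdge E
  nonforest-coefficient {r = r} E (inside Vec.∷ F) ¬forest X Y = byForest
      (isSpanningForest? (graph (rest E)) (2 ℕ.+ r) F)
    where
    open FirstEdge E using (acyclic-inside; merge)
    open Edges E using (lo; hi)
    b = edgeVector E zero
    closed : ∀ (C : Components (graph (rest E)) F (2 ℕ.+ r)) → Acyclic (graph (rest E)) F →
             Components.component C (lo zero) ≡ Components.component C (hi zero) →
             coefficient (tail (edgeVector E)) F (b ∷ X) (b ∷ Y) ≈ 0#
    closed C acyclic lo≡hi = begin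
      coefficient (tail (edgeVector E)) F (b ∷ X) (b ∷ Y)
        ≈⟨ forest-coefficient (rest E) F O acyclic (b ∷ X) (b ∷ Y) ⟩
      det (componentSums O (b ∷ X)) * det (componentSums O (b ∷ Y))
        ≈⟨ 0*x (det-zero-column (componentSums O (b ∷ X)) vanishing) ⟩
      0# ∎
      where
      O = componentOrder _ g C
      same : ComponentOrder.component O (lo zero) ≡ ComponentOrder.component O (hi zero)
      same = Equivalence.from (ComponentOrder.classes O _ _) (Equivalence.to (Components.classes C _ _) lo≡hi)
      vanishing : ∀ α → ∑[ i < n ] (indicator O α i * b i) ≈ 0#
      vanishing α = begin
        ∑[ i < n ] (indicator O α i * b i)               ≈⟨ indicator-edge O E zero α ⟩
        labelled O α (lo zero) - labelled O α (hi zero)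
            ≈⟨ +-congʳ (reflexive (≡.cong (λ l → identity _ l (suc α)) same)) ⟩
        labelled O α (hi zero) - labelled O α (hi zero)  ≈⟨ -‿inverseʳ _ ⟩
        0#                                               ∎
    byLabels : ∀ (C : Components (graph (rest E)) F (2 ℕ.+ r)) → Acyclic (graph (rest E)) F →
               Dec (Components.component C (lo zero) ≡ Components.component C (hi zero)) →
               coefficient (tail (edgeVector E)) F (b ∷ X) (b ∷ Y) ≈ 0#
    byLabels C acyclic (yes lo≡hi) = closed C acyclic lo≡hi
    byLabels C acyclic (no lo≢hi)  = ⊥-elim (¬forest
      (acyclic-inside acyclic (λ p → lo≢hi (Equivalence.from (Components.classes C _ _) p)) , merge C lo≢hi))
    byForest : Dec (IsSpanningForest (graph (rest E)) (2 ℕ.+ r) F) →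
               coefficient (tail (edgeVector E)) F (b ∷ X) (b ∷ Y) ≈ 0#
    byForest (yes (acyclic , C)) = byLabels C acyclic
        (Components.component C (lo zero) Finₚ.≟ Components.component C (hi zero))
    byForest (no ¬forest′)       = nonforest-coefficient (rest E) F ¬forest′ (b ∷ X) (b ∷ Y)

  module _ (G : SimpleGraph (suc n)) (c : Fin (SimpleGraph.size G) → A) where
    private
      E : Edges (suc n) (SimpleGraph.size G)
      E = edges G

      K : Matrix n n
      K = reducedLaplacian g G c

    forest-sum : ∀ (C : ∀ F → IsSpanningForest G (suc r) F → ComponentOrder G g F r)
        (X Y : Fin r → Vector A n) →
      bordered X Y K ≈ sumOver (isSpanningForest? G (suc r)) λ F forest →
        det (componentSums (C F forest) X) * det (componentSums (C F forest) Y) * weight G c F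
    forest-sum {r} C X Y = begin
      bordered X Y K
        ≈⟨ bordered-cong {X = X} {Y = Y} (λ _ _ → refl) (λ _ _ → refl)
            (λ i j → laplacian-gram G c (punchIn g i) (punchIn g j)) ⟩
      bordered X Y (weightedGram (edgeVector E) c)
        ≈⟨ expansion (edgeVector E) c X Y ⟩
      sumSubsets (λ F → coefficient (edgeVector E) F X Y * weight G c F)
        ≈⟨ sumOver-intro (isSpanningForest? G (suc r)) (λ F → coefficient (edgeVector E) F X Y * weight G c F)
             (λ F forest → det (componentSums (C F forest) X) * det (componentSums (C F forest) Y) * weight
                 G c F)
             (λ F forest → *-congʳ {weight G c F} (forest-coefficient E F (C F forest) (proj₁ forest) X Y))
             (λ F ¬forest → 0*x {weight G c F} (nonforest-coefficient E F ¬forest X Y)) ⟩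
      sumOver (isSpanningForest? G (suc r)) (λ F forest →
        det (componentSums (C F forest) X) * det (componentSums (C F forest) Y) * weight G c F) ∎

    det-reducedLaplacian : det K ≈ τ G c
    det-reducedLaplacian = trans
      (forest-sum (λ F forest → componentOrder G g (proj₂ forest)) [] [])
      (sumOver-⇔ (isSpanningForest? G 1) (isSpanningTree? G) (λ F _ → 1# * 1# * weight G c F)
          -- For r = 0 both component determinants are empty, hence 1, and a forest with one
          -- component is a spanning tree.
          (λ F _ → weight G c F)
        (λ F (acyclic , C) → acyclic , components⇒connected C)
        (λ F (acyclic , connected) → acyclic , connected⇒components connected)
        (λ F _ _ → trans (*-congʳ {weight G c F} (*-identityˡ 1#)) (*-identityˡ _)))

    reducedLaplacian-sym : ∀ i j → K i j ≈ K j i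
    reducedLaplacian-sym i j = begin
      K i j                              ≈⟨ laplacian-gram G c (punchIn g i) (punchIn g j) ⟩
      weightedGram (edgeVector E) c i j  ≈⟨ weightedGram-sym (edgeVector E) c i j ⟩
      weightedGram (edgeVector E) c j i  ≈⟨ laplacian-gram G c (punchIn g j) (punchIn g i) ⟨
      K j i                              ∎

    module _ (d : A) (τd≈1 : τ G c * d ≈ 1#) where

      private
        invertible : det K * d ≈ 1#
        invertible = trans (*-congʳ det-reducedLaplacian) τd≈1

      greenMatrix : Matrix n n
      greenMatrix = cramer K d invertible

      greenMatrix-inverse : IsInverse K greenMatrix
      greenMatrix-inverse = cramer-inverse K d invertible reducedLaplacian-sym

      -- Inserting det K times `d`, which is 1, turns the determinant into `d` times a bordered
      -- determinant of `K`, to which the forest sum applies.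
      det-green : ∀ (C : ∀ F → IsSpanningForest G (suc r) F → ComponentOrder G g F r)
          (X Y : Fin r → Vector A n) →
        det (λ i j → ∑[ v < n ] ((∑[ u < n ] (X i u * greenMatrix u v)) * Y j v)) ≈
        d * sumOver (isSpanningForest? G (suc r)) λ F forest →
          det (componentSums (C F forest) X) * det (componentSums (C F forest) Y) * weight G c F
      det-green {r} C X Y = begin
        det Z
          ≈⟨ trans (*-congˡ invertible) (*-identityʳ _) ⟨
        det Z * (det K * d)
          ≈⟨ solve 3 (λ z k d → z :* (k :* d) := d :* (z :* k)) refl _ _ _ ⟩
        d * (det Z * det K)
          ≈⟨ *-congˡ (bordered-jacobi X Y K XL cancelled) ⟨
        d * bordered X Y K
          ≈⟨ *-congˡ {d} (forest-sum C X Y) ⟩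
        d * sumOver (isSpanningForest? G (suc r)) (λ F forest →
          det (componentSums (C F forest) X) * det (componentSums (C F forest) Y) * weight G c F) ∎
        where
        L = greenMatrix
        XL : Matrix r n
        XL i v = ∑[ u < n ] (X i u * L u v)
        Z : Matrix r r
        Z i j = ∑[ v < n ] (XL i v * Y j v)
        cancelled : ∀ i k → ∑[ v < n ] (XL i v * K v k) ≈ X i k
        cancelled i k = begin
          ∑[ v < n ] (XL i v * K v k)
            ≈⟨ sum-cong-≋ (λ v → *-distribʳ-sum (K v k) (λ u → X i u * L u v)) ⟩
          ∑[ v < n ] ∑[ u < n ] (X i u * L u v * K v k)
            ≈⟨ ∑-comm (λ v u → X i u * L u v * K v k) ⟩
          ∑[ u < n ] ∑[ v < n ] (X i u * L u v * K v k)
            ≈⟨ sum-cong-≋ (λ u → sum-cong-≋ λ v → *-assoc (X i u) (L u v) (K v k)) ⟩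
          ∑[ u < n ] ∑[ v < n ] (X i u * (L u v * K v k))
            ≈⟨ sum-cong-≋ (λ u → *-distribˡ-sum (X i u) (λ v → L u v * K v k)) ⟨
          ∑[ u < n ] (X i u * (L ⊗ K) u k)
            ≈⟨ sum-cong-≋ (λ u → *-congˡ {X i u} (proj₂ greenMatrix-inverse u k)) ⟩
          ∑[ u < n ] (X i u * identity n u k)
            ≈⟨ sum-identityʳ (X i) k ⟩
          X i k ∎

-- Positivity of the spanning tree sum over the reals.

module Positivity where
  open Defs
  open Real using (Eventually; 0ℝ; 1ℝ; _+_)
  open Real.ℝ using (seq)
  open CommutativeRing Real.ℝ-commutativeRing using (*-commutativeMonoid)
  open Algebra.Properties.CommutativeMonoid.Sum *-commutativeMonoid using () renaming (sum to product)

  -- A condition on the representing sequence, sufficient for a nonnegative limit but not invariant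
  -- under `_≈_`. It suffices because adding such terms preserves the rational lower bound that
  -- witnesses positivity.
  NonNegative : ℝ → Set
  NonNegative x = Eventually λ n → 0ℚ ℚ.≤ seq x n

  both : ∀ {P Q : ℕ → Set} → Eventually P → Eventually Q → Eventually λ n → P n × Q n
  both (M , p) (N , q) = M ⊔ N , λ n le → p n (ℕₚ.m⊔n≤o⇒m≤o M N le) , q n (ℕₚ.m⊔n≤o⇒n≤o M N le)

  positive⇒nonNegative : ∀ {x} → Positive x → NonNegative x
  positive⇒nonNegative (δ , 0<δ , N , δ<x) = N , λ n le → ℚₚ.<⇒≤ (ℚₚ.<-trans 0<δ (δ<x n le))

  nonNegative-0 : NonNegative 0ℝ
  nonNegative-0 = 0 , λ _ _ → ℚₚ.≤-refl

  nonNegative-+ : ∀ {x y} → NonNegative x → NonNegative y → NonNegative (x + y)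
  nonNegative-+ 0≤x 0≤y = let N , le = both 0≤x 0≤y in N , λ n N≤n → let 0≤xₙ , 0≤yₙ = le n N≤n in
    ℚₚ.+-mono-≤ 0≤xₙ 0≤yₙ

  positive-+ˡ : ∀ {x y} → Positive x → NonNegative y → Positive (x + y)
  positive-+ˡ {x} {y} (δ , 0<δ , δ<x) 0≤y = δ , 0<δ , let N , le = both δ<x 0≤y in N , λ n N≤n → let δ<xₙ , 0≤yₙ = le n N≤n in
    subst (ℚ._< seq x n ℚ.+ seq y n) (ℚₚ.+-identityʳ δ) (ℚₚ.+-mono-<-≤ δ<xₙ 0≤yₙ)

  positive-+ʳ : ∀ {x y} → NonNegative x → Positive y → Positive (x + y)
  positive-+ʳ {x} {y} 0≤x (δ , 0<δ , δ<y) = δ , 0<δ , let N , le = both 0≤x δ<y in N , λ n N≤n → let 0≤xₙ , δ<yₙ = le n N≤n in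
    subst (ℚ._< seq x n ℚ.+ seq y n) (ℚₚ.+-identityˡ δ) (ℚₚ.+-mono-≤-< 0≤xₙ δ<yₙ)

  positive-1 : Positive 1ℝ
  -- The witness must lie strictly below every term of the constant sequence 1.
  positive-1 = ½ , ℚₚ.positive⁻¹ ½ , 0 , λ _ _ → from-yes (½ ℚₚ.<? 1ℚ)

  *-positive : ∀ {p q} → 0ℚ ℚ.< p → 0ℚ ℚ.< q → 0ℚ ℚ.< p ℚ.* q
  *-positive {p} {q} 0<p 0<q = ℚₚ.positive⁻¹ _ {{ℚₚ.pos*pos⇒pos p {{ℚ.positive 0<p}} q {{ℚ.positive 0<q}}}}

  positive-* : ∀ {x y} → Positive x → Positive y → Positive (x * y)
  positive-* {x} {y} (δ , 0<δ , δ<x) (ε , 0<ε , ε<y) = δ ℚ.* ε , *-positive 0<δ 0<ε ,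
    let N , lt = both δ<x ε<y in N , λ n N≤n → let δ<xₙ , ε<yₙ = lt n N≤n in
    ℚₚ.<-trans (ℚₚ.*-monoˡ-<-pos ε {{ℚ.positive 0<ε}} δ<xₙ)
      (ℚₚ.*-monoʳ-<-pos (seq x n) {{ℚ.positive (ℚₚ.<-trans 0<δ δ<xₙ)}} ε<yₙ)

  positive-product : ∀ {m} (t : Fin m → ℝ) → (∀ e → Positive (t e)) → Positive (product t)
  positive-product {zero}  t t>0 = positive-1
  positive-product {suc m} t t>0 = positive-* {t zero} {product (t ∘ suc)} (t>0 zero)
      (positive-product (t ∘ suc) (t>0 ∘ suc))

  nonNegative-sumSubsets : ∀ {m} (t : Subset m → ℝ) → (∀ F → NonNegative (t F)) → NonNegative (sumSubsets t)
  nonNegative-sumSubsets {zero}  t t≥0 = t≥0 Vec.[]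
  nonNegative-sumSubsets {suc m} t t≥0 = nonNegative-+ {sumSubsets (t ∘ (outside Vec.∷_))}
      {sumSubsets (t ∘ (inside Vec.∷_))}
    (nonNegative-sumSubsets _ (t≥0 ∘ (outside Vec.∷_))) (nonNegative-sumSubsets _ (t≥0 ∘ (inside Vec.∷_)))

  positive-sumSubsets : ∀ {m} (t : Subset m → ℝ) → (∀ F → NonNegative (t F)) → ∀ F → Positive (t F) →
      Positive (sumSubsets t)
  positive-sumSubsets t t≥0 Vec.[]            t>0 = t>0
  positive-sumSubsets t t≥0 (outside Vec.∷ F) t>0 = positive-+ˡ {sumSubsets (t ∘ (outside Vec.∷_))}
      {sumSubsets (t ∘ (inside Vec.∷_))}
    (positive-sumSubsets _ (t≥0 ∘ (outside Vec.∷_)) F t>0) (nonNegative-sumSubsets _ (t≥0 ∘ (inside Vec.∷_)))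
  positive-sumSubsets t t≥0 (inside Vec.∷ F)  t>0 = positive-+ʳ {sumSubsets (t ∘ (outside Vec.∷_))}
      {sumSubsets (t ∘ (inside Vec.∷_))}
    (nonNegative-sumSubsets _ (t≥0 ∘ (outside Vec.∷_))) (positive-sumSubsets _ (t≥0 ∘ (inside Vec.∷_)) F t>0)

  positive-sumOver : ∀ {m} {P : Subset m → Set} (P? : Decidable P) (f : ∀ F → P F → ℝ) →
                     (∀ F p → Positive (f F p)) → ∃ P → Positive (sumOver P? f)
  positive-sumOver {P = P} P? f f>0 (F , p) =
    positive-sumSubsets _ (λ F → term≥0 F (P? F)) F (term>0 (P? F))
    where
    term≥0 : ∀ F (d : Dec (P F)) → NonNegative (whenever d (f F))
    term≥0 F (yes p) = positive⇒nonNegative {f F p} (f>0 F p)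
    term≥0 F (no _)  = nonNegative-0
    term>0 : (d : Dec (P F)) → Positive (whenever d (f F))
    term>0 (yes p) = f>0 F p
    term>0 (no ¬p) = ⊥-elim (¬p p)

  positive-weight : ∀ {n} (G : SimpleGraph n) c → (∀ e → Positive (c e)) → ∀ F → Positive (weight G c F)
  positive-weight G c c>0 F = positive-product _ λ e → factor e (Vec.lookup F e)
    where
    factor : ∀ e b → Positive (if b then c e else 1ℝ)
    factor e true  = c>0 e
    factor e false = positive-1

  -- All weights are positive and the excluded edge sets contribute zero, so a single spanning tree,
  -- supplied by connectedness, gives the lower bound that `recip` requires.
  positive-τ : ∀ {n} (G : SimpleGraph n) c → (∀ e → Positive (c e)) → Connected G ⊤ → Positive (τ G c)
  positive-τ G c c>0 connected = positive-sumOver (isSpanningTree? G) (λ T _ → weight G c T)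
    (λ T _ → positive-weight G c c>0 T) (tree (spanningTree (edges G)))
    where
    tree : (∃ λ T → Acyclic G T × (∀ {u v} → Reachable G ⊤ u v → Reachable G T u v)) → ∃ (IsSpanningTree G)
    tree (T , acyclic , spans) = T , acyclic , λ u v → spans (connected u v)

-- The identity for minors of `Z` over the reals.

open import Defs
open SimpleGraph using (size)
open Superports using (p; root)
open NonRoots using (q)

theorem4p2 :
  ∀ {n : ℕ} (G : SimpleGraph (suc n)) → Connected G ⊤ →
  (c : Fin (size G) → ℝ) → (∀ e → Positive (c e)) →
  (P : Superports (suc n)) (N : NonRoots P) (a : Fin (p P)) →
  let g = root P a
      K = reducedLaplacian g G c
      D = rootDifferences g N
  in
  Σ (Positive (τ G c)) λ τ>0 →
  Σ (Matrix n n) λ K⁻¹ →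
  IsInverse K K⁻¹ ×
  (∀ (r : ℕ) (A B : Subset (q N)) (∣A∣≡r : card A ≡ r) (∣B∣≡r : card B ≡ r)
     (C : ∀ F → IsSpanningForest G (suc r) F → ComponentOrder G g F r) →
   let Z = D ᵀ ⊗ K⁻¹ ⊗ D in
   det (submatrix Z (select A ∣A∣≡r) (select B ∣B∣≡r))
     ≈ recip (τ G c) τ>0 * sumOver (isSpanningForest? G (suc r)) (λ F forest →
         χ g (C F forest) N A ∣A∣≡r * χ g (C F forest) N B ∣B∣≡r * weight G c F))
theorem4p2 G connected c c>0 P N a =
  τ>0 , greenMatrix G c τ⁻¹ τ-inverse , greenMatrix-inverse G c τ⁻¹ τ-inverse ,
  -- The border vectors are the selected columns of `D`. As `_⊗_` associates to the left, the
  -- entries of `Z` have the shape of `det-green` by definition, and the component determinants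
  -- unfold to χ.
  λ r A B ∣A∣≡r ∣B∣≡r C → det-green G c τ⁻¹ τ-inverse C
    (λ i v → rootDifferences (root P a) N v (select A ∣A∣≡r i))
    (λ j v → rootDifferences (root P a) N v (select B ∣B∣≡r j))
  where
  open ForestSum Real.ℝ-commutativeRing (root P a)
  τ>0 = Positivity.positive-τ G c c>0 connected
  τ⁻¹ = recip (τ G c) τ>0
  τ-inverse = Real.recip-inverseʳ (τ G c) τ>0
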